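{- Let $d\geq 3$ be an odd integer and let $\Sigma$ be a finite set of prime numbers. Let $\mathcal{W}_\Sigma$ be the set of rational maps $\phi(z)\in\mathbb{Q}(z)$ of degree $d$ with $2d$-power free resultant and good reduction at all primes $p\in \Sigma$. Then: (1) each rational map $\phi\in \mathcal{W}_\Sigma$ has globally minimal resultant; (2) $\mathcal{W}_\Sigma$ has positive height density. Consequently, with respect to the height density, a positive proportion of rational maps of degree $d$ have good reduction at all primes $p\in \Sigma$ and globally minimal resultant.
   Context: A rational map $\phi\in\mathbb{Q}(z)$ of degree $d$ is written in homogeneous form $\phi(X/Y)=F(X,Y)/G(X,Y)$ with $F=\sum_{i=0}^d A_iX^iY^{d-i}$, $G=\sum_{j=0}^d B_jX^jY^{d-j}$ coprime, where $(A_0,\dots,A_d,B_0,\dots,B_d)\in\mathbb{Z}^{2d+2}$ has $\gcd=1$ and first nonzero coordinate positive; this identifies $\phi$ with a point of $\mathbb{P}^{2d+1}(\mathbb{Q})$. The resultant $\mathrm{Res}(\phi)$ is $\mathrm{Res}(F,G)$. $\phi$ has good reduction at $p$ iff $p\nmid \mathrm{Res}(\phi)$. The height $H(\phi)$ is $\max\{|A_i|,|B_j|\}$. For $\phi$ and $A\in\mathrm{PGL}_2(\mathbb{Q})$, let $\epsilon_p(\phi)$ be the minimum of $\mathrm{ord}_p(\mathrm{Res}(A^{ -1}\circ\phi\circ A))$ over $A\in\mathrm{PGL}_2(\mathbb{Q})$; the minimal resultant is $\prod_p p^{\epsilon_p(\phi)}$, and $\phi$ is globally minimal if this equals $|\mathrm{Res}(\phi)|$.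 The height density of a set $\mathcal{S}$ of such points is $\lim_{x\to\infty}\#\{P\in\mathcal{S}: H(P)\le x\}/\#\{P\in\mathbb{P}^{2d+1}(\mathbb{Q}):H(P)\le x\}$ (equivalently with the denominator replaced by the number of degree-$d$ rational maps of height $\le x$). -}

module Defs where

open import Data.Nat as ℕ using (ℕ; zero; suc; _≤_; _<_; _⊔_; _<ᵇ_; _≤ᵇ_; _∸_; ∣_-_∣)
open import Data.Nat.Divisibility using (_∣_)
open import Data.Nat.GCD using (gcd)
open import Data.Nat.Primality using (Prime)
open import Data.Integer as ℤ using (ℤ; +_; -[1+_]; ∣_∣)
open import Data.Integer.DivMod using (_/ℕ_)
open import Data.Fin using (Fin; toℕ; punchIn)
import Data.Fin as Fin
open import Data.Vec using (Vec; []; _∷_; take; drop; toList)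
open import Data.List as List using (List; length)
open import Data.List.Relation.Unary.All using (All)
open import Data.List.Relation.Unary.Unique.Propositional using (Unique)
open import Data.List.Membership.Propositional using (_∈_)
open import Data.Product using (Σ; _×_; ∃)
open import Data.Unit using (⊤)
open import Data.Empty using (⊥)
open import Data.Bool using (if_then_else_; _∧_)
open import Function.Bundles using (_⇔_)
open import Relation.Nullary using (¬_)
open import Relation.Binary.PropositionalEquality using (_≡_; _≢_)

-- Binary forms: a homogeneous form of degree n is given by its
-- coefficient function k ↦ (coefficient of X^k Y^(n-k)); only
-- k = 0..n are relevant.

Form : Set
Form = ℕ → ℤ

sumTo : ℕ → (ℕ → ℤ) → ℤ
sumTo zero    f = + 0
sumTo (suc n) f = f n ℤ.+ sumTo n f

mulF : Form → Form → Form
mulF f g k = sumTo (suc k) (λ i → f i ℤ.* g (k ∸ i))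

oneF : Form
oneF zero    = + 1
oneF (suc _) = + 0

linF : ℤ → ℤ → Form
linF a b zero          = b
linF a b (suc zero)    = a
linF a b (suc (suc _)) = + 0

powF : Form → ℕ → Form
powF f zero    = oneF
powF f (suc n) = mulF f (powF f n)

composeF : ℕ → Form → ℤ → ℤ → ℤ → ℤ → Form
composeF d F a b c e k =
  sumTo (suc d) (λ i → F i ℤ.* mulF (powF (linF a b) i) (powF (linF c e) (d ∸ i)) k)

toForm : ∀ {n} → Vec ℤ n → Form
toForm []       _       = + 0
toForm (x ∷ xs) zero    = x
toForm (x ∷ xs) (suc k) = toForm xs k

sumFin : ∀ {n} → (Fin n → ℤ) → ℤ
sumFin {zero}  f = + 0
sumFin {suc n} f = f Fin.zero ℤ.+ sumFin (λ j → f (Fin.suc j))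

alt : ℕ → ℤ
alt zero    = + 1
alt (suc k) = ℤ.- alt k

det : (n : ℕ) → (Fin n → Fin n → ℤ) → ℤ
det zero    M = + 1
det (suc n) M =
  sumFin (λ j → alt (toℕ j) ℤ.* M Fin.zero j ℤ.* det n (λ r c → M (Fin.suc r) (punchIn j c)))

sylRow : ℕ → Form → ℕ → ℕ → ℤ
sylRow d f i j = if (i ≤ᵇ j) ∧ ((j ∸ i) ≤ᵇ d) then f (d ∸ (j ∸ i)) else + 0

sylvester : (d : ℕ) → Form → Form → Fin (d ℕ.+ d) → Fin (d ℕ.+ d) → ℤ
sylvester d f g r c =
  if toℕ r <ᵇ d then sylRow d f (toℕ r) (toℕ c) else sylRow d g (toℕ r ∸ d) (toℕ c)

resF : (d : ℕ) → Form → Form → ℤ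
resF d f g = det (d ℕ.+ d) (sylvester d f g)

-- Rational maps of degree d as coefficient vectors
-- (A_0,…,A_d,B_0,…,B_d) ∈ ℤ^(2d+2)

Coeffs : ℕ → Set
Coeffs d = Vec ℤ (suc d ℕ.+ suc d)

Fpart : ∀ {d} → Coeffs d → Form
Fpart {d} v = toForm (take (suc d) v)

Gpart : ∀ {d} → Coeffs d → Form
Gpart {d} v = toForm (drop (suc d) v)

Res : ∀ {d} → Coeffs d → ℤ
Res {d} v = resF d (Fpart v) (Gpart v)

gcdList : List ℤ → ℕ
gcdList = List.foldr (λ a g → gcd ∣ a ∣ g) 0

firstNonzeroPos : List ℤ → Set
firstNonzeroPos List.[]                  = ⊥
firstNonzeroPos ((+ zero) List.∷ xs)     = firstNonzeroPos xs
firstNonzeroPos ((+ suc _) List.∷ _)     = ⊤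
firstNonzeroPos (-[1+ _ ] List.∷ _)      = ⊥

-- normalized representative of a point of P^(2d+1)(ℚ):
-- gcd of coordinates is 1 and the first nonzero coordinate is positive
IsPoint : ∀ {d} → Coeffs d → Set
IsPoint v = gcdList (toList v) ≡ 1 × firstNonzeroPos (toList v)

height : ∀ {n} → Vec ℤ n → ℕ
height v = List.foldr (λ a m → ∣ a ∣ ⊔ m) 0 (toList v)

-- Conjugation A⁻¹ ∘ φ ∘ A for A = [[a, b], [c, e]] ∈ GL₂ with integer
-- entries (every class in PGL₂(ℚ) has such a representative);
-- A⁻¹ is represented (up to scalar) by the adjugate [[e, -b], [-c, a]].

conjF : (d : ℕ) → Form → Form → ℤ → ℤ → ℤ → ℤ → Form
conjF d F G a b c e k =
  e ℤ.* composeF d F a b c e k ℤ.- b ℤ.* composeF d G a b c e k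

conjG : (d : ℕ) → Form → Form → ℤ → ℤ → ℤ → ℤ → Form
conjG d F G a b c e k =
  ℤ.- c ℤ.* composeF d F a b c e k ℤ.+ a ℤ.* composeF d G a b c e k

coeffList : ℕ → Form → List ℤ
coeffList d f = List.map f (List.upTo (suc d))

divBy : ℤ → ℕ → ℤ
divBy x zero    = x
divBy x (suc m) = x /ℕ suc m

-- resultant of the normalized (primitive) representative of A⁻¹ ∘ φ ∘ A
-- (the sign normalization does not affect ord_p and is omitted)
conjRes : ∀ {d} → Coeffs d → ℤ → ℤ → ℤ → ℤ → ℤ
conjRes {d} v a b c e =
  let F' = conjF d (Fpart v) (Gpart v) a b c e
      G' = conjG d (Fpart v) (Gpart v) a b c e
      g  = gcdList (coeffList d F' List.++ coeffList d G')
  in resF d (λ k → divBy (F' k) g) (λ k → divBy (G' k) g)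

Ord : ℕ → ℤ → ℕ → Set
Ord p z k = (p ℕ.^ k ∣ ∣ z ∣) × ¬ (p ℕ.^ suc k ∣ ∣ z ∣)

-- ε_p(φ) = ord_p(Res φ), i.e. ord_p(Res φ) is the minimum over A ∈ PGL₂(ℚ)
-- of ord_p(Res(A⁻¹ ∘ φ ∘ A))
MinimalAt : ∀ {d} → ℕ → Coeffs d → Set
MinimalAt p v =
  ∀ (a b c e : ℤ) → a ℤ.* e ℤ.- b ℤ.* c ≢ + 0 →
  ∀ k₁ k₂ → Ord p (Res v) k₁ → Ord p (conjRes v a b c e) k₂ → k₁ ≤ k₂

-- globally minimal: ∏_p p^{ε_p(φ)} = |Res φ|, i.e. ε_p(φ) = ord_p(Res φ) for all p
GloballyMinimal : ∀ {d} → Coeffs d → Set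
GloballyMinimal v = ∀ p → Prime p → MinimalAt p v

PowerFree : ℕ → ℤ → Set
PowerFree k z = ∀ p → Prime p → ¬ (p ℕ.^ k ∣ ∣ z ∣)

-- 𝒲_Σ : degree-d maps (Res ≠ 0) with 2d-power free resultant and good
-- reduction at every p ∈ Σ
W : (d : ℕ) → List ℕ → Coeffs d → Set
W d S v =
  IsPoint v × (Res v ≢ + 0) × PowerFree (d ℕ.+ d) (Res v) × All (λ p → ¬ (p ∣ ∣ Res v ∣)) S

CountIs : ∀ {n} → (Vec ℤ n → Set) → ℕ → Set
CountIs {n} P m =
  Σ (List (Vec ℤ n)) λ l → Unique l × (∀ v → (v ∈ l) ⇔ P v) × length l ≡ m

CountH : ∀ {d} → (Coeffs d → Set) → ℕ → ℕ → Set
CountH P x m = CountIs (λ v → P v × height v ≤ x) m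

-- height density of P (as a subset of P^(2d+1)(ℚ)) exists and is positive:
-- the ratio r(x) = S(x)/T(x) is Cauchy and bounded below by a positive
-- rational 1/(m+1) for large x.
PositiveHeightDensity : (d : ℕ) → (Coeffs d → Set) → Set
PositiveHeightDensity d P =
  (∀ k → ∃ λ N → ∀ x y → N ≤ x → N ≤ y →
     ∀ sx tx sy ty →
     CountH P x sx → CountH (IsPoint {d}) x tx →
     CountH P y sy → CountH (IsPoint {d}) y ty →
     suc k ℕ.* ∣ sx ℕ.* ty - sy ℕ.* tx ∣ < tx ℕ.* ty)
  × (∃ λ m → ∃ λ N → ∀ x → N ≤ x → ∀ s t →
     CountH P x s → CountH (IsPoint {d}) x t → t ≤ suc m ℕ.* s)

{-# OPTIONS --safe #-}
module Submission where

-- Global minimality.  Conjugating by A with determinant δ multiplies the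
-- resultant by δ^(d(d+1)), and dividing out the content g divides it by
-- g^(2d).  For odd d both exponents are multiples of 2d, so ord_p(Res)
-- only changes by multiples of 2d; if it is below 2d it is minimal.
-- The transformation rule comes from the exterior algebra, with the
-- Sylvester matrix read as the wedge of the multiples of F and of G.
--
-- Density.  The conditions at the primes up to M are periodic, so the
-- points satisfying them have a computable density.  At p > M only
-- p^(2d) ∣ Res matters.  Here Res is a polynomial of degree d in A₀ with
-- leading coefficient ± B_d^d; if p ∤ B_d, then p^(d+1) ∣ Res confines A₀
-- to d classes modulo p².  Since p is at most a constant times the height
-- x, the loss is at most a constant times x (∑ 1/p²) + π(c x) in the A₀
-- direction, which is small because π(x) = o(x).  The case p ∣ B_d is a
-- pair of conditions modulo p.  Positivity of the density follows from
-- the same estimate inside the residue class of X^d / Y^d, which has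
-- resultant 1.

open import Defs
open import Data.Nat using (ℕ; zero; suc; _+_; _*_; _∸_; _^_; _≤_; _<_; z≤n; s≤s; NonZero; pred)
import Data.Nat as ℕ
open import Data.Nat.Properties using
  ( module ≤-Reasoning; *-assoc; *-cancelʳ-≡; *-cancelʳ-≤; *-cancelˡ-<; *-cancelˡ-≡; *-cancelˡ-≤;
    *-comm; *-distribʳ-+; *-distribˡ-+; *-distribˡ-∣-∣; *-identityʳ; *-identityˡ; *-mono-<;
    *-mono-≤; *-monoʳ-≤; *-monoˡ-<; *-monoˡ-≤; *-suc; *-zeroʳ; +-assoc; +-cancelʳ-≤; +-cancelˡ-≡;
    +-cancelˡ-≤; +-comm; +-identityʳ; +-mono-≤; +-monoʳ-<; +-monoʳ-≤; +-monoˡ-≤; +-suc;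
    +-∸-assoc; 1+n≢0; 1≤n!; <-trans; <⇒≢; <⇒≤; <⇒≱; >⇒≢; ^-*-assoc; ^-distribˡ-+-*; ^-monoʳ-<;
    ^-monoˡ-<; ^-zeroˡ; allUpTo?; m*n≡0⇒m≡0∨n≡0; m*n≢0; m+[n∸m]≡n; m+n∸m≡n; m+n∸n≡m; m+n≤o⇒m≤o∸n;
    m<m*n; m<m+n; m<n⇒0<n∸m; m<n⇒m<1+n; m^n>0; m^n≢0; m∸[m∸n]≡n; m∸n≤m; m≤m+n; m≤m⊔n; m≤n+m;
    m≤n+o⇒m∸n≤o; m≤n⇒m≤1+n; m≤n⇒∃[o]m+o≡n; m≤n⊔m; n<1+n; n∸n≡0; n≢0⇒n>0; n≤1+n; suc-pred;
    ∣m-n∣≡[m∸n]∨[n∸m]; ∸-monoʳ-<; ∸-monoˡ-<; ≤-<-trans; ≤-antisym; ≤-pred; ≤-refl; ≤-reflexive;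
    ≤-total; ≤-trans; ≤ᵇ⇒≤; ≤⇒≤ᵇ; ≤∧≢⇒<; ≮⇒≥; ≰⇒>; ⊔-lub )
open import Data.Nat.Divisibility using (_∣_; divides; _∣?_)
import Data.Nat.Divisibility as Div
import Data.Nat.DivMod as DM
open import Data.Nat.Primality using (Prime)
import Data.Nat.Primality as Pr
import Data.Nat.Tactic.RingSolver as ℕ-Ring
open import Data.Integer as ℤ using (ℤ; +_; -[1+_])
import Data.Integer.Properties as ℤₚ
import Data.Integer.Tactic.RingSolver as ℤ-Ring
open import Data.Fin using (Fin; toℕ; punchIn) renaming (zero to fzero; suc to fsuc)
import Data.Fin as Fin
import Data.Fin.Properties as Finₚ
open import Data.Vec using (Vec; []; _∷_)
import Data.Vec as Vec
open import Data.List using (List)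
import Data.List as List
open import Data.List.Relation.Unary.All using (All)
import Data.List.Relation.Unary.All as All
open import Data.Product using (_×_; _,_; ∃; proj₁; proj₂)
open import Data.Sum using (_⊎_; inj₁; inj₂; [_,_]′)
open import Data.Empty using (⊥; ⊥-elim)
open import Data.Unit using (⊤; tt)
open import Function using (_∘_)
open import Relation.Nullary using (¬_; Dec; yes; no; ¬?; _×-dec_; _⊎-dec_)
open import Relation.Binary.PropositionalEquality using (_≡_; _≢_; refl; sym; trans; cong; cong₂; subst; subst₂; module ≡-Reasoning)
open import Data.Bool using (true; false; _∧_)
open import Data.Bool.Properties using (T-≡; ¬-not)
open import Function.Bundles using (Equivalence; _⇔_; mk⇔)
open import Data.Nat.GCD using (gcd[m,n]∣m; gcd[m,n]∣n; gcd-greatest)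
import Data.Integer.DivMod as ℤDM
open import Data.List.Membership.Propositional using (_∈_)
import Data.List.Membership.Propositional.Properties as ∈ₚ
open import Data.List.Relation.Unary.Any using (here; there)
import Data.Integer.Divisibility.Signed as ℤS
import Data.Vec.Properties as Vecₚ
import Data.Nat.Combinatorics as Comb
open import Data.List.Relation.Unary.Unique.Propositional using (Unique)
import Data.List.Relation.Unary.Unique.Propositional.Properties as Uniqueₚ
import Data.List.Relation.Unary.AllPairs as AllPairs
import Relation.Nullary.Decidable as Dec
import Data.List.Properties as Listₚ
import Data.Nat.Primality.Factorisation as Fact
open import Data.List.Membership.DecPropositional ℕ._≟_ using (_∈?_)

-- The transformation rule is a matrix identity: the Sylvester matrix of (F, G) times the matrix of
-- the substitution on forms of degree 2d - 1 equals two diagonal copies of the matrix on forms of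
-- degree d - 1 times the Sylvester matrix of the substituted pair. The determinants of these
-- matrices are computed for triangular substitutions only; factoring and cancelling give the rest.
--
-- In the density the relevant primes range up to a constant multiple of x, the length of a fibre,
-- and each adds a bounded rounding error to the count in a fibre. Varying two coordinates makes the
-- total negligible; where only A₀ is varied, the sparsity of the primes has to do it. Points with
-- Res = 0 are caught by one auxiliary prime p₀ above the cut-off M.
--
-- The denominator of the density counts primitive points rather than all vectors, so it is
-- estimated by the same sieve as the numerator, and the two proportions are compared at two heights
-- without evaluating a limit. M is fixed before the modulus (M!)^(2d), so the tail bound has to be
-- uniform in the step of the progressions.

-- The exterior algebra of ℤⁿ: ω₀ ⊞ ω₁ stands for ω₀ + e₀ ∧ ω₁, where
-- e₀ does not occur in ω₀ and ω₁.
data Ext : ℕ → Set where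
  ⟨_⟩ : ℤ → Ext 0
  _⊞_ : ∀ {n} → Ext n → Ext n → Ext (suc n)

Vect : ℕ → Set
Vect n = Fin n → ℤ

infixl 6 _⊕_
infixr 7 _·_

_⊕_ : ∀ {n} → Ext n → Ext n → Ext n
⟨ x ⟩ ⊕ ⟨ y ⟩ = ⟨ x ℤ.+ y ⟩
(a ⊞ b) ⊕ (c ⊞ d) = (a ⊕ c) ⊞ (b ⊕ d)

_·_ : ∀ {n} → ℤ → Ext n → Ext n
k · ⟨ x ⟩ = ⟨ k ℤ.* x ⟩
k · (a ⊞ b) = (k · a) ⊞ (k · b)

0E : ∀ {n} → Ext n
0E {zero}  = ⟨ + 0 ⟩
0E {suc n} = 0E ⊞ 0E

unit : ∀ {n} → Ext n
unit {zero}  = ⟨ + 1 ⟩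
unit {suc n} = unit ⊞ 0E

vol : ∀ {n} → Ext n
vol {zero}  = ⟨ + 1 ⟩
vol {suc n} = 0E ⊞ vol

top : ∀ {n} → Ext n → ℤ
top ⟨ x ⟩ = x
top (a ⊞ b) = top b

neg : ∀ {n} → Ext n → Ext n
neg ω = ℤ.- (+ 1) · ω

-- With `v = v₀ e₀ + v'`, expand `v ∧ (a + e₀ ∧ b)`; the sign comes from `v' ∧ e₀ = - e₀ ∧ v'`. In
-- dimension 0 the only vector is 0.
wedge : ∀ {n} → Vect n → Ext n → Ext n
wedge v ⟨ x ⟩   = ⟨ + 0 ⟩
wedge v (a ⊞ b) = wedge (v ∘ fsuc) a ⊞ (v fzero · a ⊕ neg (wedge (v ∘ fsuc) b))

wedgeAll : ∀ {n} k → (Fin k → Vect n) → Ext n → Ext n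
wedgeAll zero    N ω = ω
wedgeAll (suc k) N ω = wedge (N fzero) (wedgeAll k (N ∘ fsuc) ω)

detE : ∀ n → (Fin n → Vect n) → ℤ
detE n N = top (wedgeAll n N unit)

-- Linearity and anticommutativity of the wedge product

⊕-identityˡ : ∀ {n} (a : Ext n) → 0E ⊕ a ≡ a
⊕-identityˡ ⟨ x ⟩ = cong ⟨_⟩ (ℤₚ.+-identityˡ x)
⊕-identityˡ (a ⊞ b) = cong₂ _⊞_ (⊕-identityˡ a) (⊕-identityˡ b)

⊕-identityʳ : ∀ {n} (a : Ext n) → a ⊕ 0E ≡ a
⊕-identityʳ ⟨ x ⟩ = cong ⟨_⟩ (ℤₚ.+-identityʳ x)
⊕-identityʳ (a ⊞ b) = cong₂ _⊞_ (⊕-identityʳ a) (⊕-identityʳ b)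

⊕-interchange : ∀ {n} (a b c d : Ext n) → (a ⊕ b) ⊕ (c ⊕ d) ≡ (a ⊕ c) ⊕ (b ⊕ d)
⊕-interchange ⟨ a ⟩ ⟨ b ⟩ ⟨ c ⟩ ⟨ d ⟩ = cong ⟨_⟩ (leaf a b c d)
  where
  leaf : ∀ a b c d → (a ℤ.+ b) ℤ.+ (c ℤ.+ d) ≡ (a ℤ.+ c) ℤ.+ (b ℤ.+ d)
  leaf = ℤ-Ring.solve-∀
⊕-interchange (a ⊞ a') (b ⊞ b') (c ⊞ c') (d ⊞ d') =
  cong₂ _⊞_ (⊕-interchange a b c d) (⊕-interchange a' b' c' d')

·-distribˡ-⊕ : ∀ {n} k (a b : Ext n) → k · (a ⊕ b) ≡ k · a ⊕ k · b
·-distribˡ-⊕ k ⟨ x ⟩ ⟨ y ⟩ = cong ⟨_⟩ (ℤₚ.*-distribˡ-+ k x y)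
·-distribˡ-⊕ k (a ⊞ a') (b ⊞ b') = cong₂ _⊞_ (·-distribˡ-⊕ k a b) (·-distribˡ-⊕ k a' b')

·-distribʳ-⊕ : ∀ {n} j k (a : Ext n) → (j ℤ.+ k) · a ≡ j · a ⊕ k · a
·-distribʳ-⊕ j k ⟨ x ⟩ = cong ⟨_⟩ (ℤₚ.*-distribʳ-+ x j k)
·-distribʳ-⊕ j k (a ⊞ b) = cong₂ _⊞_ (·-distribʳ-⊕ j k a) (·-distribʳ-⊕ j k b)

·-assoc : ∀ {n} j k (a : Ext n) → j · (k · a) ≡ (j ℤ.* k) · a
·-assoc j k ⟨ x ⟩ = cong ⟨_⟩ (sym (ℤₚ.*-assoc j k x))
·-assoc j k (a ⊞ b) = cong₂ _⊞_ (·-assoc j k a) (·-assoc j k b)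

·-comm : ∀ {n} j k (a : Ext n) → j · (k · a) ≡ k · (j · a)
·-comm j k a = trans (·-assoc j k a) (trans (cong (_· a) (ℤₚ.*-comm j k)) (sym (·-assoc k j a)))

·-zeroˡ : ∀ {n} (a : Ext n) → + 0 · a ≡ 0E
·-zeroˡ ⟨ x ⟩ = refl
·-zeroˡ (a ⊞ b) = cong₂ _⊞_ (·-zeroˡ a) (·-zeroˡ b)

·-zeroʳ : ∀ {n} k → k · 0E {n} ≡ 0E
·-zeroʳ {zero} k = cong ⟨_⟩ (ℤₚ.*-zeroʳ k)
·-zeroʳ {suc n} k = cong₂ _⊞_ (·-zeroʳ k) (·-zeroʳ k)

·-identityˡ : ∀ {n} (a : Ext n) → + 1 · a ≡ a
·-identityˡ ⟨ x ⟩ = cong ⟨_⟩ (ℤₚ.*-identityˡ x)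
·-identityˡ (a ⊞ b) = cong₂ _⊞_ (·-identityˡ a) (·-identityˡ b)

top-⊕ : ∀ {n} (a b : Ext n) → top (a ⊕ b) ≡ top a ℤ.+ top b
top-⊕ ⟨ x ⟩ ⟨ y ⟩ = refl
top-⊕ (a ⊞ b) (c ⊞ d) = top-⊕ b d

top-· : ∀ {n} k (a : Ext n) → top (k · a) ≡ k ℤ.* top a
top-· k ⟨ x ⟩ = refl
top-· k (a ⊞ b) = top-· k b

top-vol : ∀ {n} → top (vol {n}) ≡ + 1
top-vol {zero} = refl
top-vol {suc n} = top-vol {n}

wedge-cong : ∀ {n} {u v : Vect n} → (∀ i → u i ≡ v i) → (ω : Ext n) → wedge u ω ≡ wedge v ω
wedge-cong e ⟨ x ⟩ = refl
wedge-cong {u = u} {v} e (a ⊞ b) = cong₂ _⊞_ (wedge-cong (e ∘ fsuc) a)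
  (cong₂ _⊕_ (cong (_· a) (e fzero)) (cong neg (wedge-cong (e ∘ fsuc) b)))

wedge-⊕ : ∀ {n} (v : Vect n) (a b : Ext n) → wedge v (a ⊕ b) ≡ wedge v a ⊕ wedge v b
wedge-⊕ v ⟨ x ⟩ ⟨ y ⟩ = refl
wedge-⊕ v (a ⊞ b) (c ⊞ d) = cong₂ _⊞_ (wedge-⊕ _ a c) (begin
  v₀ · (a ⊕ c) ⊕ neg (wedge v' (b ⊕ d))
    ≡⟨ cong₂ _⊕_ (·-distribˡ-⊕ v₀ a c) (trans (cong neg (wedge-⊕ v' b d)) (·-distribˡ-⊕ _ _ _)) ⟩
  (v₀ · a ⊕ v₀ · c) ⊕ (neg (wedge v' b) ⊕ neg (wedge v' d))
    ≡⟨ ⊕-interchange _ _ _ _ ⟩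
  (v₀ · a ⊕ neg (wedge v' b)) ⊕ (v₀ · c ⊕ neg (wedge v' d)) ∎)
  where
  open ≡-Reasoning
  v₀ = v fzero
  v' = v ∘ fsuc

wedge-· : ∀ {n} (v : Vect n) k (a : Ext n) → wedge v (k · a) ≡ k · wedge v a
wedge-· v k ⟨ x ⟩ = cong ⟨_⟩ (sym (ℤₚ.*-zeroʳ k))
wedge-· v k (a ⊞ b) = cong₂ _⊞_ (wedge-· _ k a) (begin
  v₀ · (k · a) ⊕ neg (wedge v' (k · b))
    ≡⟨ cong₂ _⊕_ (·-comm v₀ k a) (trans (cong neg (wedge-· v' k b)) (·-comm _ k _)) ⟩
  k · (v₀ · a) ⊕ k · neg (wedge v' b)
    ≡⟨ sym (·-distribˡ-⊕ k _ _) ⟩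
  k · (v₀ · a ⊕ neg (wedge v' b)) ∎)
  where
  open ≡-Reasoning
  v₀ = v fzero
  v' = v ∘ fsuc

wedge-0E : ∀ {n} (v : Vect n) → wedge v 0E ≡ 0E
wedge-0E v = begin
  wedge v 0E          ≡⟨ cong (wedge v) (sym (·-zeroˡ 0E)) ⟩
  wedge v (+ 0 · 0E)  ≡⟨ wedge-· v (+ 0) 0E ⟩
  + 0 · wedge v 0E    ≡⟨ ·-zeroˡ _ ⟩
  0E                  ∎
  where open ≡-Reasoning

wedge-+ : ∀ {n} (u v : Vect n) (a : Ext n) → wedge (λ i → u i ℤ.+ v i) a ≡ wedge u a ⊕ wedge v a
wedge-+ u v ⟨ x ⟩ = refl
wedge-+ u v (a ⊞ b) = cong₂ _⊞_ (wedge-+ _ _ a) (trans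
  (cong₂ _⊕_ (·-distribʳ-⊕ (u fzero) (v fzero) a)
             (trans (cong neg (wedge-+ (u ∘ fsuc) (v ∘ fsuc) b)) (·-distribˡ-⊕ _ _ _)))
  (⊕-interchange _ _ _ _))

wedge-* : ∀ {n} k (v : Vect n) (a : Ext n) → wedge (λ i → k ℤ.* v i) a ≡ k · wedge v a
wedge-* k v ⟨ x ⟩ = cong ⟨_⟩ (sym (ℤₚ.*-zeroʳ k))
wedge-* k v (a ⊞ b) = cong₂ _⊞_ (wedge-* k _ a) (trans
  (cong₂ _⊕_ (sym (·-assoc k (v fzero) a))
             (trans (cong neg (wedge-* k (v ∘ fsuc) b)) (·-comm _ k _)))
  (sym (·-distribˡ-⊕ k _ _)))

wedge-zero : ∀ {n} (a : Ext n) → wedge (λ _ → + 0) a ≡ 0E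
wedge-zero a = trans (wedge-* (+ 0) (λ _ → + 0) a) (·-zeroˡ _)

neg-neg : ∀ {n} (a : Ext n) → neg (neg a) ≡ a
neg-neg a = trans (·-assoc _ _ a) (·-identityˡ a)

⊕-comm : ∀ {n} (a b : Ext n) → a ⊕ b ≡ b ⊕ a
⊕-comm ⟨ x ⟩ ⟨ y ⟩ = cong ⟨_⟩ (ℤₚ.+-comm x y)
⊕-comm (a ⊞ b) (c ⊞ d) = cong₂ _⊞_ (⊕-comm a c) (⊕-comm b d)

⊕-assoc : ∀ {n} (a b c : Ext n) → (a ⊕ b) ⊕ c ≡ a ⊕ (b ⊕ c)
⊕-assoc ⟨ x ⟩ ⟨ y ⟩ ⟨ z ⟩ = cong ⟨_⟩ (ℤₚ.+-assoc x y z)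
⊕-assoc (a ⊞ a') (b ⊞ b') (c ⊞ c') = cong₂ _⊞_ (⊕-assoc a b c) (⊕-assoc a' b' c')

neg-⊕ : ∀ {n} (a b : Ext n) → neg (a ⊕ neg b) ≡ neg a ⊕ b
neg-⊕ a b = trans (·-distribˡ-⊕ _ a _) (cong (neg a ⊕_) (neg-neg b))

wedge-anticomm : ∀ {n} (v w : Vect n) (ω : Ext n) → wedge v (wedge w ω) ≡ neg (wedge w (wedge v ω))
wedge-anticomm v w ⟨ x ⟩ = refl
wedge-anticomm v w (a ⊞ b) = cong₂ _⊞_ (wedge-anticomm v' w' a) (begin
  v₀ · wedge w' a ⊕ neg (wedge v' (w₀ · a ⊕ neg (wedge w' b)))
    ≡⟨ cong (λ z → v₀ · wedge w' a ⊕ neg z) (expand v' w' w₀) ⟩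
  v₀ · wedge w' a ⊕ neg (w₀ · wedge v' a ⊕ neg (wedge v' (wedge w' b)))
    ≡⟨ cong (v₀ · wedge w' a ⊕_) (neg-⊕ _ _) ⟩
  v₀ · wedge w' a ⊕ (neg (w₀ · wedge v' a) ⊕ wedge v' (wedge w' b))
    ≡⟨ sym (⊕-assoc _ _ _) ⟩
  (v₀ · wedge w' a ⊕ neg (w₀ · wedge v' a)) ⊕ wedge v' (wedge w' b)
    ≡⟨ cong₂ _⊕_ (⊕-comm _ _) (wedge-anticomm v' w' b) ⟩
  (neg (w₀ · wedge v' a) ⊕ v₀ · wedge w' a) ⊕ neg (wedge w' (wedge v' b))
    ≡⟨ cong (_⊕ neg (wedge w' (wedge v' b))) (sym (neg-⊕ _ _)) ⟩
  neg (w₀ · wedge v' a ⊕ neg (v₀ · wedge w' a)) ⊕ neg (wedge w' (wedge v' b))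
    ≡⟨ sym (·-distribˡ-⊕ _ _ _) ⟩
  neg ((w₀ · wedge v' a ⊕ neg (v₀ · wedge w' a)) ⊕ wedge w' (wedge v' b))
    ≡⟨ cong neg (⊕-assoc _ _ _) ⟩
  neg (w₀ · wedge v' a ⊕ (neg (v₀ · wedge w' a) ⊕ wedge w' (wedge v' b)))
    ≡⟨ cong (λ z → neg (w₀ · wedge v' a ⊕ z)) (sym (neg-⊕ _ _)) ⟩
  neg (w₀ · wedge v' a ⊕ neg (v₀ · wedge w' a ⊕ neg (wedge w' (wedge v' b))))
    ≡⟨ cong (λ z → neg (w₀ · wedge v' a ⊕ neg z)) (sym (expand w' v' v₀)) ⟩
  neg (w₀ · wedge v' a ⊕ neg (wedge w' (v₀ · a ⊕ neg (wedge v' b)))) ∎)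
  where
  open ≡-Reasoning
  v₀ = v fzero
  v' = v ∘ fsuc
  w₀ = w fzero
  w' = w ∘ fsuc
  expand : ∀ x y k → wedge x (k · a ⊕ neg (wedge y b)) ≡ k · wedge x a ⊕ neg (wedge x (wedge y b))
  expand x y k = trans (wedge-⊕ x _ _) (cong₂ _⊕_ (wedge-· x k a) (wedge-· x _ _))

-- The integers have no 2-torsion: a nonzero integer and its negative have different constructors,
-- so only `+ zero` remains in dimension 0.
self-neg⇒0E : ∀ {n} (a : Ext n) → a ≡ neg a → a ≡ 0E
self-neg⇒0E ⟨ + zero ⟩ e = refl
self-neg⇒0E (a ⊞ b) e = cong₂ _⊞_ (self-neg⇒0E a (cong fst e)) (self-neg⇒0E b (cong snd e))
  where
  fst snd : ∀ {n} → Ext (suc n) → Ext n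
  fst (a ⊞ b) = a
  snd (a ⊞ b) = b

wedge-self : ∀ {n} (v : Vect n) (ω : Ext n) → wedge v (wedge v ω) ≡ 0E
wedge-self v ω = self-neg⇒0E _ (wedge-anticomm v v ω)

sumFin-cong : ∀ {n} {f g : Fin n → ℤ} → (∀ i → f i ≡ g i) → sumFin f ≡ sumFin g
sumFin-cong {zero} e = refl
sumFin-cong {suc n} e = cong₂ ℤ._+_ (e fzero) (sumFin-cong (e ∘ fsuc))

wedgeAll-cong : ∀ {n} k {N N' : Fin k → Vect n} → (∀ i j → N i j ≡ N' i j) → ∀ ω →
  wedgeAll k N ω ≡ wedgeAll k N' ω
wedgeAll-cong zero e ω = refl
wedgeAll-cong (suc k) {N} e ω =
  trans (wedge-cong (e fzero) _) (cong (wedge _) (wedgeAll-cong k (e ∘ fsuc) ω))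

wedgeAll-· : ∀ {n} k (N : Fin k → Vect n) c ω → wedgeAll k N (c · ω) ≡ c · wedgeAll k N ω
wedgeAll-· zero N c ω = refl
wedgeAll-· (suc k) N c ω = trans (cong (wedge _) (wedgeAll-· k _ c ω)) (wedge-· _ c _)

-- Induced maps and multiplicativity of the determinant

-- The map of exterior algebras sending e_i to N i, wedged with ω.
induced : ∀ {k n} → (Fin k → Vect n) → Ext n → Ext k → Ext n
induced N ω ⟨ z ⟩ = z · ω
induced N ω (a ⊞ b) = induced (N ∘ fsuc) ω a ⊕ wedge (N fzero) (induced (N ∘ fsuc) ω b)

comb : ∀ {k n} → Vect k → (Fin k → Vect n) → Vect n
comb v N j = sumFin (λ i → v i ℤ.* N i j)

induced-⊕ : ∀ {k n} (N : Fin k → Vect n) ω (a b : Ext k) →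
  induced N ω (a ⊕ b) ≡ induced N ω a ⊕ induced N ω b
induced-⊕ N ω ⟨ x ⟩ ⟨ y ⟩ = ·-distribʳ-⊕ x y ω
induced-⊕ N ω (a ⊞ b) (c ⊞ d) = trans
  (cong₂ _⊕_ (induced-⊕ _ ω a c) (trans (cong (wedge _) (induced-⊕ _ ω b d)) (wedge-⊕ _ _ _)))
  (⊕-interchange _ _ _ _)

induced-· : ∀ {k n} (N : Fin k → Vect n) ω c (a : Ext k) → induced N ω (c · a) ≡ c · induced N ω a
induced-· N ω c ⟨ x ⟩ = sym (·-assoc c x ω)
induced-· N ω c (a ⊞ b) = trans
  (cong₂ _⊕_ (induced-· _ ω c a) (trans (cong (wedge _) (induced-· _ ω c b)) (wedge-· _ c _)))
  (sym (·-distribˡ-⊕ c _ _))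

induced-0E : ∀ {k n} (N : Fin k → Vect n) ω → induced N ω 0E ≡ 0E
induced-0E N ω = trans (cong (induced N ω) (sym (·-zeroˡ 0E))) (trans (induced-· N ω (+ 0) 0E) (·-zeroˡ _))

induced-unit : ∀ {k n} (N : Fin k → Vect n) ω → induced N ω unit ≡ ω
induced-unit {zero} N ω = ·-identityˡ ω
induced-unit {suc k} N ω = trans
  (cong₂ _⊕_ (induced-unit (N ∘ fsuc) ω)
     (trans (cong (wedge _) (induced-0E (N ∘ fsuc) ω)) (wedge-0E _)))
  (⊕-identityʳ ω)

induced-vol : ∀ {k n} (N : Fin k → Vect n) ω → induced N ω vol ≡ wedgeAll k N ω
induced-vol {zero} N ω = ·-identityˡ ω
induced-vol {suc k} N ω = trans
  (cong₂ _⊕_ (induced-0E (N ∘ fsuc) ω) (cong (wedge _) (induced-vol (N ∘ fsuc) ω)))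
  (⊕-identityˡ _)

-- Multiplicativity of the induced map. The form `ω` stays at the right end, so only wedging by a
-- vector from the left has to be checked.
induced-wedge : ∀ {k n} (N : Fin k → Vect n) ω (v : Vect k) (η : Ext k) →
  induced N ω (wedge v η) ≡ wedge (comb v N) (induced N ω η)
induced-wedge N ω v ⟨ x ⟩ = trans (·-zeroˡ ω) (sym (wedge-zero _))
induced-wedge {n = n} N ω v (a ⊞ b) = begin
  induced N' ω (wedge v' a) ⊕ wedge n₀ (induced N' ω (v₀ · a ⊕ neg (wedge v' b)))
    ≡⟨ cong₂ _⊕_ (induced-wedge N' ω v' a) (cong (wedge n₀) (trans (induced-⊕ N' ω (v₀ · a) (neg (wedge v' b)))
         (cong₂ _⊕_ (induced-· N' ω v₀ a) (trans (induced-· N' ω _ (wedge v' b)) (cong neg (induced-wedge N' ω v' b)))))) ⟩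
  wedge c A ⊕ wedge n₀ (v₀ · A ⊕ neg (wedge c B))
    ≡⟨ cong (wedge c A ⊕_) (trans (wedge-⊕ n₀ _ _) (cong₂ _⊕_ (wedge-· n₀ v₀ A) (wedge-· n₀ _ _))) ⟩
  wedge c A ⊕ (v₀ · wedge n₀ A ⊕ neg (wedge n₀ (wedge c B)))
    ≡⟨ cong (λ z → wedge c A ⊕ (v₀ · wedge n₀ A ⊕ z)) (sym (wedge-anticomm c n₀ B)) ⟩
  wedge c A ⊕ (v₀ · wedge n₀ A ⊕ wedge c (wedge n₀ B))
    ≡⟨ sym (⊕-assoc _ _ _) ⟩
  (wedge c A ⊕ v₀ · wedge n₀ A) ⊕ wedge c (wedge n₀ B)
    ≡⟨ cong₂ _⊕_ (⊕-comm _ _) (sym (⊕-identityˡ _)) ⟩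
  (v₀ · wedge n₀ A ⊕ wedge c A) ⊕ (0E ⊕ wedge c (wedge n₀ B))
    -- The term `v₀ · n₀ ∧ n₀ ∧ B` is zero; inserting it completes `c ∧ n₀ ∧ B` to the wedge with
    -- the full combination.
    ≡⟨ cong₂ _⊕_ (sym (split A))
         (trans (cong (_⊕ wedge c (wedge n₀ B)) (sym (trans (cong (v₀ ·_) (wedge-self n₀ B)) (·-zeroʳ v₀))))
                (sym (split (wedge n₀ B)))) ⟩
  wedge (comb v N) A ⊕ wedge (comb v N) (wedge n₀ B)
    ≡⟨ sym (wedge-⊕ (comb v N) A (wedge n₀ B)) ⟩
  wedge (comb v N) (A ⊕ wedge n₀ B) ∎
  where
  open ≡-Reasoning
  v₀ = v fzero
  v' = v ∘ fsuc
  n₀ = N fzero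
  N' = N ∘ fsuc
  A = induced N' ω a
  B = induced N' ω b
  c = comb v' N'
  split : ∀ ξ → wedge (comb v N) ξ ≡ v₀ · wedge n₀ ξ ⊕ wedge c ξ
  split ξ = trans (wedge-+ (λ j → v₀ ℤ.* n₀ j) c ξ) (cong (_⊕ wedge c ξ) (wedge-* v₀ n₀ ξ))

induced-wedgeAll : ∀ {k n} j (r : Fin j → Vect k) (N : Fin k → Vect n) ω η →
  induced N ω (wedgeAll j r η) ≡ wedgeAll j (λ i → comb (r i) N) (induced N ω η)
induced-wedgeAll zero r N ω η = refl
induced-wedgeAll (suc j) r N ω η =
  trans (induced-wedge N ω (r fzero) (wedgeAll j (r ∘ fsuc) η)) (cong (wedge _) (induced-wedgeAll j (r ∘ fsuc) N ω η))

-- A lower bound on the degree is enough: in dimension n, degree at least n leaves only the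
-- multiples of `vol`. This reduces a wedge of n vectors to its determinant.
DegreeAtLeast : ∀ {n} → ℕ → Ext n → Set
DegreeAtLeast zero    ω       = ⊤
DegreeAtLeast (suc k) ⟨ x ⟩   = ⟨ x ⟩ ≡ 0E
DegreeAtLeast (suc k) (a ⊞ b) = DegreeAtLeast (suc k) a × DegreeAtLeast k b

degree-⊕ : ∀ {n} k (a b : Ext n) → DegreeAtLeast k a → DegreeAtLeast k b → DegreeAtLeast k (a ⊕ b)
degree-⊕ zero a b p q = tt
degree-⊕ (suc k) ⟨ x ⟩ ⟨ y ⟩ refl refl = refl
degree-⊕ (suc k) (a ⊞ b) (c ⊞ d) (p , p') (q , q') = degree-⊕ (suc k) a c p q , degree-⊕ k b d p' q'

degree-· : ∀ {n} k c (a : Ext n) → DegreeAtLeast k a → DegreeAtLeast k (c · a)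
degree-· zero c a p = tt
degree-· (suc k) c ⟨ x ⟩ refl = cong ⟨_⟩ (ℤₚ.*-zeroʳ c)
degree-· (suc k) c (a ⊞ b) (p , q) = degree-· (suc k) c a p , degree-· k c b q

degree-wedge : ∀ {n} k (v : Vect n) (a : Ext n) → DegreeAtLeast k a → DegreeAtLeast (suc k) (wedge v a)
degree-wedge k v ⟨ x ⟩ p = refl
degree-wedge zero v (a ⊞ b) p = degree-wedge zero _ a tt , tt
degree-wedge (suc k) v (a ⊞ b) (p , q) = degree-wedge (suc k) _ a p ,
  degree-⊕ (suc k) _ _ (degree-· (suc k) (v fzero) a p) (degree-· (suc k) _ _ (degree-wedge k (v ∘ fsuc) b q))

degree-wedgeAll : ∀ {n} k (N : Fin k → Vect n) ω → DegreeAtLeast k (wedgeAll k N ω)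
degree-wedgeAll zero N ω = tt
degree-wedgeAll (suc k) N ω = degree-wedge k _ _ (degree-wedgeAll k (N ∘ fsuc) ω)

degree>n⇒0E : ∀ {n} (a : Ext n) → DegreeAtLeast (suc n) a → a ≡ 0E
degree>n⇒0E ⟨ x ⟩ p = p
degree>n⇒0E {suc n} (a ⊞ b) (p , q) = cong₂ _⊞_ (degree>n⇒0E a (weaken (suc n) a p)) (degree>n⇒0E b q)
  where
  weaken : ∀ {n} k (a : Ext n) → DegreeAtLeast (suc k) a → DegreeAtLeast k a
  weaken zero a p = tt
  weaken (suc k) ⟨ x ⟩ p = p
  weaken (suc k) (a ⊞ b) (p , q) = weaken (suc k) a p , weaken k b q

degree-n⇒top : ∀ {n} (a : Ext n) → DegreeAtLeast n a → a ≡ top a · vol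
degree-n⇒top ⟨ x ⟩ p = cong ⟨_⟩ (sym (ℤₚ.*-identityʳ x))
degree-n⇒top (a ⊞ b) (p , q) =
  cong₂ _⊞_ (trans (degree>n⇒0E a p) (sym (·-zeroʳ (top b)))) (degree-n⇒top b q)

-- In rank k the wedge of the `r i` is `detE k r · vol`, and the induced map sends `vol` to the
-- wedge of the `N i`. The `N i` may lie in a larger space and be followed by any `ω`; this allows
-- the F-block and the G-block of a Sylvester matrix to be treated one at a time.
wedgeAll-comb : ∀ {k n} (r : Fin k → Vect k) (N : Fin k → Vect n) ω →
  wedgeAll k (λ i → comb (r i) N) ω ≡ detE k r · wedgeAll k N ω
wedgeAll-comb {k} r N ω = begin
  wedgeAll k (λ i → comb (r i) N) ω
    ≡⟨ cong (wedgeAll k _) (sym (induced-unit N ω)) ⟩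
  wedgeAll k (λ i → comb (r i) N) (induced N ω unit)
    ≡⟨ sym (induced-wedgeAll k r N ω unit) ⟩
  induced N ω (wedgeAll k r unit)
    ≡⟨ cong (induced N ω) (degree-n⇒top _ (degree-wedgeAll k r unit)) ⟩
  induced N ω (detE k r · vol)
    ≡⟨ induced-· N ω (detE k r) vol ⟩
  detE k r · induced N ω vol
    ≡⟨ cong (detE k r ·_) (induced-vol N ω) ⟩
  detE k r · wedgeAll k N ω ∎
  where open ≡-Reasoning

-- Cofactor expansion and triangular determinants

-- The quotient by e_j.
delete : ∀ {n} → Fin (suc n) → Ext (suc n) → Ext n
delete fzero (a ⊞ b) = a
delete {suc n} (fsuc j) (a ⊞ b) = delete j a ⊞ delete j b

delete-⊕ : ∀ {n} (j : Fin (suc n)) a b → delete j (a ⊕ b) ≡ delete j a ⊕ delete j b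
delete-⊕ fzero (a ⊞ b) (c ⊞ d) = refl
delete-⊕ {suc n} (fsuc j) (a ⊞ b) (c ⊞ d) = cong₂ _⊞_ (delete-⊕ j a c) (delete-⊕ j b d)

delete-· : ∀ {n} (j : Fin (suc n)) k a → delete j (k · a) ≡ k · delete j a
delete-· fzero k (a ⊞ b) = refl
delete-· {suc n} (fsuc j) k (a ⊞ b) = cong₂ _⊞_ (delete-· j k a) (delete-· j k b)

delete-0E : ∀ {n} (j : Fin (suc n)) → delete j 0E ≡ 0E
delete-0E fzero = refl
delete-0E {suc n} (fsuc j) = cong₂ _⊞_ (delete-0E j) (delete-0E j)

delete-unit : ∀ {n} (j : Fin (suc n)) → delete j unit ≡ unit
delete-unit fzero = refl
delete-unit {suc n} (fsuc j) = cong₂ _⊞_ (delete-unit j) (delete-0E j)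

delete-wedge : ∀ {n} (j : Fin (suc n)) (v : Vect (suc n)) a →
  delete j (wedge v a) ≡ wedge (v ∘ punchIn j) (delete j a)
delete-wedge fzero v (a ⊞ b) = refl
delete-wedge {suc n} (fsuc j) v (a ⊞ b) = cong₂ _⊞_ (delete-wedge j _ a) (trans
  (delete-⊕ j _ _)
  (cong₂ _⊕_ (delete-· j _ a) (trans (delete-· j _ _) (cong neg (delete-wedge j (v ∘ fsuc) b)))))

delete-wedgeAll : ∀ {n} (j : Fin (suc n)) k (N : Fin k → Vect (suc n)) ω →
  delete j (wedgeAll k N ω) ≡ wedgeAll k (λ i → N i ∘ punchIn j) (delete j ω)
delete-wedgeAll j zero N ω = refl
delete-wedgeAll j (suc k) N ω = trans (delete-wedge j _ _) (cong (wedge _) (delete-wedgeAll j k (N ∘ fsuc) ω))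

sumFin-neg : ∀ {n} (f : Fin n → ℤ) → sumFin (λ i → ℤ.- f i) ≡ ℤ.- sumFin f
sumFin-neg {zero} f = refl
sumFin-neg {suc n} f = trans (cong (ℤ._+_ (ℤ.- f fzero)) (sumFin-neg (f ∘ fsuc)))
  (sym (ℤₚ.neg-distrib-+ (f fzero) _))

-- Only the component of `ω` missing exactly `e_j` can be completed to the top degree by
-- `v j · e_j`. Its coefficient is the top coefficient after passing to the quotient by `e_j`, which
-- is how the cofactors of the first row appear.
top-wedge : ∀ {n} (v : Vect (suc n)) (ω : Ext (suc n)) →
  top (wedge v ω) ≡ sumFin (λ j → alt (toℕ j) ℤ.* v j ℤ.* top (delete j ω))
top-wedge {zero} v (⟨ x ⟩ ⊞ ⟨ y ⟩) = leaf (v fzero) x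
  where
  leaf : ∀ v x → v ℤ.* x ℤ.+ + 0 ≡ + 1 ℤ.* v ℤ.* x ℤ.+ + 0
  leaf = ℤ-Ring.solve-∀
top-wedge {suc n} v (a ⊞ b) = begin
  top (v fzero · a ⊕ neg (wedge v' b))
    ≡⟨ top-⊕ (v fzero · a) _ ⟩
  top (v fzero · a) ℤ.+ top (neg (wedge v' b))
    ≡⟨ cong₂ ℤ._+_ (trans (top-· (v fzero) a) (cong (ℤ._* top a) (sym (ℤₚ.*-identityˡ (v fzero)))))
         (trans (top-· (ℤ.- (+ 1)) (wedge v' b)) (trans (ℤₚ.-1*i≡-i _) (cong ℤ.-_ (top-wedge v' b)))) ⟩
  + 1 ℤ.* v fzero ℤ.* top a ℤ.+ ℤ.- sumFin (λ j → alt (toℕ j) ℤ.* v' j ℤ.* top (delete j b))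
    ≡⟨ cong (ℤ._+_ (+ 1 ℤ.* v fzero ℤ.* top a)) (trans (sym (sumFin-neg (λ j → alt (toℕ j) ℤ.* v' j ℤ.* top (delete j b))))
         (sumFin-cong {f = λ j → ℤ.- (alt (toℕ j) ℤ.* v' j ℤ.* top (delete j b))} (λ j → leaf (alt (toℕ j)) (v' j) (top (delete j b))))) ⟩
  sumFin (λ j → alt (toℕ j) ℤ.* v j ℤ.* top (delete j (a ⊞ b))) ∎
  where
  open ≡-Reasoning
  v' = v ∘ fsuc
  leaf : ∀ s v x → ℤ.- (s ℤ.* v ℤ.* x) ≡ ℤ.- s ℤ.* v ℤ.* x
  leaf = ℤ-Ring.solve-∀

det≡detE : ∀ n (M : Fin n → Vect n) → det n M ≡ detE n M
det≡detE zero M = refl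
det≡detE (suc n) M = sym (trans (top-wedge (M fzero) (wedgeAll n (M ∘ fsuc) unit))
  (sumFin-cong {suc n} (λ j → cong ((alt (toℕ j) ℤ.* M fzero j) ℤ.*_)
    (trans (cong top (trans (delete-wedgeAll j n (M ∘ fsuc) unit) (cong (wedgeAll n _) (delete-unit j))))
           (sym (det≡detE n _))))))

detE-comb : ∀ n (R N : Fin n → Vect n) → detE n (λ i → comb (R i) N) ≡ detE n R ℤ.* detE n N
detE-comb n R N = trans (cong top (wedgeAll-comb R N unit)) (top-· (detE n R) (wedgeAll n N unit))

prodFin : ∀ n → (Fin n → ℤ) → ℤ
prodFin zero    f = + 1
prodFin (suc n) f = f fzero ℤ.* prodFin n (f ∘ fsuc)

wedgeAll-lift : ∀ {n} k (N : Fin k → Vect (suc n)) → (∀ i → N i fzero ≡ + 0) →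
  wedgeAll k N unit ≡ wedgeAll k (λ i → N i ∘ fsuc) unit ⊞ 0E
wedgeAll-lift zero N z = refl
wedgeAll-lift (suc k) N z = trans (cong (wedge (N fzero)) (wedgeAll-lift k (N ∘ fsuc) (z ∘ fsuc)))
  (cong (wedge (N fzero ∘ fsuc) A ⊞_)
    (trans (cong₂ _⊕_ (trans (cong (_· A) (z fzero)) (·-zeroˡ A))
                      (trans (cong neg (wedge-0E (N fzero ∘ fsuc))) (·-zeroʳ _)))
           (⊕-identityʳ 0E)))
  where A = wedgeAll k (λ i → N (fsuc i) ∘ fsuc) unit

detE-upper : ∀ n (M : Fin n → Vect n) → (∀ i j → toℕ j < toℕ i → M i j ≡ + 0) →
  detE n M ≡ prodFin n (λ i → M i i)
detE-upper zero M z = refl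
detE-upper (suc n) M z = begin
  top (wedge (M fzero) (wedgeAll n (M ∘ fsuc) unit))
    ≡⟨ cong (λ ω → top (wedge (M fzero) ω)) (wedgeAll-lift n (M ∘ fsuc) (λ i → z (fsuc i) fzero (s≤s z≤n))) ⟩
  top (M fzero fzero · A ⊕ neg (wedge _ 0E))
    ≡⟨ cong (λ ω → top (M fzero fzero · A ⊕ ω)) (trans (cong neg (wedge-0E _)) (·-zeroʳ _)) ⟩
  top (M fzero fzero · A ⊕ 0E)
    ≡⟨ cong top (⊕-identityʳ (M fzero fzero · A)) ⟩
  top (M fzero fzero · A)
    ≡⟨ top-· (M fzero fzero) A ⟩
  M fzero fzero ℤ.* top A
    ≡⟨ cong (M fzero fzero ℤ.*_) (detE-upper n (λ i → M (fsuc i) ∘ fsuc) (λ i j lt → z (fsuc i) (fsuc j) (s≤s lt))) ⟩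
  M fzero fzero ℤ.* prodFin n (λ i → M (fsuc i) (fsuc i)) ∎
  where
  open ≡-Reasoning
  A = wedgeAll n (λ i → M (fsuc i) ∘ fsuc) unit

detE-lower : ∀ n (M : Fin n → Vect n) → (∀ i j → toℕ i < toℕ j → M i j ≡ + 0) →
  detE n M ≡ prodFin n (λ i → M i i)
detE-lower zero M z = refl
-- The first row is a multiple of e₀, so only the part `a` free of e₀ contributes. That part is the
-- wedge of the remaining rows with column 0 deleted.
detE-lower (suc n) M z with wedgeAll n (M ∘ fsuc) unit | delete-wedgeAll fzero n (M ∘ fsuc) unit
... | a ⊞ b | refl = begin
  top (M fzero fzero · a ⊕ neg (wedge (M fzero ∘ fsuc) b))
    ≡⟨ cong (λ ω → top (M fzero fzero · a ⊕ neg ω))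
         (trans (wedge-cong (λ j → z fzero (fsuc j) (s≤s z≤n)) b) (wedge-zero b)) ⟩
  top (M fzero fzero · a ⊕ neg 0E)
    ≡⟨ cong top (trans (cong (M fzero fzero · a ⊕_) (·-zeroʳ _)) (⊕-identityʳ _)) ⟩
  top (M fzero fzero · a)
    ≡⟨ top-· (M fzero fzero) a ⟩
  M fzero fzero ℤ.* top a
    ≡⟨ cong (M fzero fzero ℤ.*_) (detE-lower n (λ i → M (fsuc i) ∘ fsuc) (λ i j lt → z (fsuc i) (fsuc j) (s≤s lt))) ⟩
  M fzero fzero ℤ.* prodFin n (λ i → M (fsuc i) (fsuc i)) ∎
  where open ≡-Reasoning

-- Binary forms and linear substitutions
infix 4 _≈_
_≈_ : Form → Form → Set
f ≈ g = ∀ k → f k ≡ g k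

sumTo-cong : ∀ n {f g : ℕ → ℤ} → (∀ i → i < n → f i ≡ g i) → sumTo n f ≡ sumTo n g
sumTo-cong zero e = refl
sumTo-cong (suc n) e = cong₂ ℤ._+_ (e n (n<1+n n)) (sumTo-cong n (λ i lt → e i (m<n⇒m<1+n lt)))

sumTo-zero : ∀ n {f : ℕ → ℤ} → (∀ i → i < n → f i ≡ + 0) → sumTo n f ≡ + 0
sumTo-zero zero e = refl
sumTo-zero (suc n) e = cong₂ ℤ._+_ (e n (n<1+n n)) (sumTo-zero n (λ i lt → e i (m<n⇒m<1+n lt)))

sumTo-+ : ∀ n (f g : ℕ → ℤ) → sumTo n (λ i → f i ℤ.+ g i) ≡ sumTo n f ℤ.+ sumTo n g
sumTo-+ zero f g = refl
sumTo-+ (suc n) f g = trans (cong (ℤ._+_ (f n ℤ.+ g n)) (sumTo-+ n f g)) (leaf (f n) (g n) _ _)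
  where
  leaf : ∀ a b c d → (a ℤ.+ b) ℤ.+ (c ℤ.+ d) ≡ (a ℤ.+ c) ℤ.+ (b ℤ.+ d)
  leaf = ℤ-Ring.solve-∀

sumTo-* : ∀ n c (f : ℕ → ℤ) → sumTo n (λ i → c ℤ.* f i) ≡ c ℤ.* sumTo n f
sumTo-* zero c f = sym (ℤₚ.*-zeroʳ c)
sumTo-* (suc n) c f = trans (cong (ℤ._+_ (c ℤ.* f n)) (sumTo-* n c f)) (sym (ℤₚ.*-distribˡ-+ c (f n) _))

sumTo-shift : ∀ n (f : ℕ → ℤ) → sumTo (suc n) f ≡ f 0 ℤ.+ sumTo n (f ∘ suc)
sumTo-shift zero f = refl
sumTo-shift (suc n) f = trans (cong (ℤ._+_ (f (suc n))) (sumTo-shift n f)) (leaf (f (suc n)) (f 0) _)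
  where
  leaf : ∀ a b c → a ℤ.+ (b ℤ.+ c) ≡ b ℤ.+ (a ℤ.+ c)
  leaf = ℤ-Ring.solve-∀

sumTo-swap : ∀ m n (f : ℕ → ℕ → ℤ) →
  sumTo m (λ i → sumTo n (f i)) ≡ sumTo n (λ j → sumTo m (λ i → f i j))
sumTo-swap zero n f = sym (sumTo-zero n (λ _ _ → refl))
sumTo-swap (suc m) n f = trans (cong (ℤ._+_ (sumTo n (f m))) (sumTo-swap m n f)) (sym (sumTo-+ n _ _))

sumFin-reverse : ∀ n (h : ℕ → ℤ) → sumFin {n} (λ i → h (n ∸ suc (toℕ i))) ≡ sumTo n h
sumFin-reverse zero h = refl
sumFin-reverse (suc n) h = cong (ℤ._+_ (h n)) (sumFin-reverse n h)

mulF-suc : ∀ f g k → mulF f g (suc k) ≡ f 0 ℤ.* g (suc k) ℤ.+ mulF (f ∘ suc) g k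
mulF-suc f g k = sumTo-shift (suc k) (λ i → f i ℤ.* g (suc k ∸ i))

mulF-suc′ : ∀ f g k → mulF f g (suc k) ≡ f (suc k) ℤ.* g 0 ℤ.+ mulF f (g ∘ suc) k
mulF-suc′ f g k = cong₂ ℤ._+_ (cong (λ j → f (suc k) ℤ.* g j) (n∸n≡0 k))
  (sumTo-cong (suc k) (λ i lt → cong (λ j → f i ℤ.* g j) (+-∸-assoc 1 (≤-pred lt))))

mulF-cong : ∀ {f f' g g'} → f ≈ f' → g ≈ g' → mulF f g ≈ mulF f' g'
mulF-cong e e' k = sumTo-cong (suc k) (λ i _ → cong₂ ℤ._*_ (e i) (e' (k ∸ i)))

mulF-comm : ∀ f g → mulF f g ≈ mulF g f
mulF-comm f g zero = cong (λ z → z ℤ.+ + 0) (ℤₚ.*-comm (f 0) (g 0))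
mulF-comm f g (suc k) = trans (mulF-suc f g k) (trans
  (cong₂ ℤ._+_ (ℤₚ.*-comm (f 0) (g (suc k))) (mulF-comm (f ∘ suc) g k))
  (sym (mulF-suc′ g f k)))

_+F_ : Form → Form → Form
(f +F g) k = f k ℤ.+ g k

_*F_ : ℤ → Form → Form
(c *F f) k = c ℤ.* f k

mulF-+ˡ : ∀ f g h → mulF (f +F g) h ≈ (mulF f h +F mulF g h)
mulF-+ˡ f g h k = trans (sumTo-cong (suc k) (λ i _ → ℤₚ.*-distribʳ-+ (h (k ∸ i)) (f i) (g i)))
  (sumTo-+ (suc k) (λ i → f i ℤ.* h (k ∸ i)) (λ i → g i ℤ.* h (k ∸ i)))

mulF-*ˡ : ∀ c f h → mulF (c *F f) h ≈ (c *F mulF f h)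
mulF-*ˡ c f h k = trans (sumTo-cong (suc k) (λ i _ → ℤₚ.*-assoc c (f i) (h (k ∸ i)))) (sumTo-* (suc k) c _)

mulF-*ʳ : ∀ c f h → mulF f (c *F h) ≈ (c *F mulF f h)
mulF-*ʳ c f h k = trans (mulF-comm f (c *F h) k) (trans (mulF-*ˡ c h f k) (cong (c ℤ.*_) (mulF-comm h f k)))

mulF-sumTo : ∀ n f (P : ℕ → Form) → mulF f (λ k → sumTo n (λ i → P i k)) ≈ (λ k → sumTo n (λ i → mulF f (P i) k))
mulF-sumTo n f P k = trans
  (sumTo-cong (suc k) (λ j _ → sym (sumTo-* n (f j) (λ i → P i (k ∸ j)))))
  (sumTo-swap (suc k) n (λ j i → f j ℤ.* P i (k ∸ j)))

mulF-assoc : ∀ f g h → mulF (mulF f g) h ≈ mulF f (mulF g h)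
mulF-assoc f g h zero = leaf (f 0) (g 0) (h 0)
  where
  leaf : ∀ a b c → (a ℤ.* b ℤ.+ + 0) ℤ.* c ℤ.+ + 0 ≡ a ℤ.* (b ℤ.* c ℤ.+ + 0) ℤ.+ + 0
  leaf = ℤ-Ring.solve-∀
mulF-assoc f g h (suc k) = begin
  mulF (mulF f g) h (suc k)
    ≡⟨ mulF-suc (mulF f g) h k ⟩
  mulF f g 0 ℤ.* h (suc k) ℤ.+ mulF (mulF f g ∘ suc) h k
    ≡⟨ cong (ℤ._+_ (mulF f g 0 ℤ.* h (suc k))) (trans
         (mulF-cong {g = h} (mulF-suc f g) (λ _ → refl) k)
         (trans (mulF-+ˡ (f 0 *F (g ∘ suc)) (mulF (f ∘ suc) g) h k)
           (cong₂ ℤ._+_ (mulF-*ˡ (f 0) (g ∘ suc) h k) (mulF-assoc (f ∘ suc) g h k)))) ⟩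
  mulF f g 0 ℤ.* h (suc k) ℤ.+ (f 0 ℤ.* mulF (g ∘ suc) h k ℤ.+ mulF (f ∘ suc) (mulF g h) k)
    ≡⟨ leaf (f 0) (g 0) (h (suc k)) _ _ ⟩
  f 0 ℤ.* (g 0 ℤ.* h (suc k) ℤ.+ mulF (g ∘ suc) h k) ℤ.+ mulF (f ∘ suc) (mulF g h) k
    ≡⟨ cong (λ z → f 0 ℤ.* z ℤ.+ mulF (f ∘ suc) (mulF g h) k) (sym (mulF-suc g h k)) ⟩
  f 0 ℤ.* mulF g h (suc k) ℤ.+ mulF (f ∘ suc) (mulF g h) k
    ≡⟨ sym (mulF-suc f (mulF g h) k) ⟩
  mulF f (mulF g h) (suc k) ∎
  where
  open ≡-Reasoning
  leaf : ∀ a b c x y → (a ℤ.* b ℤ.+ + 0) ℤ.* c ℤ.+ (a ℤ.* x ℤ.+ y) ≡ a ℤ.* (b ℤ.* c ℤ.+ x) ℤ.+ y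
  leaf = ℤ-Ring.solve-∀

mulF-const : ∀ f g → (∀ k → f (suc k) ≡ + 0) → mulF f g ≈ (f 0 *F g)
mulF-const f g z zero = ℤₚ.+-identityʳ _
mulF-const f g z (suc k) = trans (mulF-suc f g k)
  (trans (cong (ℤ._+_ (f 0 ℤ.* g (suc k)))
            (sumTo-zero (suc k) (λ i _ → trans (cong (ℤ._* g (k ∸ i)) (z i)) refl)))
         (ℤₚ.+-identityʳ _))

mulF-oneˡ : ∀ g → mulF oneF g ≈ g
mulF-oneˡ g k = trans (mulF-const oneF g (λ _ → refl) k) (ℤₚ.*-identityˡ (g k))

mulF-left-comm : ∀ f g h → mulF f (mulF g h) ≈ mulF g (mulF f h)
mulF-left-comm f g h k = trans (sym (mulF-assoc f g h k))
  (trans (mulF-cong {g = h} (mulF-comm f g) (λ _ → refl) k) (mulF-assoc g f h k))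

shiftF : ℕ → Form → Form
shiftF zero    P k       = P k
shiftF (suc m) P zero    = + 0
shiftF (suc m) P (suc k) = shiftF m P k

shiftF-< : ∀ m P k → k < m → shiftF m P k ≡ + 0
shiftF-< (suc m) P zero lt = refl
shiftF-< (suc m) P (suc k) (s≤s lt) = shiftF-< m P k lt

shiftF-+ : ∀ m P k → shiftF m P (m + k) ≡ P k
shiftF-+ zero P k = refl
shiftF-+ (suc m) P k = shiftF-+ m P k

Deg : ℕ → Form → Set
Deg n P = ∀ k → n < k → P k ≡ + 0

Deg-mul : ∀ {m n P Q} → Deg m P → Deg n Q → Deg (m + n) (mulF P Q)
Deg-mul {m} {n} {P} {Q} p q k lt = sumTo-zero (suc k) zero-term
  where
  zero-term : ∀ i → i < suc k → P i ℤ.* Q (k ∸ i) ≡ + 0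
  zero-term i i≤k with m ℕ.<? i
  ... | yes m<i = trans (cong (ℤ._* Q (k ∸ i)) (p i m<i)) refl
  ... | no m≮i = trans (cong (P i ℤ.*_) (q (k ∸ i) (m+n≤o⇒m≤o∸n (suc n)
        (≤-trans (s≤s (≤-trans (≤-reflexive (+-comm n i)) (+-monoˡ-≤ n (≮⇒≥ m≮i)))) lt))))
        (ℤₚ.*-zeroʳ (P i))

Deg-lin : ∀ a b → Deg 1 (linF a b)
Deg-lin a b (suc (suc k)) lt = refl
Deg-lin a b (suc zero) (s≤s ())

Deg-pow : ∀ a b n → Deg n (powF (linF a b) n)
Deg-pow a b zero (suc k) lt = refl
Deg-pow a b (suc n) = Deg-mul (Deg-lin a b) (Deg-pow a b n)

mulF-top : ∀ m {n P Q} → Deg m P → Deg n Q → mulF P Q (m + n) ≡ P m ℤ.* Q n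
mulF-top zero {n} {P} {Q} p q = mulF-const P Q (λ k → p (suc k) (s≤s z≤n)) n
mulF-top (suc m) {n} {P} {Q} p q = trans (mulF-suc P Q (m + n)) (trans
  (cong₂ ℤ._+_ (trans (cong (P 0 ℤ.*_) (q (suc (m + n)) (s≤s (m≤n+m n m)))) (ℤₚ.*-zeroʳ (P 0)))
     (mulF-top m (λ k lt → p (suc k) (s≤s lt)) q))
  (ℤₚ.+-identityˡ _))

Low : ℕ → Form → Set
Low m P = ∀ k → k < m → P k ≡ + 0

mulF-low : ∀ {m P Q} → Low m P → Low m (mulF P Q)
mulF-low {m} {P} {Q} p k lt = sumTo-zero (suc k)
  (λ i i≤k → trans (cong (ℤ._* Q (k ∸ i)) (p i (≤-trans i≤k lt))) refl)

mulF-bottom : ∀ m {P Q} → Low m P → mulF P Q m ≡ P m ℤ.* Q 0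
mulF-bottom zero {P} {Q} p = ℤₚ.+-identityʳ _
mulF-bottom (suc m) {P} {Q} p = trans (mulF-suc P Q m) (trans
  (cong₂ ℤ._+_ (cong (ℤ._* Q (suc m)) (p 0 (s≤s z≤n))) (mulF-bottom m {P ∘ suc} {Q} (λ k lt → p (suc k) (s≤s lt))))
  (ℤₚ.+-identityˡ _))

-- F(L, M) for a form F of degree d.
cmp : ℕ → Form → Form → Form → Form
cmp d F L M k = sumTo (suc d) (λ i → F i ℤ.* mulF (powF L i) (powF M (d ∸ i)) k)

cmp-cong : ∀ d {F F'} L M → (∀ i → i ≤ d → F i ≡ F' i) → cmp d F L M ≈ cmp d F' L M
cmp-cong d L M e k = sumTo-cong (suc d)
  (λ i lt → cong (ℤ._* mulF (powF L i) (powF M (d ∸ i)) k) (e i (≤-pred lt)))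

cmp-+ : ∀ d F G L M → cmp d (F +F G) L M ≈ (cmp d F L M +F cmp d G L M)
cmp-+ d F G L M k = trans
  (sumTo-cong (suc d) (λ i _ → ℤₚ.*-distribʳ-+ (mulF (powF L i) (powF M (d ∸ i)) k) (F i) (G i)))
  (sumTo-+ (suc d) (λ i → F i ℤ.* mulF (powF L i) (powF M (d ∸ i)) k)
                   (λ i → G i ℤ.* mulF (powF L i) (powF M (d ∸ i)) k))

cmp-* : ∀ d c F L M → cmp d (c *F F) L M ≈ (c *F cmp d F L M)
cmp-* d c F L M k = trans
  (sumTo-cong (suc d) (λ i _ → ℤₚ.*-assoc c (F i) (mulF (powF L i) (powF M (d ∸ i)) k)))
  (sumTo-* (suc d) c (λ i → F i ℤ.* mulF (powF L i) (powF M (d ∸ i)) k))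

-- Reading the same coefficients in degree d + 1 instead of d multiplies the form by Y, and the
-- substitution turns Y into `M`. In `cmp-shift` the factor is X, which becomes `L`.
cmp-raise : ∀ d F L M → F (suc d) ≡ + 0 → cmp (suc d) F L M ≈ mulF M (cmp d F L M)
cmp-raise d F L M z k = begin
  F (suc d) ℤ.* _ ℤ.+ sumTo (suc d) (λ i → F i ℤ.* mulF (powF L i) (powF M (suc d ∸ i)) k)
    ≡⟨ cong₂ ℤ._+_ (cong (ℤ._* _) z) (sumTo-cong (suc d) (λ i lt → term i (≤-pred lt))) ⟩
  + 0 ℤ.+ sumTo (suc d) (λ i → mulF M (F i *F mulF (powF L i) (powF M (d ∸ i))) k)
    ≡⟨ trans (ℤₚ.+-identityˡ _) (sym (mulF-sumTo (suc d) M (λ i → F i *F mulF (powF L i) (powF M (d ∸ i))) k)) ⟩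
  mulF M (cmp d F L M) k ∎
  where
  open ≡-Reasoning
  term : ∀ i → i ≤ d → F i ℤ.* mulF (powF L i) (powF M (suc d ∸ i)) k
    ≡ mulF M (F i *F mulF (powF L i) (powF M (d ∸ i))) k
  term i le rewrite +-∸-assoc 1 le = trans
    (cong (F i ℤ.*_) (mulF-left-comm (powF L i) M (powF M (d ∸ i)) k))
    (sym (mulF-*ʳ (F i) M (mulF (powF L i) (powF M (d ∸ i))) k))

cmp-shift : ∀ d F L M → cmp (suc d) (shiftF 1 F) L M ≈ mulF L (cmp d F L M)
cmp-shift d F L M k = begin
  cmp (suc d) (shiftF 1 F) L M k
    ≡⟨ trans (sumTo-shift (suc d) (λ i → shiftF 1 F i ℤ.* mulF (powF L i) (powF M (suc d ∸ i)) k)) (ℤₚ.+-identityˡ _) ⟩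
  sumTo (suc d) (λ i → F i ℤ.* mulF (powF L (suc i)) (powF M (d ∸ i)) k)
    ≡⟨ sumTo-cong (suc d) (λ i _ → trans
         (cong (F i ℤ.*_) (mulF-assoc L (powF L i) (powF M (d ∸ i)) k))
         (sym (mulF-*ʳ (F i) L (mulF (powF L i) (powF M (d ∸ i))) k))) ⟩
  sumTo (suc d) (λ i → mulF L (F i *F mulF (powF L i) (powF M (d ∸ i))) k)
    ≡⟨ sym (mulF-sumTo (suc d) L (λ i → F i *F mulF (powF L i) (powF M (d ∸ i))) k) ⟩
  mulF L (cmp d F L M) k ∎
  where open ≡-Reasoning

cmp-raises : ∀ j d F L M → Deg d F → cmp (j + d) F L M ≈ mulF (powF M j) (cmp d F L M)
cmp-raises zero d F L M p k = sym (mulF-oneˡ (cmp d F L M) k)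
cmp-raises (suc j) d F L M p k = trans
  (cmp-raise (j + d) F L M (p (suc (j + d)) (s≤s (m≤n+m d j))) k) (trans
  (mulF-cong {f = M} (λ _ → refl) (cmp-raises j d F L M p) k)
  (sym (mulF-assoc M (powF M j) (cmp d F L M) k)))

shiftF-1 : ∀ q F → shiftF (suc q) F ≈ shiftF 1 (shiftF q F)
shiftF-1 q F zero = refl
shiftF-1 q F (suc k) = refl

cmp-shifts : ∀ q d F L M → cmp (q + d) (shiftF q F) L M ≈ mulF (powF L q) (cmp d F L M)
cmp-shifts zero d F L M k = sym (mulF-oneˡ (cmp d F L M) k)
cmp-shifts (suc q) d F L M k = trans (cmp-cong (suc (q + d)) L M (λ i _ → shiftF-1 q F i) k) (trans
  (cmp-shift (q + d) (shiftF q F) L M k) (trans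
  (mulF-cong {f = L} (λ _ → refl) (cmp-shifts q d F L M) k)
  (sym (mulF-assoc L (powF L q) (cmp d F L M) k))))

linF-mul : ∀ a b P → mulF (linF a b) P ≈ ((b *F P) +F (a *F shiftF 1 P))
linF-mul a b P zero = cong (ℤ._+_ (b ℤ.* P 0)) (sym (ℤₚ.*-zeroʳ a))
linF-mul a b P (suc k) = trans (mulF-suc (linF a b) P k)
  (cong (ℤ._+_ (b ℤ.* P (suc k))) (mulF-const (linF a b ∘ suc) P (λ _ → refl) k))

cmp-lin : ∀ n P a b a' b' c' e' → Deg n P →
  cmp (suc n) (mulF (linF a b) P) (linF a' b') (linF c' e')
    ≈ mulF (linF (a ℤ.* a' ℤ.+ b ℤ.* c') (a ℤ.* b' ℤ.+ b ℤ.* e')) (cmp n P (linF a' b') (linF c' e'))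
cmp-lin n P a b a' b' c' e' p k = begin
  cmp (suc n) (mulF (linF a b) P) L M k
    ≡⟨ cmp-cong (suc n) L M (λ i _ → linF-mul a b P i) k ⟩
  cmp (suc n) ((b *F P) +F (a *F shiftF 1 P)) L M k
    ≡⟨ cmp-+ (suc n) (b *F P) (a *F shiftF 1 P) L M k ⟩
  cmp (suc n) (b *F P) L M k ℤ.+ cmp (suc n) (a *F shiftF 1 P) L M k
    ≡⟨ cong₂ ℤ._+_ (trans (cmp-* (suc n) b P L M k) (cong (b ℤ.*_) (cmp-raise n P L M (p (suc n) (n<1+n n)) k)))
         (trans (cmp-* (suc n) a (shiftF 1 P) L M k) (cong (a ℤ.*_) (cmp-shift n P L M k))) ⟩
  b ℤ.* mulF M C k ℤ.+ a ℤ.* mulF L C k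
    ≡⟨ cong₂ ℤ._+_ (sym (mulF-*ˡ b M C k)) (sym (mulF-*ˡ a L C k)) ⟩
  mulF (b *F M) C k ℤ.+ mulF (a *F L) C k
    ≡⟨ sym (mulF-+ˡ (b *F M) (a *F L) C k) ⟩
  mulF ((b *F M) +F (a *F L)) C k
    ≡⟨ mulF-cong {g = C} lin (λ _ → refl) k ⟩
  mulF (linF (a ℤ.* a' ℤ.+ b ℤ.* c') (a ℤ.* b' ℤ.+ b ℤ.* e')) C k ∎
  where
  open ≡-Reasoning
  L = linF a' b'
  M = linF c' e'
  C = cmp n P L M
  lin : ((b *F M) +F (a *F L)) ≈ linF (a ℤ.* a' ℤ.+ b ℤ.* c') (a ℤ.* b' ℤ.+ b ℤ.* e')
  lin zero = ℤₚ.+-comm (b ℤ.* e') (a ℤ.* b')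
  lin (suc zero) = ℤₚ.+-comm (b ℤ.* c') (a ℤ.* a')
  lin (suc (suc k)) = cong₂ ℤ._+_ (ℤₚ.*-zeroʳ b) (ℤₚ.*-zeroʳ a)

cmp-pow : ∀ j a b a' b' c' e' →
  cmp j (powF (linF a b) j) (linF a' b') (linF c' e')
    ≈ powF (linF (a ℤ.* a' ℤ.+ b ℤ.* c') (a ℤ.* b' ℤ.+ b ℤ.* e')) j
cmp-pow zero a b a' b' c' e' k = trans (ℤₚ.+-identityʳ _) (trans (ℤₚ.*-identityˡ _) (mulF-oneˡ oneF k))
cmp-pow (suc j) a b a' b' c' e' k = trans
  (cmp-lin j (powF (linF a b) j) a b a' b' c' e' (Deg-pow a b j) k)
  (mulF-cong {f = linF (a ℤ.* a' ℤ.+ b ℤ.* c') (a ℤ.* b' ℤ.+ b ℤ.* e')} (λ _ → refl) (cmp-pow j a b a' b' c' e') k)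

cmp-pow-pow : ∀ i j a b c e a' b' c' e' →
  cmp (i + j) (mulF (powF (linF a b) i) (powF (linF c e) j)) (linF a' b') (linF c' e')
    ≈ mulF (powF (linF (a ℤ.* a' ℤ.+ b ℤ.* c') (a ℤ.* b' ℤ.+ b ℤ.* e')) i)
           (powF (linF (c ℤ.* a' ℤ.+ e ℤ.* c') (c ℤ.* b' ℤ.+ e ℤ.* e')) j)
cmp-pow-pow zero j a b c e a' b' c' e' k = trans
  (cmp-cong j (linF a' b') (linF c' e') (λ i _ → mulF-oneˡ (powF (linF c e) j) i) k)
  (trans (cmp-pow j c e a' b' c' e' k) (sym (mulF-oneˡ (powF _ j) k)))
cmp-pow-pow (suc i) j a b c e a' b' c' e' k = trans
  (cmp-cong (suc (i + j)) (linF a' b') (linF c' e')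
    (λ q _ → mulF-assoc (linF a b) (powF (linF a b) i) (powF (linF c e) j) q) k) (trans
  (cmp-lin (i + j) (mulF (powF (linF a b) i) (powF (linF c e) j)) a b a' b' c' e'
    (Deg-mul (Deg-pow a b i) (Deg-pow c e j)) k) (trans
  (mulF-cong {f = A} (λ _ → refl) (cmp-pow-pow i j a b c e a' b' c' e') k)
  (sym (mulF-assoc A (powF A i) (powF B j) k))))
  where
  A = linF (a ℤ.* a' ℤ.+ b ℤ.* c') (a ℤ.* b' ℤ.+ b ℤ.* e')
  B = linF (c ℤ.* a' ℤ.+ e ℤ.* c') (c ℤ.* b' ℤ.+ e ℤ.* e')

cmp-sumTo : ∀ d n (c : ℕ → ℤ) (P : ℕ → Form) L M →
  cmp d (λ k → sumTo n (λ i → c i ℤ.* P i k)) L M ≈ (λ k → sumTo n (λ i → c i ℤ.* cmp d (P i) L M k))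
cmp-sumTo d zero c P L M k = sumTo-zero (suc d) (λ _ _ → refl)
cmp-sumTo d (suc n) c P L M k = trans
  (cmp-+ d (c n *F P n) (λ k → sumTo n (λ i → c i ℤ.* P i k)) L M k)
  (cong₂ ℤ._+_ (cmp-* d (c n) (P n) L M k) (cmp-sumTo d n c P L M k))

-- By linearity it suffices to substitute into products of powers of two linear forms, which are
-- built up one linear factor at a time.
composeF-composeF : ∀ d F a b c e a' b' c' e' →
  composeF d (composeF d F a b c e) a' b' c' e'
    ≈ composeF d F (a ℤ.* a' ℤ.+ b ℤ.* c') (a ℤ.* b' ℤ.+ b ℤ.* e')
                   (c ℤ.* a' ℤ.+ e ℤ.* c') (c ℤ.* b' ℤ.+ e ℤ.* e')
composeF-composeF d F a b c e a' b' c' e' k = trans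
  (cmp-sumTo d (suc d) F (λ i → mulF (powF (linF a b) i) (powF (linF c e) (d ∸ i))) (linF a' b') (linF c' e') k)
  (sumTo-cong (suc d) (λ i lt → cong (F i ℤ.*_) (term i (≤-pred lt))))
  where
  L = linF (a ℤ.* a' ℤ.+ b ℤ.* c') (a ℤ.* b' ℤ.+ b ℤ.* e')
  M = linF (c ℤ.* a' ℤ.+ e ℤ.* c') (c ℤ.* b' ℤ.+ e ℤ.* e')
  term : ∀ i → i ≤ d → cmp d (mulF (powF (linF a b) i) (powF (linF c e) (d ∸ i))) (linF a' b') (linF c' e') k
    ≡ mulF (powF L i) (powF M (d ∸ i)) k
  term i i≤d = subst
    (λ m → cmp m (mulF (powF (linF a b) i) (powF (linF c e) (d ∸ i))) (linF a' b') (linF c' e') k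
             ≡ mulF (powF L i) (powF M (d ∸ i)) k)
    (m+[n∸m]≡n i≤d) (cmp-pow-pow i (d ∸ i) a b c e a' b' c' e' k)

Deg-compose : ∀ d F a b c e → Deg d (composeF d F a b c e)
Deg-compose d F a b c e k lt = sumTo-zero (suc d) (λ i i≤d → trans
  (cong (F i ℤ.*_) (Deg-mul {i} {d ∸ i} (Deg-pow a b i) (Deg-pow c e (d ∸ i)) k
    (subst (_< k) (sym (m+[n∸m]≡n (≤-pred i≤d))) lt)))
  (ℤₚ.*-zeroʳ (F i)))

-- The resultant under linear substitutions
≤ᵇ-true : ∀ {m n} → m ≤ n → (m ℕ.≤ᵇ n) ≡ true
≤ᵇ-true le = Equivalence.to T-≡ (≤⇒≤ᵇ le)

≤ᵇ-false : ∀ {m n} → n < m → (m ℕ.≤ᵇ n) ≡ false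
≤ᵇ-false {m} {n} lt = ¬-not (λ e → <⇒≱ lt (≤ᵇ⇒≤ m n (Equivalence.from T-≡ e)))

sylRow-inside : ∀ d f {i j} → i ≤ j → j ∸ i ≤ d → sylRow d f i j ≡ f (d ∸ (j ∸ i))
sylRow-inside d f p q rewrite ≤ᵇ-true p | ≤ᵇ-true q = refl

sylRow-left : ∀ d f {i j} → j < i → sylRow d f i j ≡ + 0
sylRow-left d f p rewrite ≤ᵇ-false p = refl

sylRow-right : ∀ d f {i j} → i ≤ j → d < j ∸ i → sylRow d f i j ≡ + 0
sylRow-right d f p q rewrite ≤ᵇ-true p | ≤ᵇ-false q = refl

-- Row i of a Sylvester block is the form `X^(d-1-i) Y^i f`, and column j holds the coefficient of
-- `X^(2d-1-j)`. Inside the band the two sides agree; to its left `Deg d f` makes the coefficient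
-- vanish, and to its right the shift does.
sylRow-shift : ∀ d f i j → Deg d f → i < d → j < d + d →
  sylRow d f i j ≡ shiftF (d ∸ suc i) f (d + d ∸ suc j)
sylRow-shift d f i j deg i<d j<2d with m≤n⇒∃[o]m+o≡n i<d
... | a , refl with i ℕ.≤? j
... | no i≰j with m≤n⇒∃[o]m+o≡n (≰⇒> i≰j)
...   | r , refl = trans (sylRow-left d f (≰⇒> i≰j)) (sym (begin
  shiftF (suc (suc (j + r)) + a ∸ suc (suc (j + r))) f (d + d ∸ suc j)
    ≡⟨ cong₂ (λ x y → shiftF x f y) (m+n∸m≡n (suc (suc (j + r))) a)
         (trans (cong (_∸ suc j) (arith j r a)) (m+n∸m≡n (suc j) _)) ⟩
  shiftF a f (a + (d + suc r))
    ≡⟨ shiftF-+ a f (d + suc r) ⟩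
  f (d + suc r)
    ≡⟨ deg (d + suc r) (m<m+n d (s≤s z≤n)) ⟩
  + 0 ∎))
  where
  open ≡-Reasoning
  arith : ∀ j r a → (suc (suc (j + r)) + a) + (suc (suc (j + r)) + a)
    ≡ suc j + (a + ((suc (suc (j + r)) + a) + suc r))
  arith = ℕ-Ring.solve-∀
sylRow-shift d f i j deg i<d j<2d | a , refl | yes i≤j with m≤n⇒∃[o]m+o≡n i≤j
... | q , refl with q ℕ.≤? d
... | yes q≤d with m≤n⇒∃[o]m+o≡n q≤d
...   | b , e = trans (sylRow-inside d f (m≤m+n i q) (subst (_≤ d) (sym (m+n∸m≡n i q)) q≤d)) (begin
  f (d ∸ (i + q ∸ i))
    ≡⟨ cong f (trans (cong (d ∸_) (m+n∸m≡n i q)) (trans (cong (_∸ q) (sym e)) (m+n∸m≡n q b))) ⟩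
  f b
    ≡⟨ sym (shiftF-+ a f b) ⟩
  shiftF a f (a + b)
    ≡⟨ sym (cong₂ (λ x y → shiftF x f y) (m+n∸m≡n (suc i) a)
         (trans (cong (λ z → d + z ∸ suc (i + q)) (sym e))
           (trans (cong (_∸ suc (i + q)) (arith i a q b)) (m+n∸m≡n (suc (i + q)) (a + b))))) ⟩
  shiftF (d ∸ suc i) f (d + d ∸ suc (i + q)) ∎)
  where
  open ≡-Reasoning
  arith : ∀ i a q b → (suc i + a) + (q + b) ≡ suc (i + q) + (a + b)
  arith = ℕ-Ring.solve-∀
sylRow-shift d f i j deg i<d j<2d | a , refl | yes i≤j | q , refl | no q≰d
  with m≤n⇒∃[o]m+o≡n (≰⇒> q≰d)
... | r , refl with m≤n⇒∃[o]m+o≡n (+-cancelˡ-≤ (suc i + d) (suc r) a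
                      (subst₂ _≤_ (arith₁ i d r) (arith₂ i d a) j<2d))
  where
  arith₁ : ∀ i d r → suc (i + suc (d + r)) ≡ (suc i + d) + suc r
  arith₁ = ℕ-Ring.solve-∀
  arith₂ : ∀ i d a → (suc i + a) + d ≡ (suc i + d) + a
  arith₂ = ℕ-Ring.solve-∀
...   | t , refl = trans
  (sylRow-right d f (m≤m+n i _) (subst (d <_) (sym (m+n∸m≡n i _)) (m≤m+n (suc d) r)))
  (sym (shiftF-< _ f _ (subst₂ _<_
    (sym (trans (cong (_∸ suc (i + suc (d + r))) (arith₁ i d r t)) (m+n∸m≡n (suc (i + suc (d + r))) t)))
    (sym (m+n∸m≡n (suc i) (suc r + t)))
    (s≤s (m≤n+m t r)))))
  where
  arith₁ : ∀ i d r t → (suc i + (suc r + t)) + d ≡ suc (i + suc (d + r)) + t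
  arith₁ = ℕ-Ring.solve-∀

sylRows : (d : ℕ) → Form → Fin d → Vect (d + d)
sylRows d f i j = sylRow d f (toℕ i) (toℕ j)

wedgeAll-++ : ∀ {n} k m (M : Fin (k + m) → Vect n) ω →
  wedgeAll (k + m) M ω ≡ wedgeAll k (λ i → M (i Fin.↑ˡ m)) (wedgeAll m (λ i → M (k Fin.↑ʳ i)) ω)
wedgeAll-++ zero m M ω = refl
wedgeAll-++ (suc k) m M ω = cong (wedge (M fzero)) (wedgeAll-++ k m (M ∘ fsuc) ω)

sylvester-top : ∀ d f g i j → sylvester d f g (i Fin.↑ˡ d) j ≡ sylRows d f i j
sylvester-top d f g i j rewrite Finₚ.toℕ-↑ˡ i d | ≤ᵇ-true (Finₚ.toℕ<n i) = refl

sylvester-bottom : ∀ d f g i j → sylvester d f g (d Fin.↑ʳ i) j ≡ sylRows d g i j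
sylvester-bottom d f g i j
  rewrite Finₚ.toℕ-↑ʳ d i | ≤ᵇ-false (s≤s (m≤m+n d (toℕ i))) | m+n∸m≡n d (toℕ i) = refl

resF-wedge : ∀ d f g → resF d f g ≡ top (wedgeAll d (sylRows d f) (wedgeAll d (sylRows d g) unit))
resF-wedge d f g = trans (det≡detE (d + d) (sylvester d f g)) (cong top (trans
  (wedgeAll-++ d d (sylvester d f g) unit) (trans
  (wedgeAll-cong d (sylvester-top d f g) _)
  (cong (wedgeAll d (sylRows d f)) (wedgeAll-cong d (sylvester-bottom d f g) unit)))))

sylRow-linear : ∀ d x y f g i j →
  sylRow d (λ k → x ℤ.* f k ℤ.+ y ℤ.* g k) i j ≡ x ℤ.* sylRow d f i j ℤ.+ y ℤ.* sylRow d g i j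
sylRow-linear d x y f g i j with (i ℕ.≤ᵇ j) ∧ ((j ∸ i) ℕ.≤ᵇ d)
... | true = refl
... | false = sym (cong₂ ℤ._+_ (ℤₚ.*-zeroʳ x) (ℤₚ.*-zeroʳ y))

sylRow-cong : ∀ d {f g} i j → (∀ k → k ≤ d → f k ≡ g k) → sylRow d f i j ≡ sylRow d g i j
sylRow-cong d i j e with (i ℕ.≤ᵇ j) ∧ ((j ∸ i) ℕ.≤ᵇ d)
... | true = e _ (m∸n≤m d (j ∸ i))
... | false = refl

resF-cong : ∀ d {f f' g g'} → (∀ k → k ≤ d → f k ≡ f' k) → (∀ k → k ≤ d → g k ≡ g' k) →
  resF d f g ≡ resF d f' g'
resF-cong d {f} {f'} {g} {g'} e e' = trans (resF-wedge d f g) (trans (cong top (trans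
  (wedgeAll-cong d (λ i j → sylRow-cong d (toℕ i) (toℕ j) e) _)
  (cong (wedgeAll d (sylRows d f')) (wedgeAll-cong d (λ i j → sylRow-cong d (toℕ i) (toℕ j) e') unit))))
  (sym (resF-wedge d f' g')))

wedgeAll-wedge : ∀ {n} k (r : Fin k → Vect n) v ω →
  wedgeAll k r (wedge v ω) ≡ alt k · wedge v (wedgeAll k r ω)
wedgeAll-wedge zero r v ω = sym (·-identityˡ _)
wedgeAll-wedge (suc k) r v ω = begin
  wedge r₀ (wedgeAll k r' (wedge v ω))
    ≡⟨ cong (wedge r₀) (wedgeAll-wedge k r' v ω) ⟩
  wedge r₀ (alt k · wedge v η)
    ≡⟨ wedge-· r₀ (alt k) (wedge v η) ⟩
  alt k · wedge r₀ (wedge v η)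
    ≡⟨ cong (alt k ·_) (wedge-anticomm r₀ v η) ⟩
  alt k · neg (wedge v (wedge r₀ η))
    ≡⟨ trans (·-assoc (alt k) (ℤ.- (+ 1)) _)
         (cong (_· wedge v (wedge r₀ η)) (trans (ℤₚ.*-comm (alt k) (ℤ.- (+ 1))) (ℤₚ.-1*i≡-i (alt k)))) ⟩
  alt (suc k) · wedge v (wedge r₀ η) ∎
  where
  open ≡-Reasoning
  r₀ = r fzero
  r' = r ∘ fsuc
  η = wedgeAll k r' ω

wedge-pair : ∀ {n} (r s : Vect n) x y z w ω →
  wedge (λ j → x ℤ.* r j ℤ.+ y ℤ.* s j) (wedge (λ j → z ℤ.* r j ℤ.+ w ℤ.* s j) ω)
    ≡ (x ℤ.* w ℤ.- y ℤ.* z) · wedge r (wedge s ω)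
wedge-pair r s x y z w ω = begin
  wedge (λ j → x ℤ.* r j ℤ.+ y ℤ.* s j) (wedge (λ j → z ℤ.* r j ℤ.+ w ℤ.* s j) ω)
    ≡⟨ trans (cong (wedge _) (lin z w ω)) (lin x y _) ⟩
  x · wedge r (z · R ⊕ w · S) ⊕ y · wedge s (z · R ⊕ w · S)
    ≡⟨ cong₂ (λ p q → x · p ⊕ y · q) (expand r) (expand s) ⟩
  x · (z · wedge r R ⊕ w · wedge r S) ⊕ y · (z · wedge s R ⊕ w · wedge s S)
    ≡⟨ cong₂ (λ p q → x · p ⊕ y · q)
         (trans (cong (λ p → z · p ⊕ w · wedge r S) (wedge-self r ω))
           (trans (cong (_⊕ w · wedge r S) (·-zeroʳ z)) (⊕-identityˡ _)))
         (trans (cong (λ p → z · wedge s R ⊕ w · p) (wedge-self s ω))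
           (trans (cong (z · wedge s R ⊕_) (·-zeroʳ w)) (⊕-identityʳ _))) ⟩
  x · (w · wedge r S) ⊕ y · (z · wedge s R)
    ≡⟨ cong₂ _⊕_ (·-assoc x w _) (trans (cong (λ p → y · (z · p)) (wedge-anticomm s r ω))
         (trans (·-assoc y z _) (·-assoc (y ℤ.* z) _ _))) ⟩
  (x ℤ.* w) · wedge r S ⊕ (y ℤ.* z ℤ.* ℤ.- (+ 1)) · wedge r S
    ≡⟨ sym (·-distribʳ-⊕ (x ℤ.* w) (y ℤ.* z ℤ.* ℤ.- (+ 1)) _) ⟩
  (x ℤ.* w ℤ.+ y ℤ.* z ℤ.* ℤ.- (+ 1)) · wedge r S
    ≡⟨ cong (_· wedge r S) (cong (ℤ._+_ (x ℤ.* w)) (trans (ℤₚ.*-comm (y ℤ.* z) (ℤ.- (+ 1))) (ℤₚ.-1*i≡-i (y ℤ.* z)))) ⟩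
  (x ℤ.* w ℤ.- y ℤ.* z) · wedge r S ∎
  where
  open ≡-Reasoning
  R = wedge r ω
  S = wedge s ω
  lin : ∀ x y η → wedge (λ j → x ℤ.* r j ℤ.+ y ℤ.* s j) η ≡ x · wedge r η ⊕ y · wedge s η
  lin x y η = trans (wedge-+ (λ j → x ℤ.* r j) (λ j → y ℤ.* s j) η) (cong₂ _⊕_ (wedge-* x r η) (wedge-* y s η))
  expand : ∀ t → wedge t (z · R ⊕ w · S) ≡ z · wedge t R ⊕ w · wedge t S
  expand t = trans (wedge-⊕ t _ _) (cong₂ _⊕_ (wedge-· t z R) (wedge-· t w S))

-- Row i of the first block is paired with row i of the second. The first row of the second block is
-- moved past the rest of the first block, the pair yields the factor δ, and `s fzero` is moved
-- back; the sign `alt k` of the first move is used up by the second.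
wedgeAll-pairs : ∀ {n} k (r s : Fin k → Vect n) x y z w ω →
  wedgeAll k (λ i j → x ℤ.* r i j ℤ.+ y ℤ.* s i j) (wedgeAll k (λ i j → z ℤ.* r i j ℤ.+ w ℤ.* s i j) ω)
    ≡ ((x ℤ.* w ℤ.- y ℤ.* z) ℤ.^ k) · wedgeAll k r (wedgeAll k s ω)
wedgeAll-pairs zero r s x y z w ω = sym (·-identityˡ ω)
wedgeAll-pairs {n} (suc k) r s x y z w ω = begin
  wedge u₀ (wedgeAll k u' (wedge v₀ (wedgeAll k v' ω)))
    ≡⟨ cong (wedge u₀) (wedgeAll-wedge k u' v₀ (wedgeAll k v' ω)) ⟩
  wedge u₀ (alt k · wedge v₀ (wedgeAll k u' (wedgeAll k v' ω)))
    ≡⟨ cong (λ η → wedge u₀ (alt k · wedge v₀ η)) (wedgeAll-pairs k (r ∘ fsuc) (s ∘ fsuc) x y z w ω) ⟩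
  wedge u₀ (alt k · wedge v₀ (δ ℤ.^ k · P))
    ≡⟨ wedge-· u₀ (alt k) (wedge v₀ (δ ℤ.^ k · P)) ⟩
  alt k · wedge u₀ (wedge v₀ (δ ℤ.^ k · P))
    ≡⟨ cong (alt k ·_) (wedge-pair (r fzero) (s fzero) x y z w (δ ℤ.^ k · P)) ⟩
  alt k · (δ · wedge (r fzero) (wedge (s fzero) (δ ℤ.^ k · P)))
    ≡⟨ cong (λ η → alt k · (δ · η))
         (trans (cong (wedge (r fzero)) (wedge-· (s fzero) (δ ℤ.^ k) P)) (wedge-· (r fzero) (δ ℤ.^ k) _)) ⟩
  alt k · (δ · (δ ℤ.^ k · wedge (r fzero) (wedge (s fzero) P)))
    ≡⟨ trans (cong (alt k ·_) (·-assoc δ (δ ℤ.^ k) _)) (·-comm (alt k) (δ ℤ.^ suc k) _) ⟩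
  (δ ℤ.^ suc k) · (alt k · wedge (r fzero) (wedge (s fzero) P))
    ≡⟨ cong ((δ ℤ.^ suc k) ·_) (trans (sym (wedge-· (r fzero) (alt k) _))
         (cong (wedge (r fzero)) (sym (wedgeAll-wedge k (r ∘ fsuc) (s fzero) (wedgeAll k (s ∘ fsuc) ω))))) ⟩
  (δ ℤ.^ suc k) · wedgeAll (suc k) r (wedgeAll (suc k) s ω) ∎
  where
  open ≡-Reasoning
  δ = x ℤ.* w ℤ.- y ℤ.* z
  u v : Fin (suc k) → Vect n
  u i j = x ℤ.* r i j ℤ.+ y ℤ.* s i j
  v i j = z ℤ.* r i j ℤ.+ w ℤ.* s i j
  u₀ = u fzero
  u' = u ∘ fsuc
  v₀ = v fzero
  v' = v ∘ fsuc
  P = wedgeAll k (r ∘ fsuc) (wedgeAll k (s ∘ fsuc) ω)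

-- The one rule behind three later facts: the action of the adjugate of A on the pair (F, G), the
-- removal of the content, and the exchange of the two forms.
resF-linear : ∀ d x y z w f g →
  resF d (λ k → x ℤ.* f k ℤ.+ y ℤ.* g k) (λ k → z ℤ.* f k ℤ.+ w ℤ.* g k)
    ≡ (x ℤ.* w ℤ.- y ℤ.* z) ℤ.^ d ℤ.* resF d f g
resF-linear d x y z w f g = begin
  resF d u v
    ≡⟨ resF-wedge d u v ⟩
  top (wedgeAll d (sylRows d u) (wedgeAll d (sylRows d v) unit))
    ≡⟨ cong top (trans (wedgeAll-cong d (λ i j → sylRow-linear d x y f g (toℕ i) (toℕ j)) _)
         (cong (wedgeAll d (λ i j → x ℤ.* sylRows d f i j ℤ.+ y ℤ.* sylRows d g i j))
           (wedgeAll-cong d (λ i j → sylRow-linear d z w f g (toℕ i) (toℕ j)) unit))) ⟩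
  top (wedgeAll d (λ i j → x ℤ.* sylRows d f i j ℤ.+ y ℤ.* sylRows d g i j)
    (wedgeAll d (λ i j → z ℤ.* sylRows d f i j ℤ.+ w ℤ.* sylRows d g i j) unit))
    ≡⟨ cong top (wedgeAll-pairs d (sylRows d f) (sylRows d g) x y z w unit) ⟩
  top (δ ℤ.^ d · wedgeAll d (sylRows d f) (wedgeAll d (sylRows d g) unit))
    ≡⟨ top-· (δ ℤ.^ d) (wedgeAll d (sylRows d f) (wedgeAll d (sylRows d g) unit)) ⟩
  δ ℤ.^ d ℤ.* top (wedgeAll d (sylRows d f) (wedgeAll d (sylRows d g) unit))
    ≡⟨ cong (δ ℤ.^ d ℤ.*_) (sym (resF-wedge d f g)) ⟩
  δ ℤ.^ d ℤ.* resF d f g ∎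
  where
  open ≡-Reasoning
  δ = x ℤ.* w ℤ.- y ℤ.* z
  u v : Form
  u k = x ℤ.* f k ℤ.+ y ℤ.* g k
  v k = z ℤ.* f k ℤ.+ w ℤ.* g k

-- The substitution matrix and the Sylvester matrix

-- The matrix of P ↦ P(L, M) on forms of degree n - 1, in the basis
-- X^(n-1), …, Y^(n-1).
subMatrix : ∀ n → Form → Form → Fin n → Vect n
subMatrix n L M i j = mulF (powF L q) (powF M (pred n ∸ q)) (n ∸ suc (toℕ j))
  where q = n ∸ suc (toℕ i)

comb-subMatrix : ∀ n P L M j →
  comb (λ i → P (suc n ∸ suc (toℕ i))) (subMatrix (suc n) L M) j ≡ cmp n P L M (suc n ∸ suc (toℕ j))
comb-subMatrix n P L M j =
  sumFin-reverse (suc n) (λ q → P q ℤ.* mulF (powF L q) (powF M (n ∸ q)) (n ∸ toℕ j))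

mulF-expand : ∀ n E C → (∀ k → n ≤ k → E k ≡ + 0) → ∀ x →
  mulF E C x ≡ sumTo n (λ q → E q ℤ.* shiftF q C x)
mulF-expand zero E C z x = sumTo-zero (suc x) (λ i _ → cong (ℤ._* C (x ∸ i)) (z i z≤n))
mulF-expand (suc n) E C z zero = sym (trans (sumTo-shift n (λ q → E q ℤ.* shiftF q C 0))
  (trans (cong (ℤ._+_ (E 0 ℤ.* C 0)) (sumTo-zero n (λ i _ → ℤₚ.*-zeroʳ (E (suc i))))) refl))
mulF-expand (suc n) E C z (suc x) = trans (mulF-suc E C x) (trans
  (cong (ℤ._+_ (E 0 ℤ.* C (suc x))) (mulF-expand n (E ∘ suc) C (λ k le → z (suc k) (s≤s le)) x))
  (sym (sumTo-shift n (λ q → E q ℤ.* shiftF q C (suc x)))))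

cmp-shift-expand : ∀ d' F L M → Deg (suc d') F → ∀ q → q ≤ d' →
  cmp (d' + suc d') (shiftF q F) L M
    ≈ mulF (mulF (powF L q) (powF M (d' ∸ q))) (cmp (suc d') F L M)
cmp-shift-expand d' F L M deg q q≤d' k = begin
  cmp (d' + d) (shiftF q F) L M k
    ≡⟨ cong (λ m → cmp m (shiftF q F) L M k)
         (trans (cong (_+ d) (sym (m+[n∸m]≡n q≤d'))) (+-assoc q (d' ∸ q) d)) ⟩
  cmp (q + ((d' ∸ q) + d)) (shiftF q F) L M k
    ≡⟨ cmp-shifts q ((d' ∸ q) + d) F L M k ⟩
  mulF (powF L q) (cmp ((d' ∸ q) + d) F L M) k
    ≡⟨ mulF-cong {f = powF L q} (λ _ → refl) (cmp-raises (d' ∸ q) d F L M deg) k ⟩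
  mulF (powF L q) (mulF (powF M (d' ∸ q)) (cmp d F L M)) k
    ≡⟨ sym (mulF-assoc (powF L q) (powF M (d' ∸ q)) (cmp d F L M) k) ⟩
  mulF (mulF (powF L q) (powF M (d' ∸ q))) (cmp d F L M) k ∎
  where
  open ≡-Reasoning
  d = suc d'

-- Substituting (L, M) into `X^q Y^(d-1-q) F` gives `L^q M^(d-1-q)` times F(L, M). Expanding the
-- first factor in monomials expresses the result through the rows of the Sylvester block of F(L,
-- M).
comb-sylRows : ∀ d' F a b c e → Deg (suc d') F → ∀ i j →
  comb (sylRows (suc d') F i) (subMatrix (suc d' + suc d') (linF a b) (linF c e)) j
    ≡ comb (subMatrix (suc d') (linF a b) (linF c e) i) (sylRows (suc d') (composeF (suc d') F a b c e)) j
comb-sylRows d' F a b c e deg i j = begin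
  comb (sylRows d F i) (subMatrix (d + d) L M) j
    ≡⟨ sumFin-cong {f = λ r → sylRows d F i r ℤ.* subMatrix (d + d) L M r j}
         (λ r → cong (ℤ._* subMatrix (d + d) L M r j) (sylRow-shift d F (toℕ i) (toℕ r) deg (Finₚ.toℕ<n i) (Finₚ.toℕ<n r))) ⟩
  comb (λ r → shiftF q F (d + d ∸ suc (toℕ r))) (subMatrix (d + d) L M) j
    ≡⟨ comb-subMatrix (d' + d) (shiftF q F) L M j ⟩
  cmp (d' + d) (shiftF q F) L M x
    ≡⟨ cmp-shift-expand d' F L M deg q (m∸n≤m d' (toℕ i)) x ⟩
  mulF E C x
    ≡⟨ mulF-expand d E C degE x ⟩
  sumTo d (λ k → E k ℤ.* shiftF k C x)
    ≡⟨ sym (sumFin-reverse d (λ k → E k ℤ.* shiftF k C x)) ⟩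
  sumFin {d} (λ k → E (d ∸ suc (toℕ k)) ℤ.* shiftF (d ∸ suc (toℕ k)) C x)
    ≡⟨ sym (sumFin-cong {f = λ k → E (d ∸ suc (toℕ k)) ℤ.* sylRows d C k j}
         (λ k → cong (E (d ∸ suc (toℕ k)) ℤ.*_)
            (sylRow-shift d C (toℕ k) (toℕ j) (Deg-compose d F a b c e) (Finₚ.toℕ<n k) (Finₚ.toℕ<n j)))) ⟩
  comb (subMatrix d L M i) (sylRows d C) j ∎
  where
  open ≡-Reasoning
  d = suc d'
  L = linF a b
  M = linF c e
  q = d ∸ suc (toℕ i)
  x = d + d ∸ suc (toℕ j)
  C = composeF d F a b c e
  E = mulF (powF L q) (powF M (d' ∸ q))
  degE : ∀ k → d ≤ k → E k ≡ + 0
  degE k lt = Deg-mul {q} {d' ∸ q} (Deg-pow a b q) (Deg-pow c e (d' ∸ q)) k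
    (subst (_< k) (sym (m+[n∸m]≡n (m∸n≤m d' (toℕ i)))) lt)

-- Each of the two blocks contributes the determinant of the matrix of size d once. The equation is
-- left undivided, and the determinants are evaluated for triangular substitutions only.
resF-compose : ∀ d' F G a b c e → Deg (suc d') F → Deg (suc d') G →
  resF (suc d') F G ℤ.* detE (suc d' + suc d') (subMatrix (suc d' + suc d') (linF a b) (linF c e))
    ≡ detE (suc d') (subMatrix (suc d') (linF a b) (linF c e)) ℤ.*
      (detE (suc d') (subMatrix (suc d') (linF a b) (linF c e)) ℤ.*
        resF (suc d') (composeF (suc d') F a b c e) (composeF (suc d') G a b c e))
resF-compose d' F G a b c e degF degG = begin
  resF d F G ℤ.* detE (d + d) T
    ≡⟨ cong (ℤ._* detE (d + d) T) (det≡detE (d + d) (sylvester d F G)) ⟩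
  detE (d + d) (sylvester d F G) ℤ.* detE (d + d) T
    ≡⟨ sym (detE-comb (d + d) (sylvester d F G) T) ⟩
  detE (d + d) (λ i → comb (sylvester d F G i) T)
    ≡⟨ cong top (wedgeAll-++ d d (λ i → comb (sylvester d F G i) T) unit) ⟩
  top (wedgeAll d (λ i → comb (sylvester d F G (i Fin.↑ˡ d)) T)
        (wedgeAll d (λ i → comb (sylvester d F G (d Fin.↑ʳ i)) T) unit))
    ≡⟨ cong top (trans
         (wedgeAll-cong d (λ i j → trans (comb-cong (sylvester-top d F G i) j) (comb-sylRows d' F a b c e degF i j)) _)
         (cong (wedgeAll d (λ i → comb (S i) RF))
           (wedgeAll-cong d (λ i j → trans (comb-cong (sylvester-bottom d F G i) j) (comb-sylRows d' G a b c e degG i j)) unit))) ⟩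
  top (wedgeAll d (λ i → comb (S i) RF) (wedgeAll d (λ i → comb (S i) RG) unit))
    ≡⟨ cong top (trans (wedgeAll-comb S RF _)
         (cong (detE d S ·_) (trans (cong (wedgeAll d RF) (wedgeAll-comb S RG unit)) (wedgeAll-· d RF (detE d S) _)))) ⟩
  top (detE d S · (detE d S · Ω))
    ≡⟨ trans (top-· (detE d S) (detE d S · Ω)) (cong (detE d S ℤ.*_) (top-· (detE d S) Ω)) ⟩
  detE d S ℤ.* (detE d S ℤ.* top Ω)
    ≡⟨ cong (λ z → detE d S ℤ.* (detE d S ℤ.* z)) (sym (resF-wedge d (composeF d F a b c e) (composeF d G a b c e))) ⟩
  detE d S ℤ.* (detE d S ℤ.* resF d (composeF d F a b c e) (composeF d G a b c e)) ∎
  where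
  open ≡-Reasoning
  d = suc d'
  T = subMatrix (d + d) (linF a b) (linF c e)
  S = subMatrix d (linF a b) (linF c e)
  RF = sylRows d (composeF d F a b c e)
  RG = sylRows d (composeF d G a b c e)
  Ω = wedgeAll d RF (wedgeAll d RG unit)
  comb-cong : {u v : Vect (d + d)} → (∀ i → u i ≡ v i) → ∀ j → comb u T j ≡ comb v T j
  comb-cong {u} e j = sumFin-cong {f = λ i → u i ℤ.* T i j} (λ i → cong (ℤ._* T i j) (e i))

-- Determinants of triangular substitutions

tri : ℕ → ℕ
tri zero    = zero
tri (suc n) = suc n + tri n

tri-double : ∀ n → 2 * tri n ≡ n * suc n
tri-double zero = refl
tri-double (suc n) = trans (*-distribˡ-+ 2 (suc n) (tri n)) (trans (cong (ℕ._+_ (2 * suc n)) (tri-double n)) (arith n))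
  where
  arith : ∀ n → 2 * suc n + n * suc n ≡ suc n * suc (suc n)
  arith = ℕ-Ring.solve-∀

-- The matrix of size n + 1 will have determinant `δ ^ tri n`; so d² is the exponent left over when
-- the determinant of size 2d is divided by the square of the one of size d.
tri-double-size : ∀ d' → tri (d' + suc d') ≡ tri d' + (tri d' + suc d' * suc d')
tri-double-size d' = *-cancelˡ-≡ _ _ 2 (begin
  2 * tri (d' + suc d')                        ≡⟨ tri-double (d' + suc d') ⟩
  (d' + suc d') * suc (d' + suc d')            ≡⟨ arith₁ d' ⟩
  d' * suc d' + (d' * suc d' + 2 * (suc d' * suc d'))
    ≡⟨ cong₂ (λ x y → x + (y + 2 * (suc d' * suc d'))) (sym (tri-double d')) (sym (tri-double d')) ⟩
  2 * tri d' + (2 * tri d' + 2 * (suc d' * suc d')) ≡⟨ arith₂ (tri d') (suc d' * suc d') ⟩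
  2 * (tri d' + (tri d' + suc d' * suc d'))    ∎)
  where
  open ≡-Reasoning
  arith₁ : ∀ d → (d + suc d) * suc (d + suc d) ≡ d * suc d + (d * suc d + 2 * (suc d * suc d))
  arith₁ = ℕ-Ring.solve-∀
  arith₂ : ∀ t s → 2 * t + (2 * t + 2 * s) ≡ 2 * (t + (t + s))
  arith₂ = ℕ-Ring.solve-∀

prodFin-cong : ∀ n {f g : Fin n → ℤ} → (∀ i → f i ≡ g i) → prodFin n f ≡ prodFin n g
prodFin-cong zero e = refl
prodFin-cong (suc n) e = cong₂ ℤ._*_ (e fzero) (prodFin-cong n (e ∘ fsuc))

^-+ : ∀ x m n → x ℤ.^ (m + n) ≡ x ℤ.^ m ℤ.* x ℤ.^ n
^-+ = ℤₚ.^-distribˡ-+-*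

^-*-base : ∀ x y n → (x ℤ.* y) ℤ.^ n ≡ x ℤ.^ n ℤ.* y ℤ.^ n
^-*-base x y zero = refl
^-*-base x y (suc n) = trans (cong ((x ℤ.* y) ℤ.*_) (^-*-base x y n)) (arith x y (x ℤ.^ n) (y ℤ.^ n))
  where
  arith : ∀ a b c d → (a ℤ.* b) ℤ.* (c ℤ.* d) ≡ (a ℤ.* c) ℤ.* (b ℤ.* d)
  arith = ℤ-Ring.solve-∀

-- The offset `s` is there for the induction: removing the first factor leaves a product of the same
-- shape with `suc s`.
prodFin-powers : ∀ n a e s →
  prodFin (suc n) (λ i → a ℤ.^ (n ∸ toℕ i) ℤ.* e ℤ.^ (toℕ i + s)) ≡ a ℤ.^ tri n ℤ.* e ℤ.^ (tri n + suc n * s)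
prodFin-powers zero a e s = trans (ℤₚ.*-identityʳ _)
  (cong (λ m → + 1 ℤ.* e ℤ.^ m) (sym (+-identityʳ s)))
prodFin-powers (suc n) a e s = begin
  a ℤ.^ suc n ℤ.* e ℤ.^ s ℤ.* prodFin (suc n) (λ i → a ℤ.^ (n ∸ toℕ i) ℤ.* e ℤ.^ (suc (toℕ i) + s))
    ≡⟨ cong (a ℤ.^ suc n ℤ.* e ℤ.^ s ℤ.*_) (trans
         (prodFin-cong (suc n) (λ i → cong (λ m → a ℤ.^ (n ∸ toℕ i) ℤ.* e ℤ.^ m) (sym (+-suc (toℕ i) s))))
         (prodFin-powers n a e (suc s))) ⟩
  a ℤ.^ suc n ℤ.* e ℤ.^ s ℤ.* (a ℤ.^ tri n ℤ.* e ℤ.^ (tri n + suc n * suc s))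
    ≡⟨ arith (a ℤ.^ suc n) (e ℤ.^ s) (a ℤ.^ tri n) _ ⟩
  a ℤ.^ suc n ℤ.* a ℤ.^ tri n ℤ.* (e ℤ.^ s ℤ.* e ℤ.^ (tri n + suc n * suc s))
    ≡⟨ cong₂ ℤ._*_ (sym (^-+ a (suc n) (tri n))) (sym (^-+ e s (tri n + suc n * suc s))) ⟩
  a ℤ.^ tri (suc n) ℤ.* e ℤ.^ (s + (tri n + suc n * suc s))
    ≡⟨ cong (λ m → a ℤ.^ tri (suc n) ℤ.* e ℤ.^ m) (arith′ n s (tri n)) ⟩
  a ℤ.^ tri (suc n) ℤ.* e ℤ.^ (tri (suc n) + suc (suc n) * s) ∎
  where
  open ≡-Reasoning
  arith : ∀ a b c d → a ℤ.* b ℤ.* (c ℤ.* d) ≡ a ℤ.* c ℤ.* (b ℤ.* d)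
  arith = ℤ-Ring.solve-∀
  arith′ : ∀ n s t → s + (t + suc n * suc s) ≡ (suc n + t) + suc (suc n) * s
  arith′ = ℕ-Ring.solve-∀

powF-top : ∀ a b n → powF (linF a b) n n ≡ a ℤ.^ n
powF-top a b zero = refl
powF-top a b (suc n) = trans (mulF-top 1 (Deg-lin a b) (Deg-pow a b n)) (cong (a ℤ.*_) (powF-top a b n))

powF-bottom : ∀ a b n → powF (linF a b) n 0 ≡ b ℤ.^ n
powF-bottom a b zero = refl
powF-bottom a b (suc n) = trans (ℤₚ.+-identityʳ _) (cong (b ℤ.*_) (powF-bottom a b n))

powF-constant : ∀ b n → Deg 0 (powF (linF (+ 0) b) n)
powF-constant b zero (suc k) lt = refl
powF-constant b (suc n) = Deg-mul {0} {0} linear (powF-constant b n)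
  where
  linear : Deg 0 (linF (+ 0) b)
  linear (suc zero) lt = refl
  linear (suc (suc k)) lt = refl

powF-low : ∀ a n → Low n (powF (linF a (+ 0)) n)
powF-low a (suc n) k lt = trans (linF-mul a (+ 0) (powF (linF a (+ 0)) n) k)
  (trans (ℤₚ.+-identityˡ _) (trans (cong (a ℤ.*_) (low k lt)) (ℤₚ.*-zeroʳ a)))
  where
  low : ∀ k → k < suc n → shiftF 1 (powF (linF a (+ 0)) n) k ≡ + 0
  low zero lt = refl
  low (suc k) (s≤s lt) = powF-low a n k lt

prod-diagonal : ∀ n a e → prodFin (suc n) (λ i → a ℤ.^ (n ∸ toℕ i) ℤ.* e ℤ.^ (n ∸ (n ∸ toℕ i))) ≡ (a ℤ.* e) ℤ.^ tri n
prod-diagonal n a e = trans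
  (prodFin-cong (suc n) (λ i → cong (λ m → a ℤ.^ (n ∸ toℕ i) ℤ.* e ℤ.^ m)
    (trans (m∸[m∸n]≡n (≤-pred (Finₚ.toℕ<n i))) (sym (+-identityʳ (toℕ i))))))
  (trans (prodFin-powers n a e 0) (trans
    (cong (λ m → a ℤ.^ tri n ℤ.* e ℤ.^ m) (trans (cong (ℕ._+_ (tri n)) (*-zeroʳ (suc n))) (+-identityʳ (tri n))))
    (sym (^-*-base a e (tri n)))))

-- When the second linear form is `e Y`, the form `L^q (e Y)^(n-q)` has degree at most q in X, with
-- leading coefficient `a^q e^(n-q)`. In the lower triangular case the first form is `a X`, and the
-- products are divisible by X^q instead.
detE-subMatrix-upper : ∀ n a b e → detE (suc n) (subMatrix (suc n) (linF a b) (linF (+ 0) e)) ≡ (a ℤ.* e) ℤ.^ tri n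
detE-subMatrix-upper n a b e = trans (detE-upper (suc n) M vanish) (trans (prodFin-cong (suc n) diagonal) (prod-diagonal n a e))
  where
  M = subMatrix (suc n) (linF a b) (linF (+ 0) e)
  q : Fin (suc n) → ℕ
  q i = n ∸ toℕ i
  vanish : ∀ i j → toℕ j < toℕ i → M i j ≡ + 0
  vanish i j lt = Deg-mul {q i} {0} (Deg-pow a b (q i)) (powF-constant e (n ∸ q i)) (q j)
    (subst (_< q j) (sym (+-identityʳ (q i))) (∸-monoʳ-< lt (≤-pred (Finₚ.toℕ<n i))))
  diagonal : ∀ i → M i i ≡ a ℤ.^ q i ℤ.* e ℤ.^ (n ∸ q i)
  diagonal i = trans (cong (mulF (powF (linF a b) (q i)) (powF (linF (+ 0) e) (n ∸ q i))) (sym (+-identityʳ (q i))))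
    (trans (mulF-top (q i) (Deg-pow a b (q i)) (powF-constant e (n ∸ q i)))
      (cong₂ ℤ._*_ (powF-top a b (q i)) (powF-bottom (+ 0) e (n ∸ q i))))

detE-subMatrix-lower : ∀ n a c e → detE (suc n) (subMatrix (suc n) (linF a (+ 0)) (linF c e)) ≡ (a ℤ.* e) ℤ.^ tri n
detE-subMatrix-lower n a c e = trans (detE-lower (suc n) M vanish) (trans (prodFin-cong (suc n) diagonal) (prod-diagonal n a e))
  where
  M = subMatrix (suc n) (linF a (+ 0)) (linF c e)
  q : Fin (suc n) → ℕ
  q i = n ∸ toℕ i
  vanish : ∀ i j → toℕ i < toℕ j → M i j ≡ + 0
  vanish i j lt = mulF-low {Q = powF (linF c e) (n ∸ q i)} (powF-low a (q i)) (q j) (∸-monoʳ-< lt (≤-pred (Finₚ.toℕ<n j)))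
  diagonal : ∀ i → M i i ≡ a ℤ.^ q i ℤ.* e ℤ.^ (n ∸ q i)
  diagonal i = trans (mulF-bottom (q i) {Q = powF (linF c e) (n ∸ q i)} (powF-low a (q i)))
    (cong₂ ℤ._*_ (powF-top a (+ 0) (q i)) (powF-bottom c e (n ∸ q i)))

^-nonZero : ∀ x n → x ≢ + 0 → x ℤ.^ n ≢ + 0
^-nonZero x zero x≢0 ()
^-nonZero x (suc n) x≢0 e with ℤₚ.i*j≡0⇒i≡0∨j≡0 x e
... | inj₁ z = x≢0 z
... | inj₂ z = ^-nonZero x n x≢0 z

*-cancelˡ : ∀ x {y z} → x ≢ + 0 → x ℤ.* y ≡ x ℤ.* z → y ≡ z
*-cancelˡ x {y} {z} x≢0 e = ℤₚ.*-cancelˡ-≡ x y z {{ℤ.≢-nonZero x≢0}} e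

-- From triangular to arbitrary substitutions

record Mat : Set where
  constructor mat
  field a b c e : ℤ

_⊗_ : Mat → Mat → Mat
mat a b c e ⊗ mat a' b' c' e' =
  mat (a ℤ.* a' ℤ.+ b ℤ.* c') (a ℤ.* b' ℤ.+ b ℤ.* e') (c ℤ.* a' ℤ.+ e ℤ.* c') (c ℤ.* b' ℤ.+ e ℤ.* e')

disc : Mat → ℤ
disc (mat a b c e) = a ℤ.* e ℤ.- b ℤ.* c

disc-⊗ : ∀ A B → disc (A ⊗ B) ≡ disc A ℤ.* disc B
disc-⊗ (mat a b c e) (mat a' b' c' e') = arith a b c e a' b' c' e'
  where
  arith : ∀ a b c e a' b' c' e' →
    (a ℤ.* a' ℤ.+ b ℤ.* c') ℤ.* (c ℤ.* b' ℤ.+ e ℤ.* e') ℤ.- (a ℤ.* b' ℤ.+ b ℤ.* e') ℤ.* (c ℤ.* a' ℤ.+ e ℤ.* c')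
      ≡ (a ℤ.* e ℤ.- b ℤ.* c) ℤ.* (a' ℤ.* e' ℤ.- b' ℤ.* c')
  arith = ℤ-Ring.solve-∀

_∘F[_]_ : Form → ℕ → Mat → Form
F ∘F[ d ] mat a b c e = composeF d F a b c e

TransformsResultant : ℕ → Mat → Set
TransformsResultant d A = ∀ F G → Deg d F → Deg d G →
  resF d (F ∘F[ d ] A) (G ∘F[ d ] A) ≡ disc A ℤ.^ (d * d) ℤ.* resF d F G

transforms-from-det : ∀ d' a b c e → a ℤ.* e ℤ.- b ℤ.* c ≢ + 0 →
  (∀ n → detE (suc n) (subMatrix (suc n) (linF a b) (linF c e)) ≡ (a ℤ.* e ℤ.- b ℤ.* c) ℤ.^ tri n) →
  TransformsResultant (suc d') (mat a b c e)
transforms-from-det d' a b c e δ≢0 dets F G degF degG =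
  *-cancelˡ s (^-nonZero δ (tri d') δ≢0) (*-cancelˡ s (^-nonZero δ (tri d') δ≢0) (begin
    s ℤ.* (s ℤ.* R')
      ≡⟨ cong (λ x → x ℤ.* (x ℤ.* R')) (sym (dets d')) ⟩
    detE d S ℤ.* (detE d S ℤ.* R')
      ≡⟨ sym (resF-compose d' F G a b c e degF degG) ⟩
    R ℤ.* detE (d + d) (subMatrix (d + d) (linF a b) (linF c e))
      ≡⟨ cong (R ℤ.*_) (trans (dets (d' + d)) (cong (δ ℤ.^_) (tri-double-size d'))) ⟩
    R ℤ.* δ ℤ.^ (tri d' + (tri d' + d * d))
      ≡⟨ cong (R ℤ.*_) (trans (^-+ δ (tri d') _) (cong (s ℤ.*_) (^-+ δ (tri d') (d * d)))) ⟩
    R ℤ.* (s ℤ.* (s ℤ.* δ ℤ.^ (d * d)))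
      ≡⟨ arith R s (δ ℤ.^ (d * d)) ⟩
    s ℤ.* (s ℤ.* (δ ℤ.^ (d * d) ℤ.* R)) ∎))
  where
  open ≡-Reasoning
  d = suc d'
  δ = a ℤ.* e ℤ.- b ℤ.* c
  s = δ ℤ.^ tri d'
  S = subMatrix d (linF a b) (linF c e)
  R = resF d F G
  R' = resF d (composeF d F a b c e) (composeF d G a b c e)
  arith : ∀ r s t → r ℤ.* (s ℤ.* (s ℤ.* t)) ≡ s ℤ.* (s ℤ.* (t ℤ.* r))
  arith = ℤ-Ring.solve-∀

disc-upper : ∀ a b e → a ℤ.* e ℤ.- b ℤ.* + 0 ≡ a ℤ.* e
disc-upper = ℤ-Ring.solve-∀

disc-lower : ∀ a c e → a ℤ.* e ℤ.- + 0 ℤ.* c ≡ a ℤ.* e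
disc-lower = ℤ-Ring.solve-∀

transforms-upper : ∀ d' a b e → disc (mat a b (+ 0) e) ≢ + 0 → TransformsResultant (suc d') (mat a b (+ 0) e)
transforms-upper d' a b e δ≢0 = transforms-from-det d' a b (+ 0) e δ≢0
  (λ n → trans (detE-subMatrix-upper n a b e) (cong (ℤ._^ tri n) (sym (disc-upper a b e))))

transforms-lower : ∀ d' a c e → disc (mat a (+ 0) c e) ≢ + 0 → TransformsResultant (suc d') (mat a (+ 0) c e)
transforms-lower d' a c e δ≢0 = transforms-from-det d' a (+ 0) c e δ≢0
  (λ n → trans (detE-subMatrix-lower n a c e) (cong (ℤ._^ tri n) (sym (disc-lower a c e))))

resF-∘F-⊗ : ∀ d F G A B →
  resF d ((F ∘F[ d ] A) ∘F[ d ] B) ((G ∘F[ d ] A) ∘F[ d ] B) ≡ resF d (F ∘F[ d ] (A ⊗ B)) (G ∘F[ d ] (A ⊗ B))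
resF-∘F-⊗ d F G (mat a b c e) (mat a' b' c' e') = resF-cong d
  (λ k _ → composeF-composeF d F a b c e a' b' c' e' k)
  (λ k _ → composeF-composeF d G a b c e a' b' c' e' k)

transforms-⊗ : ∀ d A B → TransformsResultant d A → TransformsResultant d B → TransformsResultant d (A ⊗ B)
transforms-⊗ d A B tA tB F G degF degG = begin
  resF d (F ∘F[ d ] (A ⊗ B)) (G ∘F[ d ] (A ⊗ B))
    ≡⟨ sym (resF-∘F-⊗ d F G A B) ⟩
  resF d ((F ∘F[ d ] A) ∘F[ d ] B) ((G ∘F[ d ] A) ∘F[ d ] B)
    ≡⟨ tB _ _ (Deg-compose d F _ _ _ _) (Deg-compose d G _ _ _ _) ⟩
  disc B ℤ.^ (d * d) ℤ.* resF d (F ∘F[ d ] A) (G ∘F[ d ] A)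
    ≡⟨ cong (disc B ℤ.^ (d * d) ℤ.*_) (tA F G degF degG) ⟩
  disc B ℤ.^ (d * d) ℤ.* (disc A ℤ.^ (d * d) ℤ.* resF d F G)
    ≡⟨ arith (disc B ℤ.^ (d * d)) (disc A ℤ.^ (d * d)) (resF d F G) ⟩
  disc A ℤ.^ (d * d) ℤ.* disc B ℤ.^ (d * d) ℤ.* resF d F G
    ≡⟨ cong (ℤ._* resF d F G) (trans (sym (^-*-base (disc A) (disc B) (d * d))) (cong (ℤ._^ (d * d)) (sym (disc-⊗ A B)))) ⟩
  disc (A ⊗ B) ℤ.^ (d * d) ℤ.* resF d F G ∎
  where
  open ≡-Reasoning
  arith : ∀ x y z → x ℤ.* (y ℤ.* z) ≡ y ℤ.* x ℤ.* z
  arith = ℤ-Ring.solve-∀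

-- An integral matrix need not have an integral inverse. Instead of multiplying by the inverse of B,
-- the rule for `A ⊗ B` is divided by a nonzero power of `disc B`.
transforms-cancel : ∀ d A B → disc B ≢ + 0 → TransformsResultant d B → TransformsResultant d (A ⊗ B) → TransformsResultant d A
transforms-cancel d A B δ≢0 tB tAB F G degF degG = *-cancelˡ β (^-nonZero (disc B) (d * d) δ≢0) (begin
  β ℤ.* resF d (F ∘F[ d ] A) (G ∘F[ d ] A)
    ≡⟨ sym (tB _ _ (Deg-compose d F _ _ _ _) (Deg-compose d G _ _ _ _)) ⟩
  resF d ((F ∘F[ d ] A) ∘F[ d ] B) ((G ∘F[ d ] A) ∘F[ d ] B)
    ≡⟨ resF-∘F-⊗ d F G A B ⟩
  resF d (F ∘F[ d ] (A ⊗ B)) (G ∘F[ d ] (A ⊗ B))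
    ≡⟨ tAB F G degF degG ⟩
  disc (A ⊗ B) ℤ.^ (d * d) ℤ.* resF d F G
    ≡⟨ cong (ℤ._* resF d F G) (trans (cong (ℤ._^ (d * d)) (disc-⊗ A B)) (^-*-base (disc A) (disc B) (d * d))) ⟩
  disc A ℤ.^ (d * d) ℤ.* β ℤ.* resF d F G
    ≡⟨ arith (disc A ℤ.^ (d * d)) β (resF d F G) ⟩
  β ℤ.* (disc A ℤ.^ (d * d) ℤ.* resF d F G) ∎)
  where
  open ≡-Reasoning
  β = disc B ℤ.^ (d * d)
  arith : ∀ x y z → x ℤ.* y ℤ.* z ≡ y ℤ.* (x ℤ.* z)
  arith = ℤ-Ring.solve-∀

mat-≡ : ∀ {a b c e a' b' c' e'} → a ≡ a' → b ≡ b' → c ≡ c' → e ≡ e' → mat a b c e ≡ mat a' b' c' e'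
mat-≡ refl refl refl refl = refl

*-nonZero : ∀ {x y} → x ≢ + 0 → y ≢ + 0 → x ℤ.* y ≢ + 0
*-nonZero {x} {y} p q e with ℤₚ.i*j≡0⇒i≡0∨j≡0 x e
... | inj₁ z = p z
... | inj₂ z = q z

-- With δ = ae - bc one has
-- [[a, b], [c, e]]·diag(1, a) = [[a, 0], [c, δ]]·[[1, b], [0, 1]].
transforms-a≢0 : ∀ d' a b c e → a ≢ + 0 → disc (mat a b c e) ≢ + 0 → TransformsResultant (suc d') (mat a b c e)
transforms-a≢0 d' a b c e a≢0 δ≢0 = transforms-cancel (suc d') (mat a b c e) (mat (+ 1) (+ 0) (+ 0) a)
  D≢0 (transforms-upper d' (+ 1) (+ 0) a D≢0)
  (subst (TransformsResultant (suc d')) factorisation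
    (transforms-⊗ (suc d') (mat a (+ 0) c δ) (mat (+ 1) b (+ 0) (+ 1))
      (transforms-lower d' a c δ (λ z → *-nonZero a≢0 δ≢0 (trans (sym (disc-lower a c δ)) z)))
      (transforms-upper d' (+ 1) b (+ 1) (λ z → one≢0 (trans (sym (disc-upper (+ 1) b (+ 1))) z)))))
  where
  δ = a ℤ.* e ℤ.- b ℤ.* c
  one≢0 : + 1 ≢ + 0
  one≢0 ()
  D≢0 : disc (mat (+ 1) (+ 0) (+ 0) a) ≢ + 0
  D≢0 z = a≢0 (trans (sym (ℤₚ.*-identityˡ a)) (trans (sym (disc-upper (+ 1) (+ 0) a)) z))
  factorisation : mat a (+ 0) c δ ⊗ mat (+ 1) b (+ 0) (+ 1) ≡ mat a b c e ⊗ mat (+ 1) (+ 0) (+ 0) a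
  factorisation = mat-≡ (e₁ a b) (e₂ a b) (e₃ a b c e) (e₄ a b c e)
    where
    e₁ : ∀ a b → a ℤ.* + 1 ℤ.+ + 0 ℤ.* + 0 ≡ a ℤ.* + 1 ℤ.+ b ℤ.* + 0
    e₁ = ℤ-Ring.solve-∀
    e₂ : ∀ a b → a ℤ.* b ℤ.+ + 0 ℤ.* + 1 ≡ a ℤ.* + 0 ℤ.+ b ℤ.* a
    e₂ = ℤ-Ring.solve-∀
    e₃ : ∀ a b c e → c ℤ.* + 1 ℤ.+ (a ℤ.* e ℤ.- b ℤ.* c) ℤ.* + 0 ≡ c ℤ.* + 1 ℤ.+ e ℤ.* + 0
    e₃ = ℤ-Ring.solve-∀
    e₄ : ∀ a b c e → c ℤ.* b ℤ.+ (a ℤ.* e ℤ.- b ℤ.* c) ℤ.* + 1 ≡ c ℤ.* + 0 ℤ.+ e ℤ.* a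
    e₄ = ℤ-Ring.solve-∀

transforms : ∀ d' a b c e → disc (mat a b c e) ≢ + 0 → TransformsResultant (suc d') (mat a b c e)
transforms d' a b c e δ≢0 with a ℤ.≟ + 0
... | no a≢0 = transforms-a≢0 d' a b c e a≢0 δ≢0
-- When a = 0, multiplying by the unipotent matrix V puts b into the first entry, and b is nonzero
-- because the determinant is -bc.
... | yes refl = transforms-cancel (suc d') (mat (+ 0) b c e) V (λ ()) (transforms-lower d' (+ 1) (+ 1) (+ 1) (λ ()))
    (transforms-a≢0 d' _ _ _ _ first≢0 (λ z → *-nonZero δ≢0 (λ ()) (trans (sym (disc-⊗ (mat (+ 0) b c e) V)) z)))
  where
  V = mat (+ 1) (+ 0) (+ 1) (+ 1)
  first≢0 : + 0 ℤ.* + 1 ℤ.+ b ℤ.* + 1 ≢ + 0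
  first≢0 z = δ≢0 (trans (cong (λ x → + 0 ℤ.* e ℤ.- x ℤ.* c) (trans (arith b) z)) refl)
    where
    arith : ∀ b → b ≡ + 0 ℤ.* + 1 ℤ.+ b ℤ.* + 1
    arith = ℤ-Ring.solve-∀

resF-conj : ∀ d' F G a b c e → Deg (suc d') F → Deg (suc d') G → a ℤ.* e ℤ.- b ℤ.* c ≢ + 0 →
  resF (suc d') (conjF (suc d') F G a b c e) (conjG (suc d') F G a b c e)
    ≡ (a ℤ.* e ℤ.- b ℤ.* c) ℤ.^ (suc d' * suc (suc d')) ℤ.* resF (suc d') F G
resF-conj d' F G a b c e degF degG δ≢0 = begin
  resF d (conjF d F G a b c e) (conjG d F G a b c e)
    ≡⟨ resF-cong d {g' = conjG d F G a b c e} (λ k _ → cong (ℤ._+_ (e ℤ.* F' k)) (ℤₚ.neg-distribˡ-* b (G' k))) (λ _ _ → refl) ⟩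
  resF d (λ k → e ℤ.* F' k ℤ.+ (ℤ.- b) ℤ.* G' k) (λ k → (ℤ.- c) ℤ.* F' k ℤ.+ a ℤ.* G' k)
    ≡⟨ resF-linear d e (ℤ.- b) (ℤ.- c) a F' G' ⟩
  (e ℤ.* a ℤ.- (ℤ.- b) ℤ.* (ℤ.- c)) ℤ.^ d ℤ.* resF d F' G'
    ≡⟨ cong₂ (λ x y → x ℤ.^ d ℤ.* y) (arith a b c e) (transforms d' a b c e δ≢0 F G degF degG) ⟩
  δ ℤ.^ d ℤ.* (δ ℤ.^ (d * d) ℤ.* resF d F G)
    ≡⟨ sym (ℤₚ.*-assoc (δ ℤ.^ d) (δ ℤ.^ (d * d)) _) ⟩
  δ ℤ.^ d ℤ.* δ ℤ.^ (d * d) ℤ.* resF d F G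
    ≡⟨ cong (ℤ._* resF d F G) (trans (sym (^-+ δ d (d * d))) (cong (δ ℤ.^_) (sym (*-suc d d)))) ⟩
  δ ℤ.^ (d * suc d) ℤ.* resF d F G ∎
  where
  open ≡-Reasoning
  d = suc d'
  δ = a ℤ.* e ℤ.- b ℤ.* c
  F' = composeF d F a b c e
  G' = composeF d G a b c e
  arith : ∀ a b c e → e ℤ.* a ℤ.- (ℤ.- b) ℤ.* (ℤ.- c) ≡ a ℤ.* e ℤ.- b ℤ.* c
  arith = ℤ-Ring.solve-∀

resF-scale : ∀ d g F G → resF d (λ k → g ℤ.* F k) (λ k → g ℤ.* G k) ≡ g ℤ.^ (d + d) ℤ.* resF d F G
resF-scale d g F G = begin
  resF d (λ k → g ℤ.* F k) (λ k → g ℤ.* G k)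
    ≡⟨ resF-cong d (λ k _ → arith₁ g (F k) (G k)) (λ k _ → arith₂ g (F k) (G k)) ⟩
  resF d (λ k → g ℤ.* F k ℤ.+ + 0 ℤ.* G k) (λ k → + 0 ℤ.* F k ℤ.+ g ℤ.* G k)
    ≡⟨ resF-linear d g (+ 0) (+ 0) g F G ⟩
  (g ℤ.* g ℤ.- + 0) ℤ.^ d ℤ.* resF d F G
    ≡⟨ cong (ℤ._* resF d F G) (trans (cong (ℤ._^ d) (ℤₚ.+-identityʳ (g ℤ.* g)))
         (trans (^-*-base g g d) (sym (^-+ g d d)))) ⟩
  g ℤ.^ (d + d) ℤ.* resF d F G ∎
  where
  open ≡-Reasoning
  arith₁ : ∀ g x y → g ℤ.* x ≡ g ℤ.* x ℤ.+ + 0 ℤ.* y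
  arith₁ = ℤ-Ring.solve-∀
  arith₂ : ∀ g x y → g ℤ.* y ≡ + 0 ℤ.* x ℤ.+ g ℤ.* y
  arith₂ = ℤ-Ring.solve-∀

-- Valuations and global minimality
prime-power-cancel : ∀ {p} → Prime p → ∀ m u {v} → ¬ (p ∣ u) → p ^ m ∣ u * v → p ^ m ∣ v
prime-power-cancel pp zero u p∤u h = Div.1∣ _
prime-power-cancel {p} pp (suc m) u {v} p∤u h
  with Pr.euclidsLemma u v pp (Div.∣-trans (Div.m∣m*n (p ^ m)) h)
... | inj₁ p∣u = ⊥-elim (p∤u p∣u)
... | inj₂ (divides w refl) = subst (p * p ^ m ∣_) (*-comm p w) (Div.*-monoʳ-∣ p
        (prime-power-cancel pp m u p∤u
          (Div.*-cancelˡ-∣ p {{Pr.prime⇒nonZero pp}} (subst (p * p ^ m ∣_) (arith u w p) h))))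
  where
  arith : ∀ u w p → u * (w * p) ≡ p * (u * w)
  arith = ℕ-Ring.solve-∀

prime∤pow : ∀ {p} → Prime p → ∀ g n → ¬ (p ∣ g) → ¬ (p ∣ g ^ n)
prime∤pow pp g zero p∤g h = Pr.¬prime[1] (subst Prime (Div.∣1⇒≡1 h) pp)
prime∤pow pp g (suc n) p∤g h with Pr.euclidsLemma g (g ^ n) pp h
... | inj₁ x = p∤g x
... | inj₂ x = prime∤pow pp g n p∤g x

^-mono-∣ : ∀ {a b} n → a ∣ b → a ^ n ∣ b ^ n
^-mono-∣ zero h = Div.∣-refl
^-mono-∣ (suc n) h = Div.*-pres-∣ h (^-mono-∣ n h)

^-monoʳ-∣ : ∀ p {m n} → m ≤ n → p ^ m ∣ p ^ n
^-monoʳ-∣ p {m} {n} m≤n = subst (p ^ m ∣_)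
  (trans (sym (^-distribˡ-+-* p m (n ∸ m))) (cong (p ^_) (m+[n∸m]≡n m≤n))) (Div.m∣m*n (p ^ (n ∸ m)))

pow-* : ∀ x y n → (x * y) ^ n ≡ x ^ n * y ^ n
pow-* x y zero = refl
pow-* x y (suc n) = trans (cong ((x * y) *_) (pow-* x y n)) (arith x y (x ^ n) (y ^ n))
  where
  arith : ∀ a b c d → (a * b) * (c * d) ≡ (a * c) * (b * d)
  arith = ℕ-Ring.solve-∀

-- If A g^q = h^q B and p^q ∤ B, a common factor p of g and h cancels,
-- and p ∣ g, p ∤ h is impossible; so one may assume p ∤ g.
order-≤ : ∀ {p} → Prime p → ∀ q A B g h → h ≢ 0 → A * g ^ q ≡ h ^ q * B → ¬ (p ^ q ∣ B) →
  ∀ k → p ^ k ∣ B → p ^ k ∣ A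
order-≤ {p} pp q A B g h = go h (≤-refl) g
  where
  instance _ = Pr.prime⇒nonZero pp
  go : ∀ {n} h → h ≤ n → ∀ g → h ≢ 0 → A * g ^ q ≡ h ^ q * B → ¬ (p ^ q ∣ B) → ∀ k → p ^ k ∣ B → p ^ k ∣ A
  go h h≤n g h≢0 e ¬B k p^k∣B with p ∣? g
  ... | no p∤g = prime-power-cancel pp k (g ^ q) (prime∤pow pp g q p∤g)
        (subst (p ^ k ∣_) (trans (sym e) (*-comm A (g ^ q))) (Div.∣n⇒∣m*n (h ^ q) p^k∣B))
  ... | yes p∣g with p ∣? h
  ...   | no p∤h = ⊥-elim (¬B (prime-power-cancel pp q (h ^ q) (prime∤pow pp h q p∤h)
            (subst (p ^ q ∣_) e (Div.∣n⇒∣m*n A (^-mono-∣ q p∣g)))))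
  go zero h≤n g h≢0 e ¬B k p^k∣B | yes p∣g | yes p∣h = ⊥-elim (h≢0 refl)
  go {suc n} (suc h) h≤n g h≢0 e ¬B k p^k∣B | yes (divides g' refl) | yes (divides h' e') =
    go {n} h' (≤-pred (≤-trans h'<h h≤n)) g' h'≢0
      (*-cancelʳ-≡ _ _ (p ^ q) {{m^n≢0 p q}} (begin
        A * g' ^ q * p ^ q     ≡⟨ trans (*-assoc A (g' ^ q) (p ^ q)) (cong (A *_) (sym (pow-* g' p q))) ⟩
        A * (g' * p) ^ q       ≡⟨ e ⟩
        suc h ^ q * B          ≡⟨ cong (λ z → z ^ q * B) e' ⟩
        (h' * p) ^ q * B       ≡⟨ cong (_* B) (pow-* h' p q) ⟩
        h' ^ q * p ^ q * B     ≡⟨ arith (h' ^ q) (p ^ q) B ⟩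
        h' ^ q * B * p ^ q     ∎)) ¬B k p^k∣B
    where
    open ≡-Reasoning
    arith : ∀ x y z → x * y * z ≡ x * z * y
    arith = ℕ-Ring.solve-∀
    h'≢0 : h' ≢ 0
    h'≢0 z = 1+n≢0 (trans e' (cong (_* p) z))
    h'<h : h' < suc h
    h'<h = subst (h' <_) (sym e') (m<m*n h' p {{ℕ.≢-nonZero h'≢0}} (ℕ.nonTrivial⇒n>1 p {{Pr.prime⇒nonTrivial pp}}))

gcdList-∣ : ∀ {x} xs → x ∈ xs → gcdList xs ∣ ℤ.∣ x ∣
gcdList-∣ (y List.∷ xs) (here refl) = gcd[m,n]∣m ℤ.∣ y ∣ (gcdList xs)
gcdList-∣ (y List.∷ xs) (there x∈) = Div.∣-trans (gcd[m,n]∣n ℤ.∣ y ∣ (gcdList xs)) (gcdList-∣ xs x∈)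

%ℕ-≡0 : ∀ x m → suc m ∣ ℤ.∣ x ∣ → x ℤ.%ℕ suc m ≡ 0
%ℕ-≡0 (+ n) m h = Div.n∣m⇒m%n≡0 n (suc m) h
%ℕ-≡0 -[1+ n ] m h with suc n DM.% suc m | Div.n∣m⇒m%n≡0 (suc n) (suc m) h
... | zero | refl = refl

-- The number by which `divBy` actually divides: since `divBy x 0` is x, content 0 counts as 1.
divisor : ℕ → ℤ
divisor zero    = + 1
divisor (suc m) = + suc m

divBy-exact : ∀ g x → g ∣ ℤ.∣ x ∣ → x ≡ divisor g ℤ.* divBy x g
divBy-exact zero x h = sym (ℤₚ.*-identityˡ x)
divBy-exact (suc m) x h = begin
  x                                              ≡⟨ ℤDM.a≡a%ℕn+[a/ℕn]*n x (suc m) ⟩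
  + (x ℤ.%ℕ suc m) ℤ.+ (x ℤ./ℕ suc m) ℤ.* + suc m ≡⟨ cong (λ r → + r ℤ.+ (x ℤ./ℕ suc m) ℤ.* + suc m) (%ℕ-≡0 x m h) ⟩
  + 0 ℤ.+ (x ℤ./ℕ suc m) ℤ.* + suc m             ≡⟨ ℤₚ.+-identityˡ _ ⟩
  (x ℤ./ℕ suc m) ℤ.* + suc m                     ≡⟨ ℤₚ.*-comm (x ℤ./ℕ suc m) (+ suc m) ⟩
  + suc m ℤ.* (x ℤ./ℕ suc m)                     ∎
  where open ≡-Reasoning

toForm-beyond : ∀ {n} (v : Vec ℤ n) k → n ≤ k → toForm v k ≡ + 0
toForm-beyond [] k le = refl
toForm-beyond (x ∷ v) (suc k) (s≤s le) = toForm-beyond v k le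

Deg-Fpart : ∀ {d} (v : Coeffs d) → Deg d (Fpart v)
Deg-Fpart {d} v k lt = toForm-beyond (Vec.take (suc d) v) k lt

Deg-Gpart : ∀ {d} (v : Coeffs d) → Deg d (Gpart v)
Deg-Gpart {d} v k lt = toForm-beyond (Vec.drop (suc d) v) k lt

abs-^ : ∀ x n → ℤ.∣ x ℤ.^ n ∣ ≡ ℤ.∣ x ∣ ^ n
abs-^ x zero = refl
abs-^ x (suc n) = trans (ℤₚ.abs-* x (x ℤ.^ n)) (cong (ℤ.∣ x ∣ *_) (abs-^ x n))

contentOf : ∀ {d} → Coeffs d → ℤ → ℤ → ℤ → ℤ → ℕ
contentOf {d} v a b c e =
  gcdList (coeffList d (conjF d (Fpart {d} v) (Gpart {d} v) a b c e) List.++ coeffList d (conjG d (Fpart {d} v) (Gpart {d} v) a b c e))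

conjRes-resF : ∀ d (v : Coeffs d) a b c e →
  resF d (conjF d (Fpart {d} v) (Gpart {d} v) a b c e) (conjG d (Fpart {d} v) (Gpart {d} v) a b c e)
    ≡ divisor (contentOf {d} v a b c e) ℤ.^ (d + d) ℤ.* conjRes {d} v a b c e
conjRes-resF d v a b c e = trans
  (resF-cong d
    (λ k k≤d → divBy-exact g (F' k) (gcdList-∣ (xs List.++ ys) (∈ₚ.∈-++⁺ˡ (coefficient F' k≤d))))
    (λ k k≤d → divBy-exact g (G' k) (gcdList-∣ (xs List.++ ys) (∈ₚ.∈-++⁺ʳ xs (coefficient G' k≤d)))))
  (resF-scale d (divisor g) (λ k → divBy (F' k) g) (λ k → divBy (G' k) g))
  where
  F' = conjF d (Fpart {d} v) (Gpart {d} v) a b c e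
  G' = conjG d (Fpart {d} v) (Gpart {d} v) a b c e
  xs = coeffList d F'
  ys = coeffList d G'
  g = contentOf {d} v a b c e
  coefficient : ∀ f {k} → k ≤ d → f k ∈ coeffList d f
  coefficient f k≤d = ∈ₚ.∈-map⁺ f (∈ₚ.∈-upTo⁺ (s≤s k≤d))

Res-conj : ∀ d → d ≢ 0 → ∀ (v : Coeffs d) a b c e → a ℤ.* e ℤ.- b ℤ.* c ≢ + 0 →
  resF d (conjF d (Fpart {d} v) (Gpart {d} v) a b c e) (conjG d (Fpart {d} v) (Gpart {d} v) a b c e)
    ≡ (a ℤ.* e ℤ.- b ℤ.* c) ℤ.^ (d * suc d) ℤ.* Res {d} v
Res-conj zero d≢0 = ⊥-elim (d≢0 refl)
Res-conj (suc d') _ v a b c e δ≢0 =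
  resF-conj d' (Fpart {suc d'} v) (Gpart {suc d'} v) a b c e (Deg-Fpart {suc d'} v) (Deg-Gpart {suc d'} v) δ≢0

-- This is the shape `A g^q = h^q B` required by `order-≤`, with q = 2d and `h = |δ|^(m+1)`, where m
-- + 1 is (d + 1)/2.
conjRes-relation : ∀ d m → d ≡ suc (2 * m) → ∀ (v : Coeffs d) a b c e → a ℤ.* e ℤ.- b ℤ.* c ≢ + 0 →
  ℤ.∣ conjRes {d} v a b c e ∣ * ℤ.∣ divisor (contentOf {d} v a b c e) ∣ ^ (d + d)
    ≡ (ℤ.∣ a ℤ.* e ℤ.- b ℤ.* c ∣ ^ suc m) ^ (d + d) * ℤ.∣ Res {d} v ∣
conjRes-relation d m odd v a b c e δ≢0 = begin
  C * ℤ.∣ g ∣ ^ (d + d)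
    ≡⟨ trans (*-comm C (ℤ.∣ g ∣ ^ (d + d))) (trans (cong (_* C) (sym (abs-^ g (d + d))))
         (sym (ℤₚ.abs-* (g ℤ.^ (d + d)) (conjRes {d} v a b c e)))) ⟩
  ℤ.∣ g ℤ.^ (d + d) ℤ.* conjRes {d} v a b c e ∣
    ≡⟨ cong ℤ.∣_∣ (trans (sym (conjRes-resF d v a b c e))
         (Res-conj d (λ z → 1+n≢0 (trans (sym odd) z)) v a b c e δ≢0)) ⟩
  ℤ.∣ δ ℤ.^ (d * suc d) ℤ.* Res {d} v ∣
    ≡⟨ trans (ℤₚ.abs-* (δ ℤ.^ (d * suc d)) (Res {d} v)) (cong (_* R) (abs-^ δ (d * suc d))) ⟩
  ℤ.∣ δ ∣ ^ (d * suc d) * R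
    ≡⟨ cong (_* R) (trans (cong (ℤ.∣ δ ∣ ^_) (exponent d m odd)) (sym (^-*-assoc ℤ.∣ δ ∣ (suc m) (d + d)))) ⟩
  (ℤ.∣ δ ∣ ^ suc m) ^ (d + d) * R ∎
  where
  open ≡-Reasoning
  δ = a ℤ.* e ℤ.- b ℤ.* c
  g = divisor (contentOf {d} v a b c e)
  C = ℤ.∣ conjRes {d} v a b c e ∣
  R = ℤ.∣ Res {d} v ∣
  exponent : ∀ d m → d ≡ suc (2 * m) → d * suc d ≡ suc m * (d + d)
  exponent _ m refl = arith m
    where
    arith : ∀ m → suc (2 * m) * suc (suc (2 * m)) ≡ suc m * (suc (2 * m) + suc (2 * m))
    arith = ℕ-Ring.solve-∀

globally-minimal : ∀ d → (∃ λ k → d ≡ suc (2 * k)) → (v : Coeffs d) →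
  PowerFree (d + d) (Res {d} v) → GloballyMinimal {d} v
globally-minimal d (m , odd) v free p pp a b c e δ≢0 k₁ k₂ (p^k₁∣R , _) (_ , p^k₂∤C) =
  ≮⇒≥ (λ k₂<k₁ → p^k₂∤C (Div.∣-trans (^-monoʳ-∣ p k₂<k₁)
    (order-≤ pp (d + d) ℤ.∣ conjRes {d} v a b c e ∣ ℤ.∣ Res {d} v ∣
      ℤ.∣ divisor (contentOf {d} v a b c e) ∣ (ℤ.∣ δ ∣ ^ suc m)
      (λ z → δ≢0 (ℤₚ.i^n≡0⇒i≡0 δ (suc m) (ℤₚ.∣i∣≡0⇒i≡0 (trans (abs-^ δ (suc m)) z))))
      (conjRes-relation d m odd v a b c e δ≢0) (free p pp) k₁ p^k₁∣R)))
  where δ = a ℤ.* e ℤ.- b ℤ.* c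

-- Counting polynomial roots modulo prime powers
sumL : ∀ {A : Set} → List A → (A → ℕ) → ℕ
sumL List.[]       f = 0
sumL (x List.∷ xs) f = f x + sumL xs f

sumL-mono : ∀ {A : Set} (xs : List A) {f g : A → ℕ} → (∀ x → x ∈ xs → f x ≤ g x) → sumL xs f ≤ sumL xs g
sumL-mono List.[] h = z≤n
sumL-mono (x List.∷ xs) h = +-mono-≤ (h x (here refl)) (sumL-mono xs (λ y y∈ → h y (there y∈)))

sumL-cong : ∀ {A : Set} (xs : List A) {f g : A → ℕ} → (∀ x → f x ≡ g x) → sumL xs f ≡ sumL xs g
sumL-cong List.[] h = refl
sumL-cong (x List.∷ xs) h = cong₂ _+_ (h x) (sumL-cong xs h)

sumL-+ : ∀ {A : Set} (xs : List A) (f g : A → ℕ) → sumL xs (λ x → f x + g x) ≡ sumL xs f + sumL xs g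
sumL-+ List.[] f g = refl
sumL-+ (x List.∷ xs) f g = trans (cong (ℕ._+_ (f x + g x)) (sumL-+ xs f g)) (arith (f x) (g x) _ _)
  where
  arith : ∀ a b c d → (a + b) + (c + d) ≡ (a + c) + (b + d)
  arith = ℕ-Ring.solve-∀

sumL-* : ∀ {A : Set} (xs : List A) c (f : A → ℕ) → sumL xs (λ x → c * f x) ≡ c * sumL xs f
sumL-* List.[] c f = sym (*-zeroʳ c)
sumL-* (x List.∷ xs) c f = trans (cong (ℕ._+_ (c * f x)) (sumL-* xs c f)) (sym (*-distribˡ-+ c (f x) _))

sumL-const : ∀ {A : Set} (xs : List A) c → sumL xs (λ _ → c) ≡ List.length xs * c
sumL-const List.[] c = refl
sumL-const (x List.∷ xs) c = cong (ℕ._+_ c) (sumL-const xs c)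

sumL-swap : ∀ {A B : Set} (xs : List A) (ys : List B) (f : A → B → ℕ) →
  sumL xs (λ x → sumL ys (f x)) ≡ sumL ys (λ y → sumL xs (λ x → f x y))
sumL-swap List.[] ys f = sym (trans (sumL-const ys 0) (*-zeroʳ (List.length ys)))
sumL-swap (x List.∷ xs) ys f = trans (cong (ℕ._+_ (sumL ys (f x))) (sumL-swap xs ys f)) (sym (sumL-+ ys (f x) _))

sumL-++ : ∀ {A : Set} (xs ys : List A) (f : A → ℕ) → sumL (xs List.++ ys) f ≡ sumL xs f + sumL ys f
sumL-++ List.[] ys f = refl
sumL-++ (x List.∷ xs) ys f = trans (cong (ℕ._+_ (f x)) (sumL-++ xs ys f)) (sym (+-assoc (f x) _ _))

sumL-map : ∀ {A B : Set} (h : A → B) (xs : List A) (f : B → ℕ) → sumL (List.map h xs) f ≡ sumL xs (f ∘ h)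
sumL-map h List.[] f = refl
sumL-map h (x List.∷ xs) f = cong (ℕ._+_ (f (h x))) (sumL-map h xs f)

sumL-∈ : ∀ {A : Set} {xs : List A} (f : A → ℕ) {x} → x ∈ xs → f x ≤ sumL xs f
sumL-∈ f (here refl) = m≤m+n _ _
sumL-∈ f {x} (there {x = y} x∈) = ≤-trans (sumL-∈ f x∈) (m≤n+m _ (f y))

ind : ∀ {P : Set} → Dec P → ℕ
ind (yes _) = 1
ind (no _)  = 0

ind-mono : ∀ {P Q : Set} (p : Dec P) (q : Dec Q) → (P → Q) → ind p ≤ ind q
ind-mono (yes p) (yes q) h = ≤-refl
ind-mono (yes p) (no ¬q) h = ⊥-elim (¬q (h p))
ind-mono (no ¬p) q h = z≤n

ind-yes : ∀ {P : Set} (p : Dec P) → P → ind p ≡ 1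
ind-yes (yes _) p = refl
ind-yes (no ¬p) p = ⊥-elim (¬p p)

ind-no : ∀ {P : Set} (p : Dec P) → ¬ P → ind p ≡ 0
ind-no (yes p) ¬p = ⊥-elim (¬p p)
ind-no (no _) ¬p = refl

ind≤1 : ∀ {P : Set} (p : Dec P) → ind p ≤ 1
ind≤1 (yes _) = ≤-refl
ind≤1 (no _) = z≤n

find : ∀ {A : Set} {P : A → Set} (P? : ∀ x → Dec (P x)) (xs : List A) → (∃ λ x → P x) ⊎ (sumL xs (ind ∘ P?) ≡ 0)
find P? List.[] = inj₂ refl
find P? (x List.∷ xs) with P? x | find P? xs
... | yes px | _ = inj₁ (x , px)
... | no ¬px | inj₁ r = inj₁ r
... | no ¬px | inj₂ e = inj₂ e

ap : ℤ → ℕ → ℕ → List ℤ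
ap a Q zero    = List.[]
ap a Q (suc L) = a List.∷ ap (a ℤ.+ + Q) Q L

ap-start : ∀ a Q → a ≡ a ℤ.+ + 0 ℤ.* + Q
ap-start a Q = sym (ℤₚ.+-identityʳ a)

ap-next : ∀ a i Q → a ℤ.+ + Q ℤ.+ + i ℤ.* + Q ≡ a ℤ.+ + suc i ℤ.* + Q
ap-next a i Q = trans (arith a (+ i) (+ Q)) (cong (λ z → a ℤ.+ z ℤ.* + Q) (sym (ℤₚ.pos-+ 1 i)))
  where
  arith : ∀ a i Q → a ℤ.+ Q ℤ.+ i ℤ.* Q ≡ a ℤ.+ (+ 1 ℤ.+ i) ℤ.* Q
  arith = ℤ-Ring.solve-∀

length-ap : ∀ a Q L → List.length (ap a Q L) ≡ L
length-ap a Q zero = refl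
length-ap a Q (suc L) = cong suc (length-ap _ Q L)

-- If any two hits in the progression are a multiple of q steps apart,
-- then a count of c > 0 hits with the first one at step i needs
-- i + q (c - 1) < L.
count-hits : ∀ {P : ℤ → Set} (P? : ∀ t → Dec (P t)) Q q →
  (∀ t i → P t → P (t ℤ.+ + i ℤ.* + Q) → q ∣ i) → ∀ L a →
  (sumL (ap a Q L) (ind ∘ P?) ≡ 0) ⊎
  (∃ λ i → P (a ℤ.+ + i ℤ.* + Q) × q * sumL (ap a Q L) (ind ∘ P?) + i < L + q)
count-hits P? Q q sep zero a = inj₁ refl
count-hits {P} P? Q q sep (suc L) a with P? a | count-hits P? Q q sep L (a ℤ.+ + Q)
... | no ¬p | inj₁ e = inj₁ e
... | no ¬p | inj₂ (i , pi , lt) = inj₂ (suc i , subst P (ap-next a i Q) pi , subst (_< suc (L + q)) (sym (+-suc _ i)) (s≤s lt))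
... | yes p | inj₁ e = inj₂ (0 , subst P (ap-start a Q) p , subst (λ z → q * suc z + 0 < suc L + q) (sym e)
        (s≤s (≤-trans (≤-reflexive (trans (+-identityʳ _) (*-identityʳ q))) (m≤n+m q L))))
... | yes p | inj₂ (i , pi , lt) = inj₂ (0 , subst P (ap-start a Q) p , bound)
  where
  open ≤-Reasoning
  c = sumL (ap (a ℤ.+ + Q) Q L) (ind ∘ P?)
  q≤ : q ≤ suc i
  q≤ = Div.∣⇒≤ (sep a (suc i) p (subst P (ap-next a i Q) pi))
  bound : q * suc c + 0 < suc L + q
  bound = begin-strict
    q * suc c + 0  ≡⟨ trans (+-identityʳ _) (trans (*-suc q c) (+-comm q (q * c))) ⟩
    q * c + q      ≤⟨ +-monoʳ-≤ (q * c) q≤ ⟩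
    q * c + suc i  ≡⟨ +-suc (q * c) i ⟩
    suc (q * c + i) <⟨ s≤s lt ⟩
    suc L + q      ∎

count-hits-≤ : ∀ {P : ℤ → Set} (P? : ∀ t → Dec (P t)) Q q →
  (∀ t i → P t → P (t ℤ.+ + i ℤ.* + Q) → q ∣ i) → ∀ L a →
  sumL (ap a Q L) (ind ∘ P?) * q ≤ L + q
count-hits-≤ P? Q q sep L a with count-hits P? Q q sep L a
... | inj₁ e = ≤-trans (≤-reflexive (cong (_* q) e)) z≤n
... | inj₂ (i , _ , lt) = ≤-trans (≤-reflexive (*-comm _ q)) (≤-trans (m≤m+n _ i) (<⇒≤ lt))

-- Polynomial functions of degree at most d with coefficient c at t^d,
-- described by iterated difference quotients.
Poly : ℕ → ℤ → (ℤ → ℤ) → Set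
Poly zero    c f = ∀ t → f t ≡ c
Poly (suc d) c f = ∀ x → ∃ λ g → Poly d c g × (∀ t → f t ≡ f x ℤ.+ (t ℤ.- x) ℤ.* g t)

-- At most α of the factors p of the product can come from u.
prime-power-split : ∀ {p} → Prime p → ∀ m α u {v} → ¬ (p ^ suc α ∣ u) → p ^ (m + α) ∣ u * v → p ^ m ∣ v
prime-power-split {p} pp m zero u {v} ¬u h = prime-power-cancel pp m u (λ x → ¬u (subst (_∣ u) (sym (*-identityʳ p)) x))
  (subst (λ e → p ^ e ∣ u * v) (+-identityʳ m) h)
prime-power-split {p} pp m (suc α) u {v} ¬u h with p ∣? u
... | no p∤u = Div.∣-trans (^-monoʳ-∣ p (m≤m+n m (suc α))) (prime-power-cancel pp (m + suc α) u p∤u h)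
... | yes (divides w refl) = prime-power-split pp m α w
        (λ x → ¬u (subst (p ^ suc (suc α) ∣_) (*-comm p w) (Div.*-monoʳ-∣ p x)))
        (Div.*-cancelˡ-∣ p {{Pr.prime⇒nonZero pp}} (subst₂ _∣_ (cong (p ^_) (+-suc m α)) (arith w p v) h))
  where
  arith : ∀ w p v → w * p * v ≡ p * (w * v)
  arith = ℕ-Ring.solve-∀

∣-abs-+ : ∀ {q} x y → q ∣ ℤ.∣ x ∣ → q ∣ ℤ.∣ y ∣ → q ∣ ℤ.∣ x ℤ.+ y ∣
∣-abs-+ {q} x y h k = ℤS.∣⇒∣ᵤ {+ q} {x ℤ.+ y} (ℤS.∣m∣n⇒∣m+n {+ q} {x} {y} (ℤS.∣ᵤ⇒∣ h) (ℤS.∣ᵤ⇒∣ k))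

∣-abs-- : ∀ {q} x y → q ∣ ℤ.∣ x ∣ → q ∣ ℤ.∣ y ∣ → q ∣ ℤ.∣ x ℤ.- y ∣
∣-abs-- {q} x y h k = ∣-abs-+ x (ℤ.- y) h (subst (q ∣_) (sym (ℤₚ.∣-i∣≡∣i∣ y)) k)

residue-separated : ∀ {p} → Prime p → ∀ α Q → ¬ (p ∣ Q) → ∀ x t i →
  p ^ α ∣ ℤ.∣ t ℤ.- x ∣ → p ^ α ∣ ℤ.∣ (t ℤ.+ + i ℤ.* + Q) ℤ.- x ∣ → p ^ α ∣ i
residue-separated {p} pp α Q p∤Q x t i h k = prime-power-cancel pp α Q p∤Q
  (subst (p ^ α ∣_) (trans (cong ℤ.∣_∣ (arith t x (+ i) (+ Q))) (trans (ℤₚ.abs-* (+ Q) (+ i)) refl))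
    (∣-abs-- ((t ℤ.+ + i ℤ.* + Q) ℤ.- x) (t ℤ.- x) k h))
  where
  arith : ∀ t x i Q → (t ℤ.+ i ℤ.* Q ℤ.- x) ℤ.- (t ℤ.- x) ≡ Q ℤ.* i
  arith = ℤ-Ring.solve-∀

-- Modulo p^(α+1) there are at most d residue classes of t with
-- p^(1+dα) ∣ f t: if x is one solution, then f t - f x = (t - x) g t
-- forces p^(1+(d-1)α) ∣ g t for all t outside the class of x.
count-roots : ∀ {p} → Prime p → ∀ α Q → ¬ (p ∣ Q) → ∀ d c f → Poly d c f → ¬ (p ∣ ℤ.∣ c ∣) → ∀ a L →
  sumL (ap a Q L) (λ t → ind (p ^ (1 + d * α) ∣? ℤ.∣ f t ∣)) * p ^ suc α ≤ d * (L + p ^ suc α)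
count-roots {p} pp α Q p∤Q zero c f P p∤c a L = ≤-reflexive (cong (_* p ^ suc α) (none (ap a Q L)))
  where
  none : ∀ xs → sumL xs (λ t → ind (p ^ 1 ∣? ℤ.∣ f t ∣)) ≡ 0
  none List.[] = refl
  none (t List.∷ xs) = cong₂ _+_ (ind-no (p ^ 1 ∣? ℤ.∣ f t ∣)
    (λ h → p∤c (subst₂ _∣_ (*-identityʳ p) (cong ℤ.∣_∣ (P t)) h))) (none xs)
count-roots {p} pp α Q p∤Q (suc d) c f P p∤c a L
  with find (λ t → p ^ (1 + suc d * α) ∣? ℤ.∣ f t ∣) (ap a Q L)
... | inj₂ e = ≤-trans (≤-reflexive (cong (_* p ^ suc α) e)) z≤n
... | inj₁ (x , px) with P x
...   | g , Pg , fg = begin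
  sumL T (λ t → ind (N ∣? ℤ.∣ f t ∣)) * q
    ≤⟨ *-monoˡ-≤ q (sumL-mono T (λ t _ → split t)) ⟩
  sumL T (λ t → ind (q ∣? ℤ.∣ t ℤ.- x ∣) + ind (N' ∣? ℤ.∣ g t ∣)) * q
    ≡⟨ trans (cong (_* q) (sumL-+ T (λ t → ind (q ∣? ℤ.∣ t ℤ.- x ∣)) (λ t → ind (N' ∣? ℤ.∣ g t ∣))))
         (*-distribʳ-+ q (sumL T (λ t → ind (q ∣? ℤ.∣ t ℤ.- x ∣))) _) ⟩
  sumL T (λ t → ind (q ∣? ℤ.∣ t ℤ.- x ∣)) * q + sumL T (λ t → ind (N' ∣? ℤ.∣ g t ∣)) * q
    ≤⟨ +-mono-≤
         (count-hits-≤ (λ t → q ∣? ℤ.∣ t ℤ.- x ∣) Q q (residue-separated pp (suc α) Q p∤Q x) L a)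
         (count-roots pp α Q p∤Q d c g Pg p∤c a L) ⟩
  suc d * (L + q) ∎
  where
  open ≤-Reasoning
  q = p ^ suc α
  N = p ^ (1 + suc d * α)
  N' = p ^ (1 + d * α)
  T = ap a Q L
  difference : ∀ y z w → (y ℤ.+ z ℤ.* w) ℤ.- y ≡ z ℤ.* w
  difference = ℤ-Ring.solve-∀
  exponent : ∀ d α → 1 + suc d * α ≡ 1 + d * α + α
  exponent = ℕ-Ring.solve-∀
  split : ∀ t → ind (N ∣? ℤ.∣ f t ∣) ≤ ind (q ∣? ℤ.∣ t ℤ.- x ∣) + ind (N' ∣? ℤ.∣ g t ∣)
  split t with q ∣? ℤ.∣ t ℤ.- x ∣
  ... | yes _ = ≤-trans (ind≤1 (N ∣? ℤ.∣ f t ∣)) (s≤s z≤n)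
  ... | no ¬q = ind-mono (N ∣? ℤ.∣ f t ∣) (N' ∣? ℤ.∣ g t ∣) (λ h →
    prime-power-split pp (1 + d * α) α ℤ.∣ t ℤ.- x ∣ ¬q
      (subst₂ _∣_ (cong (p ^_) (exponent d α))
        (trans (cong ℤ.∣_∣ (trans (cong (ℤ._- f x) (fg t)) (difference (f x) (t ℤ.- x) (g t)))) (ℤₚ.abs-* (t ℤ.- x) (g t)))
        (∣-abs-- (f t) (f x) h px)))

-- The resultant as a polynomial in one coefficient

PolyE : ∀ {n} → ℕ → Ext n → (ℤ → Ext n) → Set
PolyE zero    C f = ∀ t → f t ≡ C
PolyE (suc d) C f = ∀ x → ∃ λ g → PolyE d C g × (∀ t → f t ≡ f x ⊕ (t ℤ.- x) · g t)

PolyE-top : ∀ {n} d {C : Ext n} {f} → PolyE d C f → Poly d (top C) (top ∘ f)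
PolyE-top zero P t = cong top (P t)
PolyE-top (suc d) {f = f} P x with P x
... | g , Pg , e = top ∘ g , PolyE-top d Pg , λ t → trans (cong top (e t))
        (trans (top-⊕ (f x) _) (cong (ℤ._+_ (top (f x))) (top-· (t ℤ.- x) (g t))))

PolyE-wedge : ∀ {n} d {C : Ext n} {f} v → PolyE d C f → PolyE d (wedge v C) (wedge v ∘ f)
PolyE-wedge zero v P t = cong (wedge v) (P t)
PolyE-wedge (suc d) {f = f} v P x with P x
... | g , Pg , e = wedge v ∘ g , PolyE-wedge d v Pg , λ t → trans (cong (wedge v) (e t))
        (trans (wedge-⊕ v (f x) _) (cong (wedge v (f x) ⊕_) (wedge-· v (t ℤ.- x) (g t))))

PolyE-· : ∀ {n} d {C : Ext n} {f} k → PolyE d C f → PolyE d (k · C) (λ t → k · f t)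
PolyE-· zero k P t = cong (k ·_) (P t)
PolyE-· (suc d) {f = f} k P x with P x
... | g , Pg , e = (λ t → k · g t) , PolyE-· d k Pg , λ t → trans (cong (k ·_) (e t))
        (trans (·-distribˡ-⊕ k (f x) _) (cong (k · f x ⊕_) (·-comm k (t ℤ.- x) (g t))))

PolyE-⊕ : ∀ {n} d {C C' : Ext n} {f f'} → PolyE d C f → PolyE d C' f' → PolyE d (C ⊕ C') (λ t → f t ⊕ f' t)
PolyE-⊕ zero P P' t = cong₂ _⊕_ (P t) (P' t)
PolyE-⊕ (suc d) {f = f} {f'} P P' x with P x | P' x
... | g , Pg , e | g' , Pg' , e' = (λ t → g t ⊕ g' t) , PolyE-⊕ d Pg Pg' , λ t → trans (cong₂ _⊕_ (e t) (e' t))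
        (trans (⊕-interchange (f x) _ (f' x) _) (cong ((f x ⊕ f' x) ⊕_) (sym (·-distribˡ-⊕ (t ℤ.- x) (g t) (g' t)))))

PolyE-resp : ∀ {n} d {C C' : Ext n} {f f'} → C ≡ C' → (∀ t → f t ≡ f' t) → PolyE d C f → PolyE d C' f'
PolyE-resp zero refl e P t = trans (sym (e t)) (P t)
PolyE-resp (suc d) {f = f} refl e P x with P x
... | g , Pg , h = g , Pg , λ t → trans (sym (e t)) (trans (h t) (cong (_⊕ (t ℤ.- x) · g t) (e x)))

PolyE-raise : ∀ {n} d {C : Ext n} {f} → PolyE d C f → PolyE (suc d) 0E f
PolyE-raise zero {f = f} P x = (λ _ → 0E) , (λ _ → refl) , λ t → trans (trans (P t) (sym (P x)))
  (sym (trans (cong (f x ⊕_) (·-zeroʳ (t ℤ.- x))) (⊕-identityʳ (f x))))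
PolyE-raise (suc d) P x with P x
... | g , Pg , e = g , PolyE-raise d Pg , e

-- From `t f(t) - x f(x) = (t - x)(f(t) + x g(t))`, where g is the difference quotient of f at x.
-- The summand `x g` has smaller degree and leaves the leading coefficient alone.
PolyE-X· : ∀ {n} d {C : Ext n} {f} → PolyE d C f → PolyE (suc d) C (λ t → t · f t)
PolyE-X· zero {C} {f} P x = f , P , λ t → trans (split x t (f t)) (cong (λ z → x · z ⊕ (t ℤ.- x) · f t) (trans (P t) (sym (P x))))
  where
  split : ∀ {n} x t (F : Ext n) → t · F ≡ x · F ⊕ (t ℤ.- x) · F
  split x t F = trans (cong (_· F) (arith x t)) (·-distribʳ-⊕ x (t ℤ.- x) F)
    where
    arith : ∀ x t → t ≡ x ℤ.+ (t ℤ.- x)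
    arith = ℤ-Ring.solve-∀
PolyE-X· (suc d) {C} {f} P x with P x
... | g , Pg , e = (λ t → f t ⊕ x · g t) ,
      PolyE-resp (suc d) (⊕-identityʳ _) (λ _ → refl) (PolyE-⊕ (suc d) P (PolyE-raise d (PolyE-· d x Pg))) ,
      λ t → subst (λ F → t · F ≡ x · f x ⊕ (t ℤ.- x) · (F ⊕ x · g t)) (sym (e t)) (leaf t x (f x) (g t))
  where
  leaf : ∀ {n} t x (F G : Ext n) → t · (F ⊕ (t ℤ.- x) · G) ≡ x · F ⊕ (t ℤ.- x) · ((F ⊕ (t ℤ.- x) · G) ⊕ x · G)
  leaf t x ⟨ F ⟩ ⟨ G ⟩ = cong ⟨_⟩ (arith t x F G)
    where
    arith : ∀ t x F G → t ℤ.* (F ℤ.+ (t ℤ.- x) ℤ.* G)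
      ≡ x ℤ.* F ℤ.+ (t ℤ.- x) ℤ.* ((F ℤ.+ (t ℤ.- x) ℤ.* G) ℤ.+ x ℤ.* G)
    arith = ℤ-Ring.solve-∀
  leaf t x (F ⊞ F') (G ⊞ G') = cong₂ _⊞_ (leaf t x F G) (leaf t x F' G')

-- One factor linear in t is added at a time, and only the product of all the `w i` reaches t^k.
-- Intermediate wedges have many components, so the polynomials take values in `Ext n`; the top
-- coefficient is extracted at the end.
PolyE-wedgeAll : ∀ {n} k (u w : Fin k → Vect n) ω →
  PolyE k (wedgeAll k w ω) (λ t → wedgeAll k (λ i j → u i j ℤ.+ t ℤ.* w i j) ω)
PolyE-wedgeAll zero u w ω t = refl
PolyE-wedgeAll (suc k) u w ω = PolyE-resp (suc k) (⊕-identityˡ _) join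
  (PolyE-⊕ (suc k) (PolyE-raise k (PolyE-wedge k (u fzero) rest)) (PolyE-X· k (PolyE-wedge k (w fzero) rest)))
  where
  rest = PolyE-wedgeAll k (u ∘ fsuc) (w ∘ fsuc) ω
  join : ∀ t → wedge (u fzero) (wedgeAll k (λ i j → u (fsuc i) j ℤ.+ t ℤ.* w (fsuc i) j) ω)
      ⊕ t · wedge (w fzero) (wedgeAll k (λ i j → u (fsuc i) j ℤ.+ t ℤ.* w (fsuc i) j) ω)
    ≡ wedgeAll (suc k) (λ i j → u i j ℤ.+ t ℤ.* w i j) ω
  join t = sym (trans (wedge-+ (u fzero) (λ j → t ℤ.* w fzero j) R) (cong (wedge (u fzero) R ⊕_) (wedge-* t (w fzero) R)))
    where R = wedgeAll k (λ i j → u (fsuc i) j ℤ.+ t ℤ.* w (fsuc i) j) ω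

PolyE-wedgeAll-const : ∀ {n} d {C : Ext n} {f} k (N : Fin k → Vect n) → PolyE d C f →
  PolyE d (wedgeAll k N C) (wedgeAll k N ∘ f)
PolyE-wedgeAll-const d zero N P = P
PolyE-wedgeAll-const d (suc k) N P = PolyE-wedge d (N fzero) (PolyE-wedgeAll-const d k (N ∘ fsuc) P)

Poly-resp : ∀ d {c c' f f'} → c ≡ c' → (∀ t → f t ≡ f' t) → Poly d c f → Poly d c' f'
Poly-resp zero refl e P t = trans (sym (e t)) (P t)
Poly-resp (suc d) refl e P x with P x
... | g , Pg , h = g , Pg , λ t → trans (sym (e t)) (trans (h t) (cong (ℤ._+ ((t ℤ.- x) ℤ.* g t)) (e x)))

-- Only the d rows of the second block depend on t, each of them linearly.
resF-Poly : ∀ d f u w → Poly d (resF d f w) (λ t → resF d f (λ k → u k ℤ.+ t ℤ.* w k))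
resF-Poly d f u w = Poly-resp d (sym (resF-wedge d f w))
  (λ t → trans (cong (λ η → top (wedgeAll d (sylRows d f) η)) (wedgeAll-cong d (λ i j → sym (linear t (toℕ i) (toℕ j))) unit))
           (sym (resF-wedge d f (λ k → u k ℤ.+ t ℤ.* w k))))
  (PolyE-top d (PolyE-wedgeAll-const d d (sylRows d f) (PolyE-wedgeAll d (sylRows d u) (sylRows d w) unit)))
  where
  linear : ∀ t i j → sylRow d (λ k → u k ℤ.+ t ℤ.* w k) i j ≡ sylRow d u i j ℤ.+ t ℤ.* sylRow d w i j
  linear t i j = trans (sylRow-cong d i j (λ k _ → cong (ℤ._+ (t ℤ.* w k)) (sym (ℤₚ.*-identityˡ (u k)))))
    (trans (sylRow-linear d (+ 1) t u w i j) (cong (ℤ._+ (t ℤ.* sylRow d w i j)) (ℤₚ.*-identityˡ (sylRow d u i j))))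

prodFin-++ : ∀ k m f → prodFin (k + m) f ≡ prodFin k (λ i → f (i Fin.↑ˡ m)) ℤ.* prodFin m (λ i → f (k Fin.↑ʳ i))
prodFin-++ zero m f = sym (ℤₚ.*-identityˡ _)
prodFin-++ (suc k) m f = trans (cong (f fzero ℤ.*_) (prodFin-++ k m (f ∘ fsuc))) (sym (ℤₚ.*-assoc (f fzero) _ _))

prodFin-const : ∀ n x → prodFin n (λ _ → x) ≡ x ℤ.^ n
prodFin-const zero x = refl
prodFin-const (suc n) x = cong (x ℤ.*_) (prodFin-const n x)

-- In degree d the coefficients `oneF` describe the form Y^d. Its Sylvester block is zero followed
-- by an identity matrix, and the block of f is upper triangular with diagonal entries `f d`.
resF-oneF : ∀ d f → resF d f oneF ≡ f d ℤ.^ d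
resF-oneF d f = trans (det≡detE (d + d) M) (trans (detE-upper (d + d) M vanish) (begin
  prodFin (d + d) (λ i → M i i)
    ≡⟨ prodFin-++ d d (λ i → M i i) ⟩
  prodFin d (λ i → M (i Fin.↑ˡ d) (i Fin.↑ˡ d)) ℤ.* prodFin d (λ i → M (d Fin.↑ʳ i) (d Fin.↑ʳ i))
    ≡⟨ cong₂ ℤ._*_ (trans (prodFin-cong d upper) (prodFin-const d (f d)))
         (trans (prodFin-cong d lower) (trans (prodFin-const d (+ 1)) (ℤₚ.^-zeroˡ d))) ⟩
  f d ℤ.^ d ℤ.* + 1
    ≡⟨ ℤₚ.*-identityʳ _ ⟩
  f d ℤ.^ d ∎))
  where
  open ≡-Reasoning
  M = sylvester d f oneF
  oneF-pos : ∀ k → 0 < k → oneF k ≡ + 0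
  oneF-pos (suc k) lt = refl
  vanish : ∀ i j → toℕ j < toℕ i → M i j ≡ + 0
  vanish i j lt with Fin.splitAt d i | Finₚ.join-splitAt d d i
  ... | inj₁ i' | refl = trans (sylvester-top d f oneF i' j) (sylRow-left d f (subst (toℕ j <_) (Finₚ.toℕ-↑ˡ i' d) lt))
  ... | inj₂ i' | refl with toℕ i' ℕ.≤? toℕ j
  ...   | no i'≰j = trans (sylvester-bottom d f oneF i' j) (sylRow-left d oneF (≰⇒> i'≰j))
  ...   | yes i'≤j = trans (sylvester-bottom d f oneF i' j) (trans (sylRow-inside d oneF i'≤j (<⇒≤ j-i'<d))
                       (oneF-pos _ (m<n⇒0<n∸m j-i'<d)))
    where
    j-i'<d : toℕ j ∸ toℕ i' < d
    j-i'<d = subst (toℕ j ∸ toℕ i' <_) (m+n∸n≡m d (toℕ i')) (∸-monoˡ-< (subst (toℕ j <_) (Finₚ.toℕ-↑ʳ d i') lt) i'≤j)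
  upper : ∀ i → M (i Fin.↑ˡ d) (i Fin.↑ˡ d) ≡ f d
  upper i = trans (sylvester-top d f oneF i (i Fin.↑ˡ d)) (trans (cong (sylRow d f (toℕ i)) (Finₚ.toℕ-↑ˡ i d))
    (trans (sylRow-inside d f {toℕ i} {toℕ i} ≤-refl (≤-trans (≤-reflexive (n∸n≡0 (toℕ i))) z≤n))
      (cong (λ k → f (d ∸ k)) (n∸n≡0 (toℕ i)))))
  lower : ∀ i → M (d Fin.↑ʳ i) (d Fin.↑ʳ i) ≡ + 1
  lower i = trans (sylvester-bottom d f oneF i (d Fin.↑ʳ i)) (trans (cong (sylRow d oneF (toℕ i)) (Finₚ.toℕ-↑ʳ d i))
    (trans (sylRow-inside d oneF (m≤n+m (toℕ i) d) (≤-reflexive (m+n∸n≡m d (toℕ i))))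
      (cong oneF (trans (cong (d ∸_) (m+n∸n≡m d (toℕ i))) (n∸n≡0 d)))))

resF-swap : ∀ d f g → ℤ.∣ resF d g f ∣ ≡ ℤ.∣ resF d f g ∣
resF-swap d f g = begin
  ℤ.∣ resF d g f ∣
    ≡⟨ cong ℤ.∣_∣ (resF-cong d {g} {λ k → + 0 ℤ.* f k ℤ.+ + 1 ℤ.* g k} {f} {λ k → + 1 ℤ.* f k ℤ.+ + 0 ℤ.* g k}
         (λ k _ → arith₁ (f k) (g k)) (λ k _ → arith₂ (f k) (g k))) ⟩
  ℤ.∣ resF d (λ k → + 0 ℤ.* f k ℤ.+ + 1 ℤ.* g k) (λ k → + 1 ℤ.* f k ℤ.+ + 0 ℤ.* g k) ∣
    ≡⟨ cong ℤ.∣_∣ (resF-linear d (+ 0) (+ 1) (+ 1) (+ 0) f g) ⟩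
  ℤ.∣ -[1+ 0 ] ℤ.^ d ℤ.* resF d f g ∣
    ≡⟨ trans (ℤₚ.abs-* (-[1+ 0 ] ℤ.^ d) (resF d f g)) (cong (_* ℤ.∣ resF d f g ∣) (trans (abs-^ -[1+ 0 ] d) (^-zeroˡ d))) ⟩
  1 * ℤ.∣ resF d f g ∣
    ≡⟨ *-identityˡ _ ⟩
  ℤ.∣ resF d f g ∣ ∎
  where
  open ≡-Reasoning
  arith₁ : ∀ x y → y ≡ + 0 ℤ.* x ℤ.+ + 1 ℤ.* y
  arith₁ = ℤ-Ring.solve-∀
  arith₂ : ∀ x y → x ≡ + 1 ℤ.* x ℤ.+ + 0 ℤ.* y
  arith₂ = ℤ-Ring.solve-∀

upd : ∀ {n} → Vec ℤ n → ℕ → ℤ → Vec ℤ n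
upd []      i       t = []
upd (x ∷ v) zero    t = t ∷ v
upd (x ∷ v) (suc i) t = x ∷ upd v i t

toForm-upd : ∀ {n} (v : Vec ℤ n) i t → i < n → toForm (upd v i t) i ≡ t
toForm-upd (x ∷ v) zero t lt = refl
toForm-upd (x ∷ v) (suc i) t (s≤s lt) = toForm-upd v i t lt

toForm-upd-≢ : ∀ {n} (v : Vec ℤ n) i t k → k ≢ i → toForm (upd v i t) k ≡ toForm v k
toForm-upd-≢ [] i t k k≢i = refl
toForm-upd-≢ (x ∷ v) zero t zero k≢i = ⊥-elim (k≢i refl)
toForm-upd-≢ (x ∷ v) zero t (suc k) k≢i = refl
toForm-upd-≢ (x ∷ v) (suc i) t zero k≢i = refl
toForm-upd-≢ (x ∷ v) (suc i) t (suc k) k≢i = toForm-upd-≢ v i t k (k≢i ∘ cong suc)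

toForm-++ˡ : ∀ {m n} (xs : Vec ℤ m) (ys : Vec ℤ n) k → k < m → toForm (xs Vec.++ ys) k ≡ toForm xs k
toForm-++ˡ (x ∷ xs) ys zero lt = refl
toForm-++ˡ (x ∷ xs) ys (suc k) (s≤s lt) = toForm-++ˡ xs ys k lt

toForm-++ʳ : ∀ {m n} (xs : Vec ℤ m) (ys : Vec ℤ n) k → toForm (xs Vec.++ ys) (m + k) ≡ toForm ys k
toForm-++ʳ [] ys k = refl
toForm-++ʳ (x ∷ xs) ys k = toForm-++ʳ xs ys k

Fpart-toForm : ∀ d (v : Coeffs d) k → k ≤ d → Fpart {d} v k ≡ toForm v k
Fpart-toForm d v k k≤d = trans (sym (toForm-++ˡ (Vec.take (suc d) v) (Vec.drop (suc d) v) k (s≤s k≤d)))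
  (cong (λ w → toForm w k) (Vecₚ.take++drop≡id (suc d) v))

Gpart-toForm : ∀ d (v : Coeffs d) k → Gpart {d} v k ≡ toForm v (suc d + k)
Gpart-toForm d v k = trans (sym (toForm-++ʳ (Vec.take (suc d) v) (Vec.drop (suc d) v) k))
  (cong (λ w → toForm w (suc d + k)) (Vecₚ.take++drop≡id (suc d) v))

upper : ∀ {n} → ℕ → Vec ℤ n → Form
upper m v k = toForm v (m + k)

Res-toForm : ∀ d (v : Coeffs d) → Res {d} v ≡ resF d (toForm v) (upper (suc d) v)
Res-toForm d v = resF-cong d {Fpart {d} v} {toForm v} {Gpart {d} v} {upper (suc d) v}
  (λ k k≤d → Fpart-toForm d v k k≤d) (λ k _ → Gpart-toForm d v k)

dropConstant : Form → Form
dropConstant f zero    = + 0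
dropConstant f (suc k) = f (suc k)

setConstant : ∀ (f f' : Form) t → f' 0 ≡ t → (∀ k → f' (suc k) ≡ f (suc k)) →
  ∀ k → f' k ≡ dropConstant f k ℤ.+ t ℤ.* oneF k
setConstant f f' t e₀ e zero = trans e₀ (sym (trans (ℤₚ.+-identityˡ _) (ℤₚ.*-identityʳ t)))
setConstant f f' t e₀ e (suc k) = trans (e k) (sym (trans (cong (ℤ._+_ (f (suc k))) (ℤₚ.*-zeroʳ t)) (ℤₚ.+-identityʳ _)))

-- Index `suc d` holds B₀, the coefficient of Y^d in G, so changing it adds a multiple of `oneF`.
-- Index d holds A_d.
Res-B₀ : ∀ d (v : Coeffs d) → ∃ λ f → Poly d (toForm v d ℤ.^ d) f × (∀ t → ℤ.∣ Res {d} (upd v (suc d) t) ∣ ≡ ℤ.∣ f t ∣)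
Res-B₀ d v = (λ t → resF d (toForm v) (λ k → u k ℤ.+ t ℤ.* oneF k)) ,
  Poly-resp d (resF-oneF d (toForm v)) (λ _ → refl) (resF-Poly d (toForm v) u oneF) ,
  λ t → cong ℤ.∣_∣ (trans (Res-toForm d (upd v (suc d) t))
    (resF-cong d {toForm (upd v (suc d) t)} {toForm v} {upper (suc d) (upd v (suc d) t)} {λ k → u k ℤ.+ t ℤ.* oneF k}
      (λ k k≤d → toForm-upd-≢ v (suc d) t k (<⇒≢ (s≤s k≤d)))
      (λ k _ → setConstant (upper (suc d) v) (upper (suc d) (upd v (suc d) t)) t
        (trans (cong (toForm (upd v (suc d) t)) (+-identityʳ (suc d))) (toForm-upd v (suc d) t (s≤s (m<m+n d (s≤s z≤n)))))
        (λ j → toForm-upd-≢ v (suc d) t (suc d + suc j) (>⇒≢ (m<m+n (suc d) (s≤s z≤n)))) k)))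
  where u = dropConstant (upper (suc d) v)

-- Index 0 holds A₀ and index `suc d + d` holds B_d. The forms are exchanged to make the varying one
-- the second, which is why only absolute values are compared.
Res-A₀ : ∀ d (v : Coeffs d) → ∃ λ f → Poly d (toForm v (suc d + d) ℤ.^ d) f × (∀ t → ℤ.∣ Res {d} (upd v 0 t) ∣ ≡ ℤ.∣ f t ∣)
Res-A₀ d v = (λ t → resF d (upper (suc d) v) (λ k → u k ℤ.+ t ℤ.* oneF k)) ,
  Poly-resp d (resF-oneF d (upper (suc d) v)) (λ _ → refl) (resF-Poly d (upper (suc d) v) u oneF) ,
  λ t → trans (cong ℤ.∣_∣ (trans (Res-toForm d (upd v 0 t))
    (resF-cong d {toForm (upd v 0 t)} {λ k → u k ℤ.+ t ℤ.* oneF k} {upper (suc d) (upd v 0 t)} {upper (suc d) v}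
      (λ k _ → setConstant (toForm v) (toForm (upd v 0 t)) t (toForm-upd v 0 t (s≤s z≤n))
        (λ j → toForm-upd-≢ v 0 t (suc j) (λ ())) k)
      (λ k _ → toForm-upd-≢ v 0 t (suc d + k) (λ ())))))
    (resF-swap d (upper (suc d) v) (λ k → u k ℤ.+ t ℤ.* oneF k))
  where u = dropConstant (toForm v)

-- Size and residues of the resultant

sumFin-bound : ∀ n (f : Fin n → ℤ) B → (∀ i → ℤ.∣ f i ∣ ≤ B) → ℤ.∣ sumFin f ∣ ≤ n * B
sumFin-bound zero f B h = z≤n
sumFin-bound (suc n) f B h = ≤-trans (ℤₚ.∣i+j∣≤∣i∣+∣j∣ (f fzero) _)
  (+-mono-≤ (h fzero) (sumFin-bound n (f ∘ fsuc) B (h ∘ fsuc)))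

abs-alt : ∀ n → ℤ.∣ alt n ∣ ≡ 1
abs-alt zero = refl
abs-alt (suc n) = trans (ℤₚ.∣-i∣≡∣i∣ (alt n)) (abs-alt n)

det-bound : ∀ n (M : Fin n → Fin n → ℤ) B → (∀ i j → ℤ.∣ M i j ∣ ≤ B) → ℤ.∣ det n M ∣ ≤ n ℕ.! * B ^ n
det-bound zero M B h = ≤-refl
det-bound (suc n) M B h = ≤-trans (sumFin-bound (suc n) term (B * (n ℕ.! * B ^ n)) bound)
  (≤-reflexive (arith (suc n) B (n ℕ.!) (B ^ n)))
  where
  minor : Fin (suc n) → ℤ
  minor j = det n (λ r c → M (fsuc r) (punchIn j c))
  term : Fin (suc n) → ℤ
  term j = alt (toℕ j) ℤ.* M fzero j ℤ.* minor j
  arith : ∀ m B f b → m * (B * (f * b)) ≡ (m * f) * (B * b)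
  arith = ℕ-Ring.solve-∀
  abs-term : ∀ j → ℤ.∣ term j ∣ ≡ ℤ.∣ M fzero j ∣ * ℤ.∣ minor j ∣
  abs-term j = trans (ℤₚ.abs-* (alt (toℕ j) ℤ.* M fzero j) (minor j)) (cong (_* ℤ.∣ minor j ∣)
    (trans (ℤₚ.abs-* (alt (toℕ j)) (M fzero j)) (trans (cong (_* ℤ.∣ M fzero j ∣) (abs-alt (toℕ j))) (*-identityˡ _))))
  bound : ∀ j → ℤ.∣ term j ∣ ≤ B * (n ℕ.! * B ^ n)
  bound j = ≤-trans (≤-reflexive (abs-term j)) (*-mono-≤ (h fzero j) (det-bound n _ B (λ r c → h (fsuc r) (punchIn j c))))

sylRow-all : ∀ {P : ℤ → Set} d f i j → P (+ 0) → (∀ k → P (f k)) → P (sylRow d f i j)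
sylRow-all d f i j p₀ p with (i ℕ.≤ᵇ j) ∧ ((j ∸ i) ℕ.≤ᵇ d)
... | true = p _
... | false = p₀

sylvester-all : ∀ {P : ℤ → Set} d f g → P (+ 0) → (∀ k → P (f k)) → (∀ k → P (g k)) → ∀ i j → P (sylvester d f g i j)
sylvester-all {P} d f g p₀ pf pg i j with toℕ i ℕ.<ᵇ d
... | true = sylRow-all {P} d f (toℕ i) (toℕ j) p₀ pf
... | false = sylRow-all {P} d g (toℕ i ∸ d) (toℕ j) p₀ pg

-- Crude but sufficient: taking 2d-th roots bounds every prime with `p^(2d) ∣ Res` and Res nonzero
-- by a constant times the height.
Res-bound : ∀ d (v : Coeffs d) B → (∀ k → ℤ.∣ toForm v k ∣ ≤ B) → ℤ.∣ Res {d} v ∣ ≤ (d + d) ℕ.! * B ^ (d + d)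
Res-bound d v B h = subst (λ z → ℤ.∣ z ∣ ≤ (d + d) ℕ.! * B ^ (d + d)) (sym (Res-toForm d v))
  (det-bound (d + d) _ B (sylvester-all {λ z → ℤ.∣ z ∣ ≤ B} d (toForm v) (upper (suc d) v) z≤n h (λ k → h (suc d + k))))

record _≡_mod_ (x y : ℤ) (q : ℕ) : Set where
  constructor modulo
  field
    multiple   : ℤ
    difference : x ≡ y ℤ.+ multiple ℤ.* + q

mod-refl : ∀ {q} x → x ≡ x mod q
mod-refl {q} x = modulo (+ 0) (arith x (+ q))
  where
  arith : ∀ x q → x ≡ x ℤ.+ + 0 ℤ.* q
  arith = ℤ-Ring.solve-∀

mod-sym : ∀ {q x y} → x ≡ y mod q → y ≡ x mod q
mod-sym {q} {x} {y} (modulo k e) =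
  modulo (ℤ.- k) (trans (arith y k (+ q)) (cong (λ z → z ℤ.+ (ℤ.- k) ℤ.* + q) (sym e)))
  where
  arith : ∀ y k q → y ≡ (y ℤ.+ k ℤ.* q) ℤ.+ (ℤ.- k) ℤ.* q
  arith = ℤ-Ring.solve-∀

mod-+ : ∀ {q x y x' y'} → x ≡ y mod q → x' ≡ y' mod q → (x ℤ.+ x') ≡ (y ℤ.+ y') mod q
mod-+ {q} {x} {y} {x'} {y'} (modulo k e) (modulo k' e') =
  modulo (k ℤ.+ k') (trans (cong₂ ℤ._+_ e e') (arith y k y' k' (+ q)))
  where
  arith : ∀ y k y' k' q → (y ℤ.+ k ℤ.* q) ℤ.+ (y' ℤ.+ k' ℤ.* q) ≡ (y ℤ.+ y') ℤ.+ (k ℤ.+ k') ℤ.* q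
  arith = ℤ-Ring.solve-∀

mod-* : ∀ {q x y x' y'} → x ≡ y mod q → x' ≡ y' mod q → (x ℤ.* x') ≡ (y ℤ.* y') mod q
mod-* {q} {x} {y} {x'} {y'} (modulo k e) (modulo k' e') =
  modulo (k ℤ.* y' ℤ.+ k' ℤ.* y ℤ.+ k ℤ.* k' ℤ.* + q) (trans (cong₂ ℤ._*_ e e') (arith y k y' k' (+ q)))
  where
  arith : ∀ y k y' k' q → (y ℤ.+ k ℤ.* q) ℤ.* (y' ℤ.+ k' ℤ.* q)
    ≡ (y ℤ.* y') ℤ.+ (k ℤ.* y' ℤ.+ k' ℤ.* y ℤ.+ k ℤ.* k' ℤ.* q) ℤ.* q
  arith = ℤ-Ring.solve-∀

mod-∣ : ∀ {q r x y} → r ∣ q → x ≡ y mod q → r ∣ ℤ.∣ y ∣ → r ∣ ℤ.∣ x ∣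
mod-∣ {q} {r} {x} {y} r∣q (modulo k e) h = subst (λ z → r ∣ ℤ.∣ z ∣) (sym e) (∣-abs-+ y (k ℤ.* + q) h
  (subst (r ∣_) (sym (ℤₚ.abs-* k (+ q))) (Div.∣n⇒∣m*n ℤ.∣ k ∣ r∣q)))

sumFin-mod : ∀ {q} n {f g : Fin n → ℤ} → (∀ i → f i ≡ g i mod q) → sumFin f ≡ sumFin g mod q
sumFin-mod zero h = mod-refl (+ 0)
sumFin-mod (suc n) h = mod-+ (h fzero) (sumFin-mod n (h ∘ fsuc))

det-mod : ∀ {q} n {M N : Fin n → Fin n → ℤ} → (∀ i j → M i j ≡ N i j mod q) → det n M ≡ det n N mod q
det-mod zero h = mod-refl (+ 1)
det-mod (suc n) h = sumFin-mod (suc n) (λ j → mod-* (mod-* (mod-refl (alt (toℕ j))) (h fzero j))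
  (det-mod n (λ r c → h (fsuc r) (punchIn j c))))

sylRow-mod : ∀ {q} d {f g} i j → (∀ k → f k ≡ g k mod q) → sylRow d f i j ≡ sylRow d g i j mod q
sylRow-mod d i j h with (i ℕ.≤ᵇ j) ∧ ((j ∸ i) ℕ.≤ᵇ d)
... | true = h _
... | false = mod-refl (+ 0)

sylvester-mod : ∀ {q} d {f g f' g'} → (∀ k → f k ≡ f' k mod q) → (∀ k → g k ≡ g' k mod q) →
  ∀ i j → sylvester d f g i j ≡ sylvester d f' g' i j mod q
sylvester-mod d h h' i j with toℕ i ℕ.<ᵇ d
... | true = sylRow-mod d (toℕ i) (toℕ j) h
... | false = sylRow-mod d (toℕ i ∸ d) (toℕ j) h'

Res-mod : ∀ {q} d (v w : Coeffs d) → (∀ k → toForm v k ≡ toForm w k mod q) → Res {d} v ≡ Res {d} w mod q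
Res-mod {q} d v w h = subst₂ (λ x y → x ≡ y mod q) (sym (Res-toForm d v)) (sym (Res-toForm d w))
  (det-mod (d + d) (sylvester-mod d h (λ k → h (suc d + k))))

-- Counting in boxes fibre by fibre
box : ∀ {n} → Vec (List ℤ) n → List (Vec ℤ n)
box []       = [] List.∷ List.[]
box (I ∷ Is) = List.cartesianProductWith _∷_ I (box Is)

side : ∀ {n} → Vec (List ℤ) n → ℕ → List ℤ
side []       i       = List.[]
side (I ∷ Is) zero    = I
side (I ∷ Is) (suc i) = side Is i

sumL-box : ∀ {n} I (Is : Vec (List ℤ) n) f → sumL (box (I ∷ Is)) f ≡ sumL I (λ a → sumL (box Is) (λ w → f (a ∷ w)))
sumL-box I Is f = product I (box Is)
  where
  product : ∀ xs ys → sumL (List.cartesianProductWith _∷_ xs ys) f ≡ sumL xs (λ a → sumL ys (λ w → f (a ∷ w)))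
  product List.[] ys = refl
  product (x List.∷ xs) ys = trans (sumL-++ (List.map (x ∷_) ys) _ f)
    (cong₂ _+_ (sumL-map (x ∷_) ys f) (product xs ys))

-- Resampling coordinate i: each point of the box arises as `upd v i t` from as many pairs (t, v) as
-- side i has entries. Fibres along a middle coordinate can thus be used without taking the vector
-- apart.
sumL-upd : ∀ {n} (Is : Vec (List ℤ) n) i → i < n → ∀ f →
  sumL (side Is i) (λ t → sumL (box Is) (λ v → f (upd v i t))) ≡ List.length (side Is i) * sumL (box Is) f
sumL-upd (I ∷ Is) zero lt f = begin
  sumL I (λ t → sumL (box (I ∷ Is)) (λ v → f (upd v 0 t)))
    ≡⟨ sumL-cong I (λ t → trans (sumL-box I Is (λ v → f (upd v 0 t))) (sumL-const I (sumL (box Is) (λ w → f (t ∷ w))))) ⟩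
  sumL I (λ t → List.length I * sumL (box Is) (λ w → f (t ∷ w)))
    ≡⟨ sumL-* I (List.length I) (λ t → sumL (box Is) (λ w → f (t ∷ w))) ⟩
  List.length I * sumL I (λ t → sumL (box Is) (λ w → f (t ∷ w)))
    ≡⟨ cong (List.length I *_) (sym (sumL-box I Is f)) ⟩
  List.length I * sumL (box (I ∷ Is)) f ∎
  where open ≡-Reasoning
sumL-upd (I ∷ Is) (suc i) (s≤s lt) f = begin
  sumL (side Is i) (λ t → sumL (box (I ∷ Is)) (λ v → f (upd v (suc i) t)))
    ≡⟨ sumL-cong (side Is i) (λ t → sumL-box I Is (λ v → f (upd v (suc i) t))) ⟩
  sumL (side Is i) (λ t → sumL I (λ a → sumL (box Is) (λ w → f (a ∷ upd w i t))))
    ≡⟨ sumL-swap (side Is i) I (λ t a → sumL (box Is) (λ w → f (a ∷ upd w i t))) ⟩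
  sumL I (λ a → sumL (side Is i) (λ t → sumL (box Is) (λ w → f (a ∷ upd w i t))))
    ≡⟨ sumL-cong I (λ a → sumL-upd Is i lt (λ w → f (a ∷ w))) ⟩
  sumL I (λ a → List.length (side Is i) * sumL (box Is) (λ w → f (a ∷ w)))
    ≡⟨ sumL-* I (List.length (side Is i)) (λ a → sumL (box Is) (λ w → f (a ∷ w))) ⟩
  List.length (side Is i) * sumL I (λ a → sumL (box Is) (λ w → f (a ∷ w)))
    ≡⟨ cong (List.length (side Is i) *_) (sym (sumL-box I Is f)) ⟩
  List.length (side Is i) * sumL (box (I ∷ Is)) f ∎
  where open ≡-Reasoning

-- The factor `g v` lets estimates be chained: if it is the indicator of a condition on another
-- coordinate, the savings in the two directions multiply.
bound-fibres : ∀ {n} (Is : Vec (List ℤ) n) i → i < n → ∀ f g q B →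
  (∀ v → sumL (side Is i) (λ t → f (upd v i t)) * q ≤ B * g v) →
  List.length (side Is i) * sumL (box Is) f * q ≤ B * sumL (box Is) g
bound-fibres Is i lt f g q B h = begin
  List.length (side Is i) * sumL (box Is) f * q
    ≡⟨ cong (_* q) (trans (sym (sumL-upd Is i lt f)) (sumL-swap (side Is i) (box Is) (λ t v → f (upd v i t)))) ⟩
  sumL (box Is) (λ v → sumL (side Is i) (λ t → f (upd v i t))) * q
    ≡⟨ trans (*-comm _ q) (sym (sumL-* (box Is) q _)) ⟩
  sumL (box Is) (λ v → q * sumL (side Is i) (λ t → f (upd v i t)))
    ≤⟨ sumL-mono (box Is) (λ v _ → ≤-trans (≤-reflexive (*-comm q _)) (h v)) ⟩
  sumL (box Is) (λ v → B * g v)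
    ≡⟨ sumL-* (box Is) B g ⟩
  B * sumL (box Is) g ∎
  where open ≤-Reasoning

volume : ∀ {n} → Vec (List ℤ) n → ℕ
volume Is = sumL (box Is) (λ _ → 1)

IsAp : List ℤ → ℕ → ℕ → Set
IsAp I Q L = ∃ λ a → I ≡ ap a Q L

-- The first side has its own length because A₀ is restricted to positive values, which makes it
-- about half as long as the others in the box of height x.
record Sides {n} (Is : Vec (List ℤ) n) (Q L₀ L : ℕ) : Set where
  constructor sides
  field
    first : IsAp (side Is 0) Q L₀
    other : ∀ i → 0 < i → i < n → IsAp (side Is i) Q L

-- The exceptional events at one large prime

-- If p^(2d) ∣ Res, then E₁, E₂ or E₃ holds.  Each has density O(1/p²):
-- E₁ and E₂ impose two independent conditions modulo p, since Res is a
-- polynomial in B₀ with leading coefficient A_d^d, and E₃ confines A₀ to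
-- d classes modulo p², since ± Res is a polynomial in A₀ with leading
-- coefficient B_d^d.
E₁? : ∀ d p (v : Coeffs d) → Dec ((p ∣ ℤ.∣ toForm v (suc d + d) ∣) × (p ∣ ℤ.∣ toForm v d ∣))
E₁? d p v = (p ∣? ℤ.∣ toForm v (suc d + d) ∣) ×-dec (p ∣? ℤ.∣ toForm v d ∣)

E₂? : ∀ d p (v : Coeffs d) →
  Dec ((p ∣ ℤ.∣ toForm v (suc d + d) ∣) × (¬ (p ∣ ℤ.∣ toForm v d ∣) × (p ∣ ℤ.∣ Res {d} v ∣)))
E₂? d p v = (p ∣? ℤ.∣ toForm v (suc d + d) ∣) ×-dec (¬? (p ∣? ℤ.∣ toForm v d ∣) ×-dec (p ∣? ℤ.∣ Res {d} v ∣))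

E₃? : ∀ d p (v : Coeffs d) →
  Dec (¬ (p ∣ ℤ.∣ toForm v (suc d + d) ∣) × (p ^ (1 + d * 1) ∣ ℤ.∣ Res {d} v ∣))
E₃? d p v = ¬? (p ∣? ℤ.∣ toForm v (suc d + d) ∣) ×-dec (p ^ (1 + d * 1) ∣? ℤ.∣ Res {d} v ∣)

sumL-none : ∀ {A : Set} {P : A → Set} (P? : ∀ x → Dec (P x)) (xs : List A) → (∀ x → ¬ P x) → sumL xs (ind ∘ P?) ≡ 0
sumL-none P? List.[] h = refl
sumL-none P? (x List.∷ xs) h = cong₂ _+_ (ind-no (P? x) (h x)) (sumL-none P? xs h)

count-multiples : ∀ {p} → Prime p → ∀ Q → ¬ (p ∣ Q) → ∀ a L →
  sumL (ap a Q L) (λ t → ind (p ∣? ℤ.∣ t ∣)) * p ≤ L + p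
count-multiples {p} pp Q p∤Q a L = count-hits-≤ (λ t → p ∣? ℤ.∣ t ∣) Q p separated L a
  where
  arith : ∀ t i Q → (t ℤ.+ i ℤ.* Q) ℤ.- t ≡ Q ℤ.* i
  arith = ℤ-Ring.solve-∀
  separated : ∀ t i → p ∣ ℤ.∣ t ∣ → p ∣ ℤ.∣ t ℤ.+ + i ℤ.* + Q ∣ → p ∣ i
  separated t i h k with Pr.euclidsLemma Q i pp (subst (p ∣_)
    (trans (cong ℤ.∣_∣ (arith t (+ i) (+ Q))) (ℤₚ.abs-* (+ Q) (+ i))) (∣-abs-- (t ℤ.+ + i ℤ.* + Q) t k h))
  ... | inj₁ x = ⊥-elim (p∤Q x)
  ... | inj₂ x = x

size : ℕ → ℕ
size d = suc d + suc d

d<size : ∀ d → d < size d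
d<size d = s≤s (m≤m+n d (suc d))

1+d<size : ∀ d → suc d < size d
1+d<size d = s≤s (m<m+n d (s≤s z≤n))

1+d+d<size : ∀ d → suc d + d < size d
1+d+d<size d = s≤s (≤-reflexive (sym (+-suc d d)))

module _ (d : ℕ) (0<d : 0 < d) (Is : Vec (List ℤ) (size d)) (Q L₀ L : ℕ) (sds : Sides Is Q L₀ L) where

  private
    V = volume Is
    B = λ (v : Coeffs d) → toForm v (suc d + d)
    A = λ (v : Coeffs d) → toForm v d

  side-count : ∀ i → 0 < i → i < size d → ∀ (h : ℤ → ℕ) →
    ∃ λ a → sumL (side Is i) h ≡ sumL (ap a Q L) h
  side-count i 0<i lt h with Sides.other sds i 0<i lt
  ... | a , e = a , cong (λ I → sumL I h) e

  length-side : ∀ i → 0 < i → i < size d → List.length (side Is i) ≡ L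
  length-side i 0<i lt with Sides.other sds i 0<i lt
  ... | a , e = trans (cong List.length e) (length-ap a Q L)

  length-first : List.length (side Is 0) ≡ L₀
  length-first with Sides.first sds
  ... | a , e = trans (cong List.length e) (length-ap a Q L₀)

  count-B≡0 : 0 < Q → L * sumL (box Is) (λ v → ind (B v ℤ.≟ + 0)) * L ≤ (L + L) * V
  count-B≡0 0<Q = subst (λ l → l * sumL (box Is) (λ v → ind (B v ℤ.≟ + 0)) * L ≤ (L + L) * V)
    (length-side (suc d + d) (s≤s z≤n) (1+d+d<size d))
    (bound-fibres Is (suc d + d) (1+d+d<size d) (λ v → ind (B v ℤ.≟ + 0)) (λ _ → 1) L (L + L) fibre)
    where
    arith : ∀ i Q → + 0 ℤ.+ i ℤ.* Q ≡ i ℤ.* Q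
    arith = ℤ-Ring.solve-∀
    -- Two zeros of the progression are 0 steps apart, and `L` divides 0. With `L` as separation,
    -- `count-hits-≤` allows at most two hits when L is positive.
    separated : ∀ t i → t ≡ + 0 → t ℤ.+ + i ℤ.* + Q ≡ + 0 → L ∣ i
    separated t i refl e with ℤₚ.i*j≡0⇒i≡0∨j≡0 (+ i) (trans (sym (arith (+ i) (+ Q))) e)
    ... | inj₁ z = subst (L ∣_) (sym (ℤₚ.+-injective z)) (L Div.∣0)
    ... | inj₂ z = ⊥-elim (<⇒≢ 0<Q (sym (ℤₚ.+-injective z)))
    fibre : ∀ v → sumL (side Is (suc d + d)) (λ t → ind (B (upd v (suc d + d) t) ℤ.≟ + 0)) * L ≤ (L + L) * 1
    fibre v with side-count (suc d + d) (s≤s z≤n) (1+d+d<size d) (λ t → ind (B (upd v (suc d + d) t) ℤ.≟ + 0))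
    ... | a , e = ≤-trans (≤-reflexive (cong (_* L) (trans e
            (sumL-cong (ap a Q L) (λ t → cong (λ z → ind (z ℤ.≟ + 0)) (toForm-upd v (suc d + d) t (1+d+d<size d)))))))
            (≤-trans (count-hits-≤ (λ t → t ℤ.≟ + 0) Q L separated L a) (≤-reflexive (sym (*-identityʳ (L + L)))))

  module _ {p : ℕ} (pp : Prime p) (p∤Q : ¬ (p ∣ Q)) where

    count-p∣B : L * sumL (box Is) (λ v → ind (p ∣? ℤ.∣ B v ∣)) * p ≤ (L + p) * V
    count-p∣B = subst (λ l → l * sumL (box Is) (λ v → ind (p ∣? ℤ.∣ B v ∣)) * p ≤ (L + p) * V)
      (length-side (suc d + d) (s≤s z≤n) (1+d+d<size d))
      (bound-fibres Is (suc d + d) (1+d+d<size d) (λ v → ind (p ∣? ℤ.∣ B v ∣)) (λ _ → 1) p (L + p) fibre)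
      where
      fibre : ∀ v → sumL (side Is (suc d + d)) (λ t → ind (p ∣? ℤ.∣ B (upd v (suc d + d) t) ∣)) * p ≤ (L + p) * 1
      fibre v with side-count (suc d + d) (s≤s z≤n) (1+d+d<size d) (λ t → ind (p ∣? ℤ.∣ B (upd v (suc d + d) t) ∣))
      ... | a , e = ≤-trans (≤-reflexive (cong (_* p) (trans e
              (sumL-cong (ap a Q L) (λ t → cong (λ z → ind (p ∣? ℤ.∣ z ∣)) (toForm-upd v (suc d + d) t (1+d+d<size d)))))))
              (≤-trans (count-multiples pp Q p∤Q a L) (≤-reflexive (sym (*-identityʳ (L + p)))))

    count-E₁-fibres : L * sumL (box Is) (ind ∘ E₁? d p) * p ≤ (L + p) * sumL (box Is) (λ v → ind (p ∣? ℤ.∣ B v ∣))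
    count-E₁-fibres = subst (λ l → l * sumL (box Is) (ind ∘ E₁? d p) * p ≤ (L + p) * sumL (box Is) (λ v → ind (p ∣? ℤ.∣ B v ∣)))
      (length-side d 0<d (d<size d))
      (bound-fibres Is d (d<size d) (ind ∘ E₁? d p) (λ v → ind (p ∣? ℤ.∣ B v ∣)) p (L + p) fibre)
      where
      fibre : ∀ v → sumL (side Is d) (λ t → ind (E₁? d p (upd v d t))) * p ≤ (L + p) * ind (p ∣? ℤ.∣ B v ∣)
      fibre v with side-count d 0<d (d<size d) (λ t → ind (E₁? d p (upd v d t))) | p ∣? ℤ.∣ B v ∣
      ... | a , e | no p∤B = ≤-trans (≤-reflexive (cong (_* p) (trans e
              (sumL-none (λ t → E₁? d p (upd v d t)) (ap a Q L)
                (λ t h → p∤B (subst (λ z → p ∣ ℤ.∣ z ∣) (toForm-upd-≢ v d t (suc d + d) (>⇒≢ (s≤s (m≤m+n d d)))) (proj₁ h))))))) z≤n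
      ... | a , e | yes _ = ≤-trans (*-monoˡ-≤ p (≤-trans (≤-reflexive e)
              (sumL-mono (ap a Q L) (λ t _ → ind-mono (E₁? d p (upd v d t)) (p ∣? ℤ.∣ t ∣)
                (λ h → subst (λ z → p ∣ ℤ.∣ z ∣) (toForm-upd v d t (d<size d)) (proj₂ h))))))
              (≤-trans (count-multiples pp Q p∤Q a L) (≤-reflexive (sym (*-identityʳ (L + p)))))

    count-E₂-fibres : L * sumL (box Is) (ind ∘ E₂? d p) * p ≤ d * (L + p) * sumL (box Is) (λ v → ind (p ∣? ℤ.∣ B v ∣))
    count-E₂-fibres = subst (λ l → l * sumL (box Is) (ind ∘ E₂? d p) * p ≤ d * (L + p) * sumL (box Is) (λ v → ind (p ∣? ℤ.∣ B v ∣)))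
      (length-side (suc d) (s≤s z≤n) (1+d<size d))
      (bound-fibres Is (suc d) (1+d<size d) (ind ∘ E₂? d p) (λ v → ind (p ∣? ℤ.∣ B v ∣)) p (d * (L + p)) fibre)
      where
      exponent : p ^ (1 + d * 0) ≡ p
      exponent = trans (cong (λ k → p ^ (1 + k)) (*-zeroʳ d)) (*-identityʳ p)
      fibre : ∀ v → sumL (side Is (suc d)) (λ t → ind (E₂? d p (upd v (suc d) t))) * p ≤ d * (L + p) * ind (p ∣? ℤ.∣ B v ∣)
      fibre v with side-count (suc d) (s≤s z≤n) (1+d<size d) (λ t → ind (E₂? d p (upd v (suc d) t))) | p ∣? ℤ.∣ B v ∣ | p ∣? ℤ.∣ A v ∣
      ... | a , e | no p∤B | _ = ≤-trans (≤-reflexive (cong (_* p) (trans e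
              (sumL-none (λ t → E₂? d p (upd v (suc d) t)) (ap a Q L)
                (λ t h → p∤B (subst (λ z → p ∣ ℤ.∣ z ∣) (toForm-upd-≢ v (suc d) t (suc d + d) (>⇒≢ (m<m+n (suc d) 0<d))) (proj₁ h))))))) z≤n
      ... | a , e | yes _ | yes p∣A = ≤-trans (≤-reflexive (cong (_* p) (trans e
              (sumL-none (λ t → E₂? d p (upd v (suc d) t)) (ap a Q L)
                (λ t h → proj₁ (proj₂ h) (subst (λ z → p ∣ ℤ.∣ z ∣) (sym (toForm-upd-≢ v (suc d) t d (<⇒≢ ≤-refl))) p∣A)))))) z≤n
      ... | a , e | yes _ | no p∤A = ≤-trans (*-monoˡ-≤ p (≤-trans (≤-reflexive e)
              (sumL-mono (ap a Q L) (λ t _ → ind-mono (E₂? d p (upd v (suc d) t)) (p ^ (1 + d * 0) ∣? ℤ.∣ proj₁ (Res-B₀ d v) t ∣)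
                (λ h → subst₂ _∣_ (sym exponent) (proj₂ (proj₂ (Res-B₀ d v)) t) (proj₂ (proj₂ h)))))))
              (≤-trans (≤-trans (≤-reflexive (cong (sumL (ap a Q L) (λ t → ind (p ^ (1 + d * 0) ∣? ℤ.∣ proj₁ (Res-B₀ d v) t ∣)) *_) (sym (*-identityʳ p))))
                (count-roots pp 0 Q p∤Q d (A v ℤ.^ d) (proj₁ (Res-B₀ d v)) (proj₁ (proj₂ (Res-B₀ d v)))
                  (λ h → prime∤pow pp ℤ.∣ A v ∣ d p∤A (subst (p ∣_) (abs-^ (A v) d) h)) a L))
                (≤-reflexive (trans (cong (λ q → d * (L + q)) (*-identityʳ p)) (sym (*-identityʳ (d * (L + p)))))))

    -- This is `count-roots` with α = 1, so the exponent is d + 1 and the classes are modulo p².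
    -- Unlike E₁ and E₂, a single coordinate supplies the whole saving.
    count-E₃ : L₀ * sumL (box Is) (ind ∘ E₃? d p) * (p ^ 2) ≤ d * (L₀ + p ^ 2) * V
    count-E₃ = subst (λ l → l * sumL (box Is) (ind ∘ E₃? d p) * (p ^ 2) ≤ d * (L₀ + p ^ 2) * V)
      length-first
      (bound-fibres Is 0 (s≤s z≤n) (ind ∘ E₃? d p) (λ _ → 1) (p ^ 2) (d * (L₀ + p ^ 2)) fibre)
      where
      fibre : ∀ v → sumL (side Is 0) (λ t → ind (E₃? d p (upd v 0 t))) * (p ^ 2) ≤ d * (L₀ + p ^ 2) * 1
      fibre v with Sides.first sds | p ∣? ℤ.∣ B v ∣
      ... | a , e | yes p∣B = ≤-trans (≤-reflexive (cong (_* (p ^ 2))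
              (sumL-none (λ t → E₃? d p (upd v 0 t)) (side Is 0)
                (λ t h → proj₁ h (subst (λ z → p ∣ ℤ.∣ z ∣) (sym (toForm-upd-≢ v 0 t (suc d + d) (λ ()))) p∣B))))) z≤n
      ... | a , e | no p∤B = ≤-trans (*-monoˡ-≤ (p ^ 2) (≤-trans
              (≤-reflexive (cong (λ I → sumL I (λ t → ind (E₃? d p (upd v 0 t)))) e))
              (sumL-mono (ap a Q L₀) (λ t _ → ind-mono (E₃? d p (upd v 0 t)) (p ^ (1 + d * 1) ∣? ℤ.∣ proj₁ (Res-A₀ d v) t ∣)
                (λ h → subst (p ^ (1 + d * 1) ∣_) (proj₂ (proj₂ (Res-A₀ d v)) t) (proj₂ h))))))
              (≤-trans (count-roots pp 1 Q p∤Q d (B v ℤ.^ d) (proj₁ (Res-A₀ d v)) (proj₁ (proj₂ (Res-A₀ d v)))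
                  (λ h → prime∤pow pp ℤ.∣ B v ∣ d p∤B (subst (p ∣_) (abs-^ (B v) d) h)) a L₀)
                (≤-reflexive (sym (*-identityʳ _))))

-- Primes are sparse
range : ℕ → ℕ → List ℕ
range M zero    = List.[]
range M (suc Z) = suc M List.∷ range (suc M) Z

∈-range : ∀ {p} M Z → M < p → p ≤ M + Z → p ∈ range M Z
∈-range M zero M<p p≤ = ⊥-elim (<⇒≱ M<p (≤-trans p≤ (≤-reflexive (+-identityʳ M))))
∈-range {p} M (suc Z) M<p p≤ with p ℕ.≟ suc M
... | yes refl = here refl
... | no p≢ = there (∈-range (suc M) Z (≤∧≢⇒< M<p (p≢ ∘ sym)) (≤-trans p≤ (≤-reflexive (+-suc M Z))))

range-++ : ∀ M Z k → range M (Z + k) ≡ range M Z List.++ range (M + Z) k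
range-++ M zero k = cong (λ m → range m k) (sym (+-identityʳ M))
range-++ M (suc Z) k = cong (suc M List.∷_) (trans (range-++ (suc M) Z k)
  (cong (λ m → range (suc M) Z List.++ range m k) (sym (+-suc M Z))))

length-range : ∀ M Z → List.length (range M Z) ≡ Z
length-range M zero = refl
length-range M (suc Z) = cong suc (length-range (suc M) Z)

isPrime : ℕ → ℕ
isPrime p = ind (Pr.prime? p)

primesIn : ℕ → ℕ → ℕ
primesIn M Z = sumL (range M Z) isPrime

primesIn-+ : ∀ M Z k → primesIn M (Z + k) ≡ primesIn M Z + primesIn (M + Z) k
primesIn-+ M Z k = trans (cong (λ l → sumL l isPrime) (range-++ M Z k)) (sumL-++ (range M Z) _ isPrime)

primesIn-≤ : ∀ M Z → primesIn M Z ≤ Z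
primesIn-≤ M Z = ≤-trans (sumL-mono (range M Z) (λ p _ → ind≤1 (Pr.prime? p)))
  (≤-reflexive (trans (sumL-const (range M Z) 1) (trans (*-identityʳ _) (length-range M Z))))

primePart : ∀ p → Dec (Prime p) → ℕ
primePart p (yes _) = p
primePart p (no _)  = 1

primeProduct : ℕ → ℕ → ℕ
primeProduct M zero    = 1
primeProduct M (suc Z) = primePart (suc M) (Pr.prime? (suc M)) * primeProduct (suc M) Z

rising : ℕ → ℕ → ℕ
rising M zero    = 1
rising M (suc Z) = suc M * rising (suc M) Z

primeProduct-∣-rising : ∀ M Z → primeProduct M Z ∣ rising M Z
primeProduct-∣-rising M zero = Div.∣-refl
primeProduct-∣-rising M (suc Z) with Pr.prime? (suc M)
... | yes _ = Div.*-monoʳ-∣ (suc M) (primeProduct-∣-rising (suc M) Z)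
... | no _ = Div.*-pres-∣ {1} {suc M} (Div.1∣ suc M) (primeProduct-∣-rising (suc M) Z)

primeProduct-cancel : ∀ M Z u {v} → (∀ {p} → Prime p → M < p → ¬ (p ∣ u)) → primeProduct M Z ∣ u * v → primeProduct M Z ∣ v
primeProduct-cancel M zero u h d = Div.1∣ _
primeProduct-cancel M (suc Z) u {v} h d with Pr.prime? (suc M)
... | no _ = subst (_∣ v) (sym (*-identityˡ _)) (primeProduct-cancel (suc M) Z u (λ pp lt → h pp (<-trans (n<1+n M) lt))
        (subst (_∣ u * v) (*-identityˡ _) d))
... | yes pp with Pr.euclidsLemma u v pp (Div.∣-trans (Div.m∣m*n (primeProduct (suc M) Z)) d)
...   | inj₁ x = ⊥-elim (h pp (n<1+n M) x)
...   | inj₂ (divides w refl) = subst (suc M * primeProduct (suc M) Z ∣_) (*-comm (suc M) w) (Div.*-monoʳ-∣ (suc M)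
          (primeProduct-cancel (suc M) Z u (λ qq lt → h qq (<-trans (n<1+n M) lt))
            (Div.*-cancelˡ-∣ (suc M) (subst (suc M * primeProduct (suc M) Z ∣_) (arith u w (suc M)) d))))
  where
  arith : ∀ u w p → u * (w * p) ≡ p * (u * w)
  arith = ℕ-Ring.solve-∀

prime∤! : ∀ n {p} → Prime p → n < p → ¬ (p ∣ n ℕ.!)
prime∤! zero pp lt h = Pr.¬prime[1] (subst Prime (Div.∣1⇒≡1 h) pp)
prime∤! (suc n) pp lt h with Pr.euclidsLemma (suc n) (n ℕ.!) pp h
... | inj₁ x = <⇒≱ lt (Div.∣⇒≤ x)
... | inj₂ x = prime∤! n pp (<-trans (n<1+n n) lt) x

!-rising : ∀ M Z → M ℕ.! * rising M Z ≡ (M + Z) ℕ.!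
!-rising M zero = trans (*-identityʳ _) (cong ℕ._! (sym (+-identityʳ M)))
!-rising M (suc Z) = trans (arith (M ℕ.!) (suc M) (rising (suc M) Z))
  (trans (!-rising (suc M) Z) (cong ℕ._! (sym (+-suc M Z))))
  where
  arith : ∀ a b c → a * (b * c) ≡ b * a * c
  arith = ℕ-Ring.solve-∀

rising-last : ∀ M Z → rising M (suc Z) ≡ rising M Z * (M + suc Z)
rising-last M zero = arith M
  where
  arith : ∀ M → suc M * 1 ≡ 1 * (M + 1)
  arith = ℕ-Ring.solve-∀
rising-last M (suc Z) = trans (cong (suc M *_) (rising-last (suc M) Z))
  (trans (sym (*-assoc (suc M) (rising (suc M) Z) (suc M + suc Z))) (cong (λ k → suc M * rising (suc M) Z * k) (sym (+-suc M (suc Z)))))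

-- `rising n n` divided by n! is the central binomial coefficient, and consecutive ones have ratio
-- at most 4. The factor `suc n` is multiplied in because `suc n * rising (suc n) (suc n)` is
-- `rising n (suc (suc n))` by definition.
rising-≤ : ∀ n → rising n n ≤ 4 ^ n * n ℕ.!
rising-≤ zero = ≤-refl
rising-≤ (suc n) = *-cancelˡ-≤ (suc n) (begin
  suc n * rising (suc n) (suc n)               ≡⟨ rising-last n (suc n) ⟩
  rising n (suc n) * (n + suc (suc n))         ≡⟨ cong (_* (n + suc (suc n))) (rising-last n n) ⟩
  rising n n * (n + suc n) * (n + suc (suc n)) ≤⟨ *-monoˡ-≤ (n + suc (suc n)) (*-mono-≤ (rising-≤ n) (m≤n+m (n + suc n) 1)) ⟩
  4 ^ n * n ℕ.! * (1 + (n + suc n)) * (n + suc (suc n)) ≡⟨ arith n (4 ^ n) (n ℕ.!) ⟩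
  suc n * (4 ^ suc n * (suc n) ℕ.!)            ∎)
  where
  open ≤-Reasoning
  arith : ∀ n a b → a * b * (1 + (n + suc n)) * (n + suc (suc n)) ≡ suc n * (4 * a * (suc n * b))
  arith = ℕ-Ring.solve-∀

-- The product of the primes in (n, 2n] divides the binomial coefficient
-- (2n choose n), which is at most 4^n.
primeProduct-≤ : ∀ n → primeProduct n n ≤ 4 ^ n
primeProduct-≤ n with Div.*-cancelˡ-∣ (n ℕ.!) {{ℕ.>-nonZero (1≤n! n)}} (subst₂ _∣_
    (cong (λ k → n ℕ.! * k ℕ.!) (m+n∸n≡m n n)) (sym (!-rising n n))
    (Comb.k![n∸k]!∣n! {n + n} {n} (m≤m+n n n)))
... | divides C e = ≤-trans (Div.∣⇒≤ {{ℕ.≢-nonZero C≢0}}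
        (primeProduct-cancel n n (n ℕ.!) (prime∤! n) (subst (primeProduct n n ∣_) (trans e (*-comm C (n ℕ.!))) (primeProduct-∣-rising n n))))
        (*-cancelʳ-≤ C (4 ^ n) (n ℕ.!) {{ℕ.>-nonZero (1≤n! n)}} (subst (_≤ 4 ^ n * n ℕ.!) e (rising-≤ n)))
  where
  rising≢0 : ∀ M Z → rising M Z ≢ 0
  rising≢0 M zero ()
  rising≢0 M (suc Z) z with m*n≡0⇒m≡0∨n≡0 (suc M) z
  ... | inj₂ y = rising≢0 (suc M) Z y
  C≢0 : C ≢ 0
  C≢0 z = rising≢0 n n (trans e (cong (_* n ℕ.!) z))

pow-primesIn : ∀ b M Z → b ≤ M → b ^ primesIn M Z ≤ primeProduct M Z
pow-primesIn b M zero b≤M = ≤-refl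
pow-primesIn b M (suc Z) b≤M with Pr.prime? (suc M)
... | yes _ = *-mono-≤ (m≤n⇒m≤1+n b≤M) (pow-primesIn b (suc M) Z (m≤n⇒m≤1+n b≤M))
... | no _ = ≤-trans (pow-primesIn b (suc M) Z (m≤n⇒m≤1+n b≤M)) (≤-reflexive (sym (*-identityˡ _)))

-- Every prime in (n, 2n] exceeds `2^m`, so `2^m` raised to their number is at most their product,
-- hence at most `4^n`. Comparing exponents of 2 gives the bound.
primesIn-doubling : ∀ m n → 2 ^ m ≤ n → m * primesIn n n ≤ 2 * n
primesIn-doubling m n h = ≮⇒≥ (λ lt → <⇒≱ (^-monoʳ-< 2 (s≤s (s≤s z≤n)) lt) (begin
  2 ^ (m * primesIn n n)   ≡⟨ sym (^-*-assoc 2 m (primesIn n n)) ⟩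
  (2 ^ m) ^ primesIn n n   ≤⟨ pow-primesIn (2 ^ m) n n h ⟩
  primeProduct n n         ≤⟨ primeProduct-≤ n ⟩
  4 ^ n                    ≡⟨ ^-*-assoc 2 2 n ⟩
  2 ^ (2 * n)              ∎))
  where open ≤-Reasoning

half : ∀ Z → ∃ λ h → Z ≤ h + h × h + h ≤ suc Z
half zero = 0 , z≤n , z≤n
half (suc zero) = 1 , s≤s z≤n , ≤-refl
half (suc (suc Z)) with half Z
... | h , p , q = suc h , subst (suc (suc Z) ≤_) (cong suc (sym (+-suc h h))) (s≤s (s≤s p)) ,
                  subst (_≤ suc (suc (suc Z))) (cong suc (sym (+-suc h h))) (s≤s (s≤s q))

-- Chebyshev's bound without logarithms: π(Z) is at most 4Z/(m + 1) up to a constant, for each fixed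
-- m. Z is rounded up to an even number 2h, the primes in (h, 2h] are counted by doubling and those
-- up to h by induction; for h below `2^(m+1)` the constant covers everything.
primesIn-0-≤ : ∀ m Z → suc m * primesIn 0 Z ≤ 4 * Z + suc m * (2 ^ suc m + 2 ^ suc m)
primesIn-0-≤ m Z = go Z ≤-refl
  where
  open ≤-Reasoning
  C = suc m * (2 ^ suc m + 2 ^ suc m)
  arith₁ : ∀ h C → (4 * h + C) + 2 * h ≡ 3 * (h + h) + C
  arith₁ = ℕ-Ring.solve-∀
  arith₂ : ∀ Z → 3 * suc Z ≡ 3 * Z + 3
  arith₂ = ℕ-Ring.solve-∀
  arith₃ : ∀ Z → 3 * Z + Z ≡ 4 * Z
  arith₃ = ℕ-Ring.solve-∀
  go : ∀ {n} Z → Z ≤ n → suc m * primesIn 0 Z ≤ 4 * Z + C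
  go {zero} zero _ = ≤-trans (≤-reflexive (*-zeroʳ (suc m))) z≤n
  go {suc n} Z Z≤n with half Z
  ... | h , Z≤2h , 2h≤Z+1 with 2 ^ suc m ℕ.≤? h
  ...   | no h< = ≤-trans (*-monoʳ-≤ (suc m) (≤-trans (primesIn-≤ 0 Z) (≤-trans Z≤2h
            (+-mono-≤ (<⇒≤ (≰⇒> h<)) (<⇒≤ (≰⇒> h<)))))) (m≤n+m C (4 * Z))
  ...   | yes h≥ = begin
    suc m * primesIn 0 Z
      ≤⟨ *-monoʳ-≤ (suc m) (≤-trans (m≤m+n (primesIn 0 Z) (primesIn Z (h + h ∸ Z)))
           (≤-reflexive (trans (sym (primesIn-+ 0 Z (h + h ∸ Z))) (cong (primesIn 0) (m+[n∸m]≡n Z≤2h))))) ⟩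
    suc m * primesIn 0 (h + h)
      ≡⟨ trans (cong (suc m *_) (primesIn-+ 0 h h)) (*-distribˡ-+ (suc m) (primesIn 0 h) (primesIn h h)) ⟩
    suc m * primesIn 0 h + suc m * primesIn h h
      ≤⟨ +-mono-≤ (go h (≤-pred (≤-trans h<Z Z≤n))) (primesIn-doubling (suc m) h h≥) ⟩
    -- The coefficient 4 leaves room for the rounding of Z: 4h + 2h = 3(2h) is at most 3(Z + 1), and
    -- this is at most 4Z once Z is at least 3.
    (4 * h + C) + 2 * h
      ≡⟨ arith₁ h C ⟩
    3 * (h + h) + C
      ≤⟨ +-monoˡ-≤ C (*-monoʳ-≤ 3 2h≤Z+1) ⟩
    3 * suc Z + C
      ≡⟨ cong (_+ C) (arith₂ Z) ⟩
    3 * Z + 3 + C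
      ≤⟨ +-monoˡ-≤ C (≤-trans (+-monoʳ-≤ (3 * Z) 3≤Z) (≤-reflexive (arith₃ Z))) ⟩
    4 * Z + C ∎
    where
    2≤h : 2 ≤ h
    2≤h = ≤-trans (*-monoʳ-≤ 2 (m^n>0 2 m)) h≥
    3≤Z : 3 ≤ Z
    3≤Z = ≤-pred (≤-trans (+-mono-≤ 2≤h 2≤h) 2h≤Z+1)
    h<Z : h < Z
    h<Z = ≤-pred (≤-trans (+-monoˡ-≤ h 2≤h) 2h≤Z+1)

primes-sparse : ∀ c M R → ∃ λ N → ∀ Y Z → N ≤ Y → Z ≤ R * Y → c * primesIn M Z ≤ Y
primes-sparse c M R = 4 * M + C , bound
  where
  open ≤-Reasoning
  -- Chosen so that 4RY + Y, the bound that `primesIn-0-≤` leaves, is at most 8(R + 1)Y.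
  m = 8 * c * suc R
  C = suc m * (2 ^ suc m + 2 ^ suc m)
  arith₁ : ∀ c R x → (8 * suc R) * (c * x) ≡ 8 * c * suc R * x
  arith₁ = ℕ-Ring.solve-∀
  arith₂ : ∀ M Z C → 4 * (M + Z) + C ≡ 4 * Z + (4 * M + C)
  arith₂ = ℕ-Ring.solve-∀
  arith₃ : ∀ R Y → 4 * (R * Y) + Y + (4 * R * Y + 7 * Y) ≡ (8 * suc R) * Y
  arith₃ = ℕ-Ring.solve-∀
  bound : ∀ Y Z → 4 * M + C ≤ Y → Z ≤ R * Y → c * primesIn M Z ≤ Y
  bound Y Z N≤Y Z≤RY = *-cancelˡ-≤ (8 * suc R) (begin
    (8 * suc R) * (c * primesIn M Z)
      ≡⟨ arith₁ c R (primesIn M Z) ⟩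
    m * primesIn M Z
      ≤⟨ *-mono-≤ (n≤1+n m) (≤-trans (m≤n+m (primesIn M Z) (primesIn 0 M)) (≤-reflexive (sym (primesIn-+ 0 M Z)))) ⟩
    suc m * primesIn 0 (M + Z)
      ≤⟨ primesIn-0-≤ m (M + Z) ⟩
    4 * (M + Z) + C
      ≡⟨ arith₂ M Z C ⟩
    4 * Z + (4 * M + C)
      ≤⟨ +-mono-≤ (*-monoʳ-≤ 4 Z≤RY) N≤Y ⟩
    4 * (R * Y) + Y
      ≤⟨ m≤m+n _ (4 * R * Y + 7 * Y) ⟩
    4 * (R * Y) + Y + (4 * R * Y + 7 * Y)
      ≡⟨ arith₃ R Y ⟩
    (8 * suc R) * Y ∎)

-- The bound 1/M for the sum of 1/p² over p > M, in integers: with N = M + 1, M(1/N² + 1/N) = 1 -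
-- 1/N². The function `Y` carries the rounding error of each term.
sum-inverse-squares : ∀ Z M (α Y : ℕ → ℕ) X → (∀ p → M < p → p * p * α p ≤ X + p * p * Y p) →
  M * sumL (range M Z) α ≤ X + M * sumL (range M Z) Y
sum-inverse-squares zero M α Y X h = ≤-trans (≤-reflexive (*-zeroʳ M)) z≤n
sum-inverse-squares (suc Z) M α Y X h = *-cancelˡ-≤ (N * N) (begin
  N * N * (M * (a + s))
    ≡⟨ arith₁ M N a s ⟩
  M * (N * N * a) + M * N * (N * s)
    ≤⟨ +-mono-≤ (*-monoʳ-≤ M (h N ≤-refl)) (*-monoʳ-≤ (M * N) (sum-inverse-squares Z N α Y X (λ p lt → h p (<-trans ≤-refl lt)))) ⟩
  M * (X + N * N * y) + M * N * (X + N * t)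
    ≤⟨ m≤m+n _ X ⟩
  M * (X + N * N * y) + M * N * (X + N * t) + X
    ≡⟨ arith₂ M X y t ⟩
  N * N * (X + M * (y + t)) ∎)
  where
  open ≤-Reasoning
  N = suc M
  a = α N
  y = Y N
  s = sumL (range N Z) α
  t = sumL (range N Z) Y
  arith₁ : ∀ M N a s → N * N * (M * (a + s)) ≡ M * (N * N * a) + M * N * (N * s)
  arith₁ = ℕ-Ring.solve-∀
  arith₂ : ∀ M X y t → M * (X + suc M * suc M * y) + M * suc M * (X + suc M * t) + X ≡ suc M * suc M * (X + M * (y + t))
  arith₂ = ℕ-Ring.solve-∀

-- The contribution of the large primes
tailWeight : ∀ d → ℕ → ℕ → Coeffs d → ℕ
tailWeight d M Z v = ind (toForm v (suc d + d) ℤ.≟ + 0)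
  + sumL (range M Z) (λ p → isPrime p * (ind (E₁? d p v) + ind (E₂? d p v) + ind (E₃? d p v)))

square-+ : ∀ L p → (L + p) * (L + p) ≤ 2 * (L * L) + 2 * (p * p)
square-+ L p with ≤-total L p
... | inj₁ L≤p with m≤n⇒∃[o]m+o≡n L≤p
...   | k , refl = ≤-trans (m≤m+n _ (k * k)) (≤-reflexive (arith L k))
  where
  arith : ∀ L k → (L + (L + k)) * (L + (L + k)) + k * k ≡ 2 * (L * L) + 2 * ((L + k) * (L + k))
  arith = ℕ-Ring.solve-∀
square-+ L p | inj₂ p≤L with m≤n⇒∃[o]m+o≡n p≤L
...   | k , refl = ≤-trans (m≤m+n _ (k * k)) (≤-reflexive (arith p k))
  where
  arith : ∀ p k → ((p + k) + p) * ((p + k) + p) + k * k ≡ 2 * ((p + k) * (p + k)) + 2 * (p * p)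
  arith = ℕ-Ring.solve-∀

-- The hypothesis says that S/V is at most c/M + cw/D, and each of the two terms is at most 1/(8K).
-- Here D measures the fibres and w the number of rounding errors.
absorb : ∀ K M D c w S V → 0 < M → 0 < D → 8 * K * c ≤ M → 8 * K * c * w ≤ D →
  M * (D * S) ≤ c * V * D + M * (c * w * V) → 4 * K * S ≤ V
absorb K M D c w S V 0<M 0<D h₁ h₂ h =
  *-cancelˡ-≤ (2 * (M * D)) {{ℕ.>-nonZero (*-mono-< {0} {2} (s≤s z≤n) (*-mono-< 0<M 0<D))}} (begin
    2 * (M * D) * (4 * K * S)                      ≡⟨ arith₁ K M D S ⟩
    8 * K * (M * (D * S))                          ≤⟨ *-monoʳ-≤ (8 * K) h ⟩
    8 * K * (c * V * D + M * (c * w * V))          ≡⟨ arith₂ K M D c w V ⟩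
    8 * K * c * (V * D) + 8 * K * c * w * (M * V)  ≤⟨ +-mono-≤ (*-monoˡ-≤ (V * D) h₁) (*-monoˡ-≤ (M * V) h₂) ⟩
    M * (V * D) + D * (M * V)                      ≡⟨ arith₃ M D V ⟩
    2 * (M * D) * V                                ∎)
  where
  open ≤-Reasoning
  arith₁ : ∀ K M D S → 2 * (M * D) * (4 * K * S) ≡ 8 * K * (M * (D * S))
  arith₁ = ℕ-Ring.solve-∀
  arith₂ : ∀ K M D c w V → 8 * K * (c * V * D + M * (c * w * V)) ≡ 8 * K * c * (V * D) + 8 * K * c * w * (M * V)
  arith₂ = ℕ-Ring.solve-∀
  arith₃ : ∀ M D V → M * (V * D) + D * (M * V) ≡ 2 * (M * D) * V
  arith₃ = ℕ-Ring.solve-∀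

fibre-square : ∀ d L p s₁ s₂ b V → L * s₁ * p ≤ (L + p) * b → L * s₂ * p ≤ d * (L + p) * b → L * b * p ≤ (L + p) * V →
  p * p * (L * L * (s₁ + s₂)) ≤ 2 * suc d * V * (L * L) + p * p * (2 * suc d * V)
fibre-square d L p s₁ s₂ b V h₁ h₂ h = begin
  p * p * (L * L * (s₁ + s₂))                      ≡⟨ arith₁ L p s₁ s₂ ⟩
  L * p * (L * s₁ * p + L * s₂ * p)                ≤⟨ *-monoʳ-≤ (L * p) (+-mono-≤ h₁ h₂) ⟩
  L * p * ((L + p) * b + d * (L + p) * b)          ≡⟨ arith₂ d L p b ⟩
  suc d * (L + p) * (L * b * p)                    ≤⟨ *-monoʳ-≤ (suc d * (L + p)) h ⟩
  suc d * (L + p) * ((L + p) * V)                  ≡⟨ arith₃ d (L + p) V ⟩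
  suc d * V * ((L + p) * (L + p))                  ≤⟨ *-monoʳ-≤ (suc d * V) (square-+ L p) ⟩
  suc d * V * (2 * (L * L) + 2 * (p * p))          ≡⟨ arith₄ d L p V ⟩
  2 * suc d * V * (L * L) + p * p * (2 * suc d * V) ∎
  where
  open ≤-Reasoning
  arith₁ : ∀ L p s₁ s₂ → p * p * (L * L * (s₁ + s₂)) ≡ L * p * (L * s₁ * p + L * s₂ * p)
  arith₁ = ℕ-Ring.solve-∀
  arith₂ : ∀ d L p b → L * p * ((L + p) * b + d * (L + p) * b) ≡ suc d * (L + p) * (L * b * p)
  arith₂ = ℕ-Ring.solve-∀
  arith₃ : ∀ d x V → suc d * x * (x * V) ≡ suc d * V * (x * x)
  arith₃ = ℕ-Ring.solve-∀
  arith₄ : ∀ d L p V → suc d * V * (2 * (L * L) + 2 * (p * p)) ≡ 2 * suc d * V * (L * L) + p * p * (2 * suc d * V)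
  arith₄ = ℕ-Ring.solve-∀

module _ (d : ℕ) (0<d : 0 < d) (Is : Vec (List ℤ) (size d)) (Q L₀ L : ℕ) (sds : Sides Is Q L₀ L)
  (M Z : ℕ) (p∤Q : ∀ {p} → Prime p → M < p → ¬ (p ∣ Q)) where

  private
    V  = volume Is
    s₁ = λ p → sumL (box Is) (ind ∘ E₁? d p)
    s₂ = λ p → sumL (box Is) (ind ∘ E₂? d p)
    s₃ = λ p → sumL (box Is) (ind ∘ E₃? d p)
    α  = λ p → isPrime p * (s₁ p + s₂ p)
    β  = λ p → isPrime p * s₃ p
    b₀ = sumL (box Is) (λ v → ind (toForm v (suc d + d) ℤ.≟ + 0))
    C  = 2 * suc d

  sum-tailWeight : sumL (box Is) (tailWeight d M Z) ≡ b₀ + (sumL (range M Z) α + sumL (range M Z) β)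
  sum-tailWeight = begin
    sumL (box Is) (tailWeight d M Z)
      ≡⟨ sumL-+ (box Is) (λ v → ind (toForm v (suc d + d) ℤ.≟ + 0)) (λ v → sumL (range M Z) (λ p → term p v)) ⟩
    b₀ + sumL (box Is) (λ v → sumL (range M Z) (λ p → term p v))
      ≡⟨ cong (ℕ._+_ b₀) (sumL-swap (box Is) (range M Z) (λ v p → term p v)) ⟩
    b₀ + sumL (range M Z) (λ p → sumL (box Is) (term p))
      ≡⟨ cong (ℕ._+_ b₀) (trans (sumL-cong (range M Z) split) (sumL-+ (range M Z) α β)) ⟩
    b₀ + (sumL (range M Z) α + sumL (range M Z) β) ∎
    where
    open ≡-Reasoning
    term : ℕ → Coeffs d → ℕ
    term p v = isPrime p * (ind (E₁? d p v) + ind (E₂? d p v) + ind (E₃? d p v))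
    split : ∀ p → sumL (box Is) (term p) ≡ α p + β p
    split p = trans (sumL-* (box Is) (isPrime p) (λ v → ind (E₁? d p v) + ind (E₂? d p v) + ind (E₃? d p v)))
      (trans (cong (isPrime p *_) (trans (sumL-+ (box Is) (λ v → ind (E₁? d p v) + ind (E₂? d p v)) (ind ∘ E₃? d p))
        (cong (_+ s₃ p) (sumL-+ (box Is) (ind ∘ E₁? d p) (ind ∘ E₂? d p)))))
        (*-distribˡ-+ (isPrime p) (s₁ p + s₂ p) (s₃ p)))

  -- Two coordinates have been varied, so the rounding errors are weighed against L². A factor Z,
  -- counting all integers in the range, is then harmless for Z of order L.
  sum-α : M * (L * L * sumL (range M Z) α) ≤ C * V * (L * L) + M * (C * Z * V)
  sum-α = begin
    M * (L * L * sumL (range M Z) α)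
      ≡⟨ cong (M *_) (sym (sumL-* (range M Z) (L * L) α)) ⟩
    M * sumL (range M Z) (λ p → L * L * α p)
      ≤⟨ sum-inverse-squares Z M (λ p → L * L * α p) (λ _ → C * V) (C * V * (L * L)) term ⟩
    C * V * (L * L) + M * sumL (range M Z) (λ _ → C * V)
      ≡⟨ cong (λ x → C * V * (L * L) + M * x) (trans (sumL-const (range M Z) (C * V))
           (trans (cong (_* (C * V)) (length-range M Z)) (arith Z C V))) ⟩
    C * V * (L * L) + M * (C * Z * V) ∎
    where
    open ≤-Reasoning
    arith : ∀ Z C V → Z * (C * V) ≡ C * Z * V
    arith = ℕ-Ring.solve-∀
    term : ∀ p → M < p → p * p * (L * L * α p) ≤ C * V * (L * L) + p * p * (C * V)
    term p lt with Pr.prime? p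
    ... | no _ = ≤-trans (≤-reflexive (trans (cong (p * p *_) (*-zeroʳ (L * L))) (*-zeroʳ (p * p)))) z≤n
    ... | yes pp = subst (λ x → p * p * (L * L * x) ≤ C * V * (L * L) + p * p * (C * V)) (sym (*-identityˡ (s₁ p + s₂ p)))
      (fibre-square d L p (s₁ p) (s₂ p) (sumL (box Is) (λ v → ind (p ∣? ℤ.∣ toForm v (suc d + d) ∣))) V
        (count-E₁-fibres d 0<d Is Q L₀ L sds pp (p∤Q pp lt))
        (count-E₂-fibres d 0<d Is Q L₀ L sds pp (p∤Q pp lt))
        (count-p∣B d 0<d Is Q L₀ L sds pp (p∤Q pp lt)))

  -- Only A₀ has been varied, so the rounding errors are weighed against L₀, which may be of the
  -- same order as Z. Keeping the factor `isPrime p` replaces Z by `primesIn M Z`, to which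
  -- `primes-sparse` applies.
  sum-β : M * (L₀ * sumL (range M Z) β) ≤ d * V * L₀ + M * (d * primesIn M Z * V)
  sum-β = begin
    M * (L₀ * sumL (range M Z) β)
      ≡⟨ cong (M *_) (sym (sumL-* (range M Z) L₀ β)) ⟩
    M * sumL (range M Z) (λ p → L₀ * β p)
      ≤⟨ sum-inverse-squares Z M (λ p → L₀ * β p) (λ p → d * V * isPrime p) (d * V * L₀) term ⟩
    d * V * L₀ + M * sumL (range M Z) (λ p → d * V * isPrime p)
      ≡⟨ cong (λ x → d * V * L₀ + M * x) (trans (sumL-* (range M Z) (d * V) isPrime) (arith d V (primesIn M Z))) ⟩
    d * V * L₀ + M * (d * primesIn M Z * V) ∎
    where
    open ≤-Reasoning
    arith : ∀ d V x → d * V * x ≡ d * x * V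
    arith = ℕ-Ring.solve-∀
    arith₁ : ∀ p L₀ s → p * p * (L₀ * (1 * s)) ≡ L₀ * s * (p * (p * 1))
    arith₁ = ℕ-Ring.solve-∀
    arith₂ : ∀ p d L₀ V → d * (L₀ + p * (p * 1)) * V ≡ d * V * L₀ + p * p * (d * V * 1)
    arith₂ = ℕ-Ring.solve-∀
    term : ∀ p → M < p → p * p * (L₀ * β p) ≤ d * V * L₀ + p * p * (d * V * isPrime p)
    term p lt with Pr.prime? p
    ... | no _ = ≤-trans (≤-reflexive (trans (cong (p * p *_) (*-zeroʳ L₀)) (*-zeroʳ (p * p)))) z≤n
    ... | yes pp = ≤-trans (≤-reflexive (arith₁ p L₀ (s₃ p)))
      (≤-trans (count-E₃ d 0<d Is Q L₀ L sds pp (p∤Q pp lt)) (≤-reflexive (arith₂ p d L₀ V)))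

  tail-bound : ∀ K → 0 < Q → 0 < M → 0 < L₀ → 0 < L → 8 * K ≤ L → 8 * K * C ≤ M →
    8 * K * C * Z ≤ L * L → 8 * K * d * primesIn M Z ≤ L₀ → K * sumL (box Is) (tailWeight d M Z) ≤ V
  tail-bound K 0<Q 0<M 0<L₀ 0<L h₀ h₁ h₂ h₃ = *-cancelˡ-≤ 4 (begin
    4 * (K * sumL (box Is) (tailWeight d M Z))
      ≡⟨ trans (cong (λ x → 4 * (K * x)) sum-tailWeight) (arith K b₀ (sumL (range M Z) α) (sumL (range M Z) β)) ⟩
    4 * K * b₀ + (4 * K * sumL (range M Z) α + 4 * K * sumL (range M Z) β)
      ≤⟨ +-mono-≤ b₀-small (+-mono-≤
           (absorb K M (L * L) C Z _ V 0<M (*-mono-< 0<L 0<L) h₁ h₂ sum-α)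
           (absorb K M L₀ d (primesIn M Z) _ V 0<M 0<L₀ (≤-trans (*-monoʳ-≤ (8 * K) d≤C) h₁) h₃ sum-β)) ⟩
    V + (V + V)
      ≤⟨ m≤m+n _ V ⟩
    V + (V + V) + V
      ≡⟨ arith′ V ⟩
    4 * V ∎)
    where
    open ≤-Reasoning
    arith : ∀ K x y z → 4 * (K * (x + (y + z))) ≡ 4 * K * x + (4 * K * y + 4 * K * z)
    arith = ℕ-Ring.solve-∀
    arith′ : ∀ V → V + (V + V) + V ≡ 4 * V
    arith′ = ℕ-Ring.solve-∀
    arith₀ : ∀ K b L → 2 * L * (4 * K * b) ≡ 8 * K * (b * L)
    arith₀ = ℕ-Ring.solve-∀
    arith₁ : ∀ b L → L * (b * L) ≡ L * b * L
    arith₁ = ℕ-Ring.solve-∀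
    arith₂ : ∀ L V → (L + L) * V ≡ 2 * L * V
    arith₂ = ℕ-Ring.solve-∀
    d≤C : d ≤ C
    d≤C = ≤-trans (n≤1+n d) (m≤m+n (suc d) _)
    b₀-small : 4 * K * b₀ ≤ V
    b₀-small = *-cancelˡ-≤ (2 * L) {{ℕ.>-nonZero (*-mono-< {0} {2} (s≤s z≤n) 0<L)}} (begin
      2 * L * (4 * K * b₀)  ≡⟨ arith₀ K b₀ L ⟩
      8 * K * (b₀ * L)      ≤⟨ *-monoˡ-≤ (b₀ * L) h₀ ⟩
      L * (b₀ * L)          ≡⟨ arith₁ b₀ L ⟩
      L * b₀ * L            ≤⟨ count-B≡0 d 0<d Is Q L₀ L sds 0<Q ⟩
      (L + L) * V           ≡⟨ arith₂ L V ⟩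
      2 * L * V             ∎)

TailSmall : ∀ d → ℕ → ℕ → ℕ → ℕ → Set
TailSmall d K M R N = ∀ (Is : Vec (List ℤ) (size d)) Q L₀ L → Sides Is Q L₀ L → 0 < Q →
  (∀ {p} → Prime p → M < p → ¬ (p ∣ Q)) → ∀ Y Z → N ≤ Y → Y ≤ L₀ → Y ≤ L → Z ≤ R * Y →
  K * sumL (box Is) (tailWeight d M Z) ≤ volume Is

-- The order of the choices matters. The bound `M₀` depends on d and K alone, while R is chosen
-- after M because it will involve a prime above M and, for positivity, the modulus (M!)^(2d). The
-- threshold N does not depend on the step Q.
tail-small : ∀ d → 0 < d → ∀ K → ∃ λ M₀ → ∀ M → M₀ ≤ M → ∀ R → ∃ λ N → TailSmall d K M R N
tail-small d 0<d K = suc (8 * K * C) , λ M M₀≤M R → N M R , bound M M₀≤M R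
  where
  C = 2 * suc d
  Nπ : ℕ → ℕ → ℕ
  Nπ M R = proj₁ (primes-sparse (8 * K * d) M R)
  N : ℕ → ℕ → ℕ
  N M R = suc (8 * K + (8 * K * C * R + Nπ M R))
  arith : ∀ a R Y → a * (R * Y) ≡ a * R * Y
  arith = ℕ-Ring.solve-∀
  bound : ∀ M → suc (8 * K * C) ≤ M → ∀ R → TailSmall d K M R (N M R)
  bound M M₀≤M R Is Q L₀ L sds 0<Q p∤Q Y Z N≤Y Y≤L₀ Y≤L Z≤RY =
    tail-bound d 0<d Is Q L₀ L sds M Z p∤Q K 0<Q (≤-trans (s≤s z≤n) M₀≤M)
      (≤-trans (s≤s z≤n) (≤-trans N≤Y Y≤L₀)) (≤-trans (s≤s z≤n) (≤-trans N≤Y Y≤L))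
      (≤-trans (m≤m+n (8 * K) _) (≤-trans N'≤Y Y≤L))
      (≤-trans (n≤1+n _) M₀≤M)
      (≤-trans (*-monoʳ-≤ (8 * K * C) Z≤RY) (≤-trans (≤-reflexive (arith (8 * K * C) R Y))
        (*-mono-≤ (≤-trans (m≤m+n (8 * K * C * R) (Nπ M R)) (≤-trans (m≤n+m _ (8 * K)) (≤-trans N'≤Y Y≤L))) Y≤L)))
      (≤-trans (proj₂ (primes-sparse (8 * K * d) M R) Y Z
        (≤-trans (m≤n+m (Nπ M R) (8 * K * C * R)) (≤-trans (m≤n+m _ (8 * K)) N'≤Y)) Z≤RY) Y≤L₀)
    where
    N'≤Y : 8 * K + (8 * K * C * R + Nπ M R) ≤ Y
    N'≤Y = ≤-trans (n≤1+n _) N≤Y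

-- Boxes and progressions as duplicate-free lists

build : ∀ {A : Set} n → (ℕ → A) → Vec A n
build zero    g = []
build (suc n) g = g 0 ∷ build n (g ∘ suc)

side-build : ∀ n g i → i < n → side (build n g) i ≡ g i
side-build (suc n) g zero lt = refl
side-build (suc n) g (suc i) (s≤s lt) = side-build n (g ∘ suc) i lt

toForm-build : ∀ n g i → i < n → toForm (build n g) i ≡ g i
toForm-build (suc n) g zero lt = refl
toForm-build (suc n) g (suc i) (s≤s lt) = toForm-build n (g ∘ suc) i lt

∈-box⁺ : ∀ n g (v : Vec ℤ n) → (∀ k → k < n → toForm v k ∈ g k) → v ∈ box (build n g)
∈-box⁺ zero g [] h = here refl
∈-box⁺ (suc n) g (x ∷ v) h = ∈ₚ.∈-cartesianProductWith⁺ _∷_ (h 0 (s≤s z≤n)) (∈-box⁺ n (g ∘ suc) v (λ k lt → h (suc k) (s≤s lt)))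

∈-box⁻ : ∀ n g (v : Vec ℤ n) → v ∈ box (build n g) → ∀ k → k < n → toForm v k ∈ g k
∈-box⁻ (suc n) g v v∈ k lt with ∈ₚ.∈-cartesianProductWith⁻ _∷_ (g 0) (box (build n (g ∘ suc))) v∈
∈-box⁻ (suc n) g v v∈ zero lt | x , w , x∈ , w∈ , refl = x∈
∈-box⁻ (suc n) g v v∈ (suc k) (s≤s lt) | x , w , x∈ , w∈ , refl = ∈-box⁻ n (g ∘ suc) w w∈ k lt

box-unique : ∀ n (g : ℕ → List ℤ) → (∀ k → k < n → Unique (g k)) → Unique (box (build n g))
box-unique zero g h = All.[] AllPairs.∷ AllPairs.[]
box-unique (suc n) g h = Uniqueₚ.cartesianProductWith⁺ _∷_ Vecₚ.∷-injective (h 0 (s≤s z≤n))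
  (box-unique n (g ∘ suc) (λ k lt → h (suc k) (s≤s lt)))

∈-ap⁺ : ∀ a Q L i → i < L → a ℤ.+ + i ℤ.* + Q ∈ ap a Q L
∈-ap⁺ a Q (suc L) zero lt = here (sym (ap-start a Q))
∈-ap⁺ a Q (suc L) (suc i) (s≤s lt) = there (subst (_∈ ap (a ℤ.+ + Q) Q L) (ap-next a i Q) (∈-ap⁺ (a ℤ.+ + Q) Q L i lt))

∈-ap⁻ : ∀ a Q L {t} → t ∈ ap a Q L → ∃ λ i → i < L × t ≡ a ℤ.+ + i ℤ.* + Q
∈-ap⁻ a Q (suc L) (here refl) = 0 , s≤s z≤n , ap-start a Q
∈-ap⁻ a Q (suc L) (there t∈) with ∈-ap⁻ (a ℤ.+ + Q) Q L t∈
... | i , lt , e = suc i , s≤s lt , trans e (ap-next a i Q)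

ap-unique : ∀ a Q L → 0 < Q → Unique (ap a Q L)
ap-unique a Q zero 0<Q = AllPairs.[]
ap-unique a Q (suc L) 0<Q = All.tabulate fresh AllPairs.∷ ap-unique (a ℤ.+ + Q) Q L 0<Q
  where
  arith : ∀ a i Q → a ℤ.+ Q ℤ.+ i ℤ.* Q ℤ.- a ≡ (+ 1 ℤ.+ i) ℤ.* Q
  arith = ℤ-Ring.solve-∀
  fresh : ∀ {t} → t ∈ ap (a ℤ.+ + Q) Q L → a ≢ t
  fresh t∈ refl with ∈-ap⁻ (a ℤ.+ + Q) Q L t∈
  ... | i , _ , e with ℤₚ.i*j≡0⇒i≡0∨j≡0 (+ suc i)
      (trans (cong (ℤ._* + Q) (ℤₚ.pos-+ 1 i)) (trans (sym (arith a (+ i) (+ Q))) (trans (cong (ℤ._- a) (sym e)) (ℤₚ.+-inverseʳ a))))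
  ...   | inj₂ z = <⇒≢ 0<Q (sym (ℤₚ.+-injective z))

remove : ∀ {A : Set} {x : A} {l} → x ∈ l → ∃ λ l' → List.length l ≡ suc (List.length l') × (∀ {y} → y ∈ l → y ≢ x → y ∈ l')
remove {l = y List.∷ l} (here refl) = l , refl , λ { (here e) ne → ⊥-elim (ne e) ; (there h) ne → h }
remove {l = y List.∷ l} (there x∈) with remove x∈
... | l' , e , h = y List.∷ l' , cong suc e , λ { (here refl) ne → here refl ; (there k) ne → there (h k ne) }

-- The pigeonhole principle. A count comes with an arbitrary duplicate-free list, so counts can be
-- compared only through inclusion.
unique-length-≤ : ∀ {A : Set} (xs l : List A) → Unique xs → (∀ x → x ∈ xs → x ∈ l) → List.length xs ≤ List.length l
unique-length-≤ List.[] l u h = z≤n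
unique-length-≤ (x List.∷ xs) l (x∉ AllPairs.∷ u) h with remove (h x (here refl))
... | l' , e , k = ≤-trans (s≤s (unique-length-≤ xs l' u (λ y y∈ → k (h y (there y∈)) (λ z → All.lookup x∉ y∈ (sym z)))))
  (≤-reflexive (sym e))

count-filter : ∀ {A : Set} {P : A → Set} (P? : ∀ x → Dec (P x)) xs → sumL xs (ind ∘ P?) ≡ List.length (List.filter P? xs)
count-filter P? List.[] = refl
count-filter P? (x List.∷ xs) with P? x
... | yes _ = cong suc (count-filter P? xs)
... | no _ = count-filter P? xs

-- Counting points of boxes with a periodic condition

Near : ℕ → ℕ → ℕ → Set
Near E X Y = (X ≤ Y + E) × (Y ≤ X + E)

near-trans : ∀ {E E' X Y Z} → Near E X Y → Near E' Y Z → Near (E + E') X Z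
near-trans {E} {E'} {X} {Y} {Z} (a , b) (c , d) =
  ≤-trans a (≤-trans (+-monoˡ-≤ E c) (≤-reflexive (arith Z E' E))) ,
  ≤-trans d (≤-trans (+-monoˡ-≤ E' b) (≤-reflexive (+-assoc X E E')))
  where
  arith : ∀ Z E' E → Z + E' + E ≡ Z + (E + E')
  arith = ℕ-Ring.solve-∀

near-* : ∀ c {E X Y} → Near E X Y → Near (c * E) (c * X) (c * Y)
near-* c {E} {X} {Y} (a , b) =
  ≤-trans (*-monoʳ-≤ c a) (≤-reflexive (*-distribˡ-+ c Y E)) ,
  ≤-trans (*-monoʳ-≤ c b) (≤-reflexive (*-distribˡ-+ c X E))

near-sum : ∀ {A : Set} (xs : List A) (f g : A → ℕ) E → (∀ x → Near E (f x) (g x)) →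
  Near (List.length xs * E) (sumL xs f) (sumL xs g)
near-sum xs f g E h = half-near f g (proj₁ ∘ h) , half-near g f (proj₂ ∘ h)
  where
  half-near : ∀ f g → (∀ x → f x ≤ g x + E) → sumL xs f ≤ sumL xs g + List.length xs * E
  half-near f g k = ≤-trans (sumL-mono xs (λ x _ → k x))
    (≤-reflexive (trans (sumL-+ xs g (λ _ → E)) (cong (ℕ._+_ (sumL xs g)) (sumL-const xs E))))

≡⇒near : ∀ {X Y} → X ≡ Y → Near 0 X Y
≡⇒near {X} refl = ≤-reflexive (sym (+-identityʳ X)) , ≤-reflexive (sym (+-identityʳ X))

near-resp : ∀ {E E' X X' Y Y'} → E ≡ E' → X ≡ X' → Y ≡ Y' → Near E X Y → Near E' X' Y'
near-resp refl refl refl n = n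

ap-++ : ∀ a Q k L (F : ℤ → ℕ) → sumL (ap a Q (k + L)) F ≡ sumL (ap a Q k) F + sumL (ap (a ℤ.+ + k ℤ.* + Q) Q L) F
ap-++ a Q zero L F = cong (λ z → sumL (ap z Q L) F) (ap-start a Q)
ap-++ a Q (suc k) L F = trans (cong (ℕ._+_ (F a)) (trans (ap-++ (a ℤ.+ + Q) Q k L F)
  (cong (λ z → sumL (ap (a ℤ.+ + Q) Q k) F + sumL (ap z Q L) F) (ap-next a k Q))))
  (sym (+-assoc (F a) _ _))

module _ (F : ℤ → ℕ) (q B : ℕ) (F≤B : ∀ t → F t ≤ B) (periodic : ∀ t → F (t ℤ.+ + q) ≡ F t) where

  -- A run of q + 1 consecutive terms can lose its first or its last term; these two are equal by
  -- periodicity.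
  window-step : ∀ a → sumL (ap (a ℤ.+ + 1) 1 q) F ≡ sumL (ap a 1 q) F
  window-step a = +-cancelˡ-≡ (F a) _ _ (begin
    sumL (ap a 1 (1 + q)) F                              ≡⟨ cong (λ k → sumL (ap a 1 k) F) (+-comm 1 q) ⟩
    sumL (ap a 1 (q + 1)) F                              ≡⟨ ap-++ a 1 q 1 F ⟩
    sumL (ap a 1 q) F + (F (a ℤ.+ + q ℤ.* + 1) + 0)      ≡⟨ cong (ℕ._+_ (sumL (ap a 1 q) F)) (trans (+-identityʳ _)
                                                              (trans (cong (λ z → F (a ℤ.+ z)) (ℤₚ.*-identityʳ (+ q))) (periodic a))) ⟩
    sumL (ap a 1 q) F + F a                              ≡⟨ +-comm _ (F a) ⟩
    F a + sumL (ap a 1 q) F                              ∎)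
    where open ≡-Reasoning

  window : ∀ a → sumL (ap a 1 q) F ≡ sumL (ap (+ 0) 1 q) F
  window (+ zero) = refl
  window (+ suc n) = trans (cong (λ z → sumL (ap z 1 q) F) (trans (cong +_ (+-comm 1 n)) (ℤₚ.pos-+ n 1)))
    (trans (window-step (+ n)) (window (+ n)))
  window -[1+ zero ] = sym (window-step -[1+ 0 ])
  window -[1+ suc n ] = trans (sym (window-step -[1+ suc n ])) (window -[1+ n ])

  sum≤ : ∀ xs → sumL xs F ≤ List.length xs * B
  sum≤ xs = ≤-trans (sumL-mono xs (λ t _ → F≤B t)) (≤-reflexive (sumL-const xs B))

  -- Full periods are peeled off, and each contributes the same amount to both sides. The remainder
  -- is shorter than q, so each side is then at most `q * q * B`.
  sum-periodic : 0 < q → ∀ a L → Near (q * q * B) (q * sumL (ap a 1 L) F) (L * sumL (ap (+ 0) 1 q) F)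
  sum-periodic 0<q a L = go L ≤-refl a
    where
    open ≤-Reasoning
    w = sumL (ap (+ 0) 1 q) F
    w≤ : w ≤ q * B
    w≤ = ≤-trans (sum≤ (ap (+ 0) 1 q)) (≤-reflexive (cong (_* B) (length-ap (+ 0) 1 q)))
    go : ∀ {n} L → L ≤ n → ∀ a → Near (q * q * B) (q * sumL (ap a 1 L) F) (L * w)
    go {n} L L≤n a with L ℕ.<? q
    ... | yes L<q =
      ≤-trans (begin
        q * sumL (ap a 1 L) F ≤⟨ *-monoʳ-≤ q (≤-trans (sum≤ (ap a 1 L)) (≤-reflexive (cong (_* B) (length-ap a 1 L)))) ⟩
        q * (L * B)           ≤⟨ *-monoʳ-≤ q (*-monoˡ-≤ B (<⇒≤ L<q)) ⟩
        q * (q * B)           ≡⟨ sym (*-assoc q q B) ⟩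
        q * q * B             ∎) (m≤n+m (q * q * B) (L * w)) ,
      ≤-trans (begin
        L * w       ≤⟨ *-mono-≤ (<⇒≤ L<q) w≤ ⟩
        q * (q * B) ≡⟨ sym (*-assoc q q B) ⟩
        q * q * B   ∎) (m≤n+m (q * q * B) (q * sumL (ap a 1 L) F))
    go {zero} zero L≤n a | no L≮q = ⊥-elim (L≮q 0<q)
    go {suc n} L L≤n a | no L≮q with m≤n⇒∃[o]m+o≡n (≮⇒≥ L≮q)
    ... | L' , refl = near-resp (+-identityʳ _) refl (sym (*-distribʳ-+ w q L'))
          (near-resp refl (sym split) refl (near-shift (q * w)
            (near-resp (sym (+-identityʳ _)) refl refl (go {n} L' L'≤n (a ℤ.+ + q ℤ.* + 1)))))
      where
      near-shift : ∀ c {E X Y} → Near E X Y → Near E (c + X) (c + Y)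
      near-shift c {E} {X} {Y} (a , b) =
        ≤-trans (+-monoʳ-≤ c a) (≤-reflexive (sym (+-assoc c Y E))) ,
        ≤-trans (+-monoʳ-≤ c b) (≤-reflexive (sym (+-assoc c X E)))
      L'≤n : L' ≤ n
      L'≤n = ≤-pred (≤-trans (+-monoˡ-≤ L' 0<q) L≤n)
      split : q * sumL (ap a 1 (q + L')) F ≡ q * w + q * sumL (ap (a ℤ.+ + q ℤ.* + 1) 1 L') F
      split = trans (cong (q *_) (trans (ap-++ a 1 q L' F) (cong (_+ sumL (ap (a ℤ.+ + q ℤ.* + 1) 1 L') F) (window a))))
        (*-distribˡ-+ q w _)

residues : ℕ → ∀ n → List (Vec ℤ n)
residues q n = box (build n (λ _ → ap (+ 0) 1 q))

data UnitSteps (Lmin : ℕ) : ∀ {n} → Vec (List ℤ) n → Set where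
  []  : UnitSteps Lmin []
  _∷_ : ∀ {n I} {Is : Vec (List ℤ) n} → (∃ λ a → ∃ λ L → I ≡ ap a 1 L × Lmin ≤ L) → UnitSteps Lmin Is → UnitSteps Lmin (I ∷ Is)

volume-∷ : ∀ {n} I (Is : Vec (List ℤ) n) → volume (I ∷ Is) ≡ List.length I * volume Is
volume-∷ I Is = trans (sumL-box I Is (λ _ → 1)) (sumL-const I (volume Is))

-- The recursion follows `count-periodic`: the first summand is the cost of averaging the first
-- coordinate over a period, where the slice sums are bounded by `volume Is`; the second is the
-- error inherited from the slices over the q residues.
boundaryError : ℕ → ∀ {n} → Vec (List ℤ) n → ℕ
boundaryError q []               = 0
boundaryError q {suc n} (I ∷ Is) = q ^ n * (q * q * volume Is) + List.length I * (q * boundaryError q Is)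

Periodic : ℕ → ∀ {n} → (Vec ℤ n → ℕ) → Set
Periodic q f = ∀ v w → (∀ k → toForm v k ≡ toForm w k mod q) → f v ≡ f w

periodic-tail : ∀ q {n} (f : Vec ℤ (suc n) → ℕ) → Periodic q f → ∀ a → Periodic q (λ w → f (a ∷ w))
periodic-tail q f per a v w h = per (a ∷ v) (a ∷ w) agree
  where
  agree : ∀ k → toForm (a ∷ v) k ≡ toForm (a ∷ w) k mod q
  agree zero = mod-refl a
  agree (suc k) = h k

count-periodic : ∀ q → 0 < q → ∀ {n Lmin} (Is : Vec (List ℤ) n) → UnitSteps Lmin Is → ∀ f → (∀ v → f v ≤ 1) → Periodic q f →
  Near (boundaryError q Is) (q ^ n * sumL (box Is) f) (volume Is * sumL (residues q n) f)
count-periodic q 0<q [] [] f f≤1 per = ≡⇒near refl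
count-periodic q 0<q {suc n} (.(ap a 1 L) ∷ Is) ((a , L , refl , _) ∷ steps) f f≤1 per =
  near-resp (trans (cong (λ l → q ^ n * (q * q * V) + L * (l * E)) (length-ap (+ 0) 1 q))
                   (cong (λ l → q ^ n * (q * q * V) + l * (q * E)) (sym (length-ap a 1 L)))) left right
    (near-trans
      (near-* (q ^ n) (sum-periodic F q V F≤V F-periodic 0<q a L))
      (near-resp refl middle refl (near-* L (near-sum (ap (+ 0) 1 q) _ _ E
        (λ t → count-periodic q 0<q Is steps (λ w → f (t ∷ w)) (λ w → f≤1 (t ∷ w)) (periodic-tail q f per t))))))
  where
  open ≡-Reasoning
  V = volume Is
  E = boundaryError q Is
  F : ℤ → ℕ
  F t = sumL (box Is) (λ w → f (t ∷ w))
  R : ℤ → ℕ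
  R t = sumL (residues q n) (λ w → f (t ∷ w))
  F≤V : ∀ t → F t ≤ V
  F≤V t = sumL-mono (box Is) (λ w _ → f≤1 (t ∷ w))
  F-periodic : ∀ t → F (t ℤ.+ + q) ≡ F t
  F-periodic t = sumL-cong (box Is) (λ w → per ((t ℤ.+ + q) ∷ w) (t ∷ w) (agree w))
    where
    agree : ∀ w k → toForm ((t ℤ.+ + q) ∷ w) k ≡ toForm (t ∷ w) k mod q
    agree w zero = modulo (+ 1) (cong (ℤ._+_ t) (sym (ℤₚ.*-identityˡ (+ q))))
    agree w (suc k) = mod-refl (toForm w k)
  middle : L * sumL (ap (+ 0) 1 q) (λ t → q ^ n * F t) ≡ q ^ n * (L * sumL (ap (+ 0) 1 q) F)
  middle = trans (cong (L *_) (sumL-* (ap (+ 0) 1 q) (q ^ n) F)) (arith L (q ^ n) _)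
    where
    arith : ∀ a b c → a * (b * c) ≡ b * (a * c)
    arith = ℕ-Ring.solve-∀
  left : q ^ n * (q * sumL (ap a 1 L) F) ≡ q ^ suc n * sumL (box (ap a 1 L ∷ Is)) f
  left = trans (arith (q ^ n) q _) (cong (q ^ suc n *_) (sym (sumL-box (ap a 1 L) Is f)))
    where
    arith : ∀ a b c → a * (b * c) ≡ b * a * c
    arith = ℕ-Ring.solve-∀
  right : L * sumL (ap (+ 0) 1 q) (λ t → V * R t) ≡ volume (ap a 1 L ∷ Is) * sumL (residues q (suc n)) f
  right = begin
    L * sumL (ap (+ 0) 1 q) (λ t → V * R t)  ≡⟨ cong (L *_) (sumL-* (ap (+ 0) 1 q) V R) ⟩
    L * (V * sumL (ap (+ 0) 1 q) R)          ≡⟨ sym (*-assoc L V _) ⟩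
    L * V * sumL (ap (+ 0) 1 q) R            ≡⟨ cong₂ _*_ (trans (cong (_* V) (sym (length-ap a 1 L))) (sym (volume-∷ (ap a 1 L) Is)))
                                                  (sym (sumL-box (ap (+ 0) 1 q) (build n (λ _ → ap (+ 0) 1 q)) f)) ⟩
    volume (ap a 1 L ∷ Is) * sumL (residues q (suc n)) f ∎

-- Compared with `q^n * volume Is`, the error is at most n q / Lmin, which tends to 0 as the box
-- grows with q fixed.
boundaryError-≤ : ∀ q {n Lmin} (Is : Vec (List ℤ) n) → UnitSteps Lmin Is →
  boundaryError q Is * Lmin ≤ n * (q * q ^ n * volume Is)
boundaryError-≤ q [] [] = z≤n
boundaryError-≤ q {suc n} {Lmin} (.(ap a 1 L) ∷ Is) ((a , L , refl , Lmin≤L) ∷ steps) = begin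
  (q ^ n * (q * q * V) + l * (q * E)) * Lmin
    ≡⟨ arith₁ (q ^ n) q V l E Lmin ⟩
  q ^ n * (q * q * V) * Lmin + l * q * (E * Lmin)
    ≤⟨ +-mono-≤ (*-monoʳ-≤ (q ^ n * (q * q * V)) (≤-trans Lmin≤L (≤-reflexive (sym (length-ap a 1 L)))))
         (*-monoʳ-≤ (l * q) (boundaryError-≤ q Is steps)) ⟩
  q ^ n * (q * q * V) * l + l * q * (n * (q * q ^ n * V))
    ≡⟨ arith₂ (q ^ n) q V l n ⟩
  suc n * (q * q ^ suc n * (l * V))
    ≡⟨ cong (λ z → suc n * (q * q ^ suc n * z)) (sym (volume-∷ (ap a 1 L) Is)) ⟩
  suc n * (q * q ^ suc n * volume (ap a 1 L ∷ Is)) ∎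
  where
  open ≤-Reasoning
  V = volume Is
  E = boundaryError q Is
  l = List.length (ap a 1 L)
  arith₁ : ∀ p q V l E m → (p * (q * q * V) + l * (q * E)) * m ≡ p * (q * q * V) * m + l * q * (E * m)
  arith₁ = ℕ-Ring.solve-∀
  arith₂ : ∀ p q V l n → p * (q * q * V) * l + l * q * (n * (q * p * V)) ≡ suc n * (q * (q * p) * (l * V))
  arith₂ = ℕ-Ring.solve-∀

-- Sieves on coefficient vectors

-- A family of local conditions, one at each prime, which at large primes
-- are implied by p^(2d) ∣ Res or by p dividing all coefficients.
record Sieve (d : ℕ) : Set₁ where
  field
    Bad       : ℕ → Coeffs d → Set
    bad?      : ∀ p v → Dec (Bad p v)
    bound     : ℕ
    bad-large : ∀ {p} → Prime p → bound < p → ∀ v → Bad p v →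
                (p ^ (d + d) ∣ ℤ.∣ Res {d} v ∣) ⊎ (∀ k → p ∣ ℤ.∣ toForm v k ∣)
    bad-mod   : ∀ {p q} → p ^ (d + d) ∣ q → ∀ v w → (∀ k → toForm v k ≡ toForm w k mod q) → Bad p v → Bad p w

  Good : ℕ → Coeffs d → Set
  Good M v = ∀ {p} → p < suc M → Prime p → ¬ Bad p v

  good? : ∀ M v → Dec (Good M v)
  good? M v = allUpTo? (λ p → Pr.prime? p Dec.→-dec ¬? (bad? p v)) (suc M)

  Solution : Coeffs d → Set
  Solution v = firstNonzeroPos (Vec.toList v) × (∀ p → Prime p → ¬ Bad p v)

^-cancel-≤ : ∀ n {p y} → n ≢ 0 → p ^ n ≤ y ^ n → p ≤ y
^-cancel-≤ n n≢0 h = ≮⇒≥ (λ lt → <⇒≱ (^-monoˡ-< n {{ℕ.≢-nonZero n≢0}} lt) h)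

m≤m^n : ∀ m n → n ≢ 0 → m ≤ m ^ n
m≤m^n zero n n≢0 = z≤n
m≤m^n (suc m) zero n≢0 = ⊥-elim (n≢0 refl)
m≤m^n (suc m) (suc n) _ = ≤-trans (≤-reflexive (sym (*-identityʳ (suc m)))) (*-monoʳ-≤ (suc m) (m^n>0 (suc m) n))

module _ (d : ℕ) (0<d : 0 < d) where

  tail-hit : ∀ {p} → Prime p → ∀ M Z → M < p → p ≤ M + Z → ∀ v →
    1 ≤ ind (E₁? d p v) + ind (E₂? d p v) + ind (E₃? d p v) → 1 ≤ tailWeight d M Z v
  tail-hit {p} pp M Z M<p p≤ v h = ≤-trans
    (≤-trans (≤-trans h (≤-reflexive (trans (sym (*-identityˡ e)) (cong (_* e) (sym (ind-yes (Pr.prime? p) pp))))))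
      (sumL-∈ (λ p → isPrime p * (ind (E₁? d p v) + ind (E₂? d p v) + ind (E₃? d p v))) (∈-range M Z M<p p≤)))
    (m≤n+m _ (ind (toForm v (suc d + d) ℤ.≟ + 0)))
    where e = ind (E₁? d p v) + ind (E₂? d p v) + ind (E₃? d p v)

  -- If p divides neither leading coefficient or only A_d, the exponent 2d is lowered to the d + 1
  -- of E₃, which is possible because d is positive; if p divides B_d alone, one factor p of the
  -- resultant suffices.
  classify : ∀ p v → p ^ (d + d) ∣ ℤ.∣ Res {d} v ∣ → 1 ≤ ind (E₁? d p v) + ind (E₂? d p v) + ind (E₃? d p v)
  classify p v h = go (p ∣? ℤ.∣ toForm v (suc d + d) ∣) (p ∣? ℤ.∣ toForm v d ∣)
    where
    e₁ = ind (E₁? d p v)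
    e₂ = ind (E₂? d p v)
    e₃ = ind (E₃? d p v)
    p∣Res : p ∣ ℤ.∣ Res {d} v ∣
    p∣Res = Div.∣-trans (subst (_∣ p ^ (d + d)) (*-identityʳ p) (^-monoʳ-∣ p {1} (≤-trans 0<d (m≤m+n d d)))) h
    go : Dec (p ∣ ℤ.∣ toForm v (suc d + d) ∣) → Dec (p ∣ ℤ.∣ toForm v d ∣) → 1 ≤ e₁ + e₂ + e₃
    go (yes b) (yes a) = ≤-trans (≤-reflexive (sym (ind-yes (E₁? d p v) (b , a))))
      (≤-trans (m≤m+n e₁ e₂) (m≤m+n (e₁ + e₂) e₃))
    go (yes b) (no ¬a) = ≤-trans (≤-reflexive (sym (ind-yes (E₂? d p v) (b , ¬a , p∣Res))))
      (≤-trans (m≤n+m e₂ e₁) (m≤m+n (e₁ + e₂) e₃))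
    go (no ¬b) _ = ≤-trans (≤-reflexive (sym (ind-yes (E₃? d p v) (¬b , Div.∣-trans
      (^-monoʳ-∣ p (subst (_≤ d + d) (cong suc (sym (*-identityʳ d))) (+-monoˡ-≤ d 0<d))) h))))
      (m≤n+m e₃ (e₁ + e₂))

  module _ (𝒮 : Sieve d) where
    open Sieve 𝒮

    -- A bad prime above M must fall in (M, M + Z] to be seen by the weight. If it divides all
    -- coefficients, it is at most |B_d|; if its 2d-th power divides a nonzero resultant, it is at
    -- most (2d)! x by `Res-bound`. Both are at most Z.
    all-good : ∀ {p₀} → Prime p₀ → ∀ M x Z → bound ≤ M → M < p₀ → p₀ ≤ M + Z → (d + d) ℕ.! * x ≤ Z →
      ∀ v → (∀ k → ℤ.∣ toForm v k ∣ ≤ x) → Good M v → tailWeight d M Z v ≡ 0 → ∀ p → Prime p → ¬ Bad p v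
    all-good {p₀} pp₀ M x Z S≤M M<p₀ p₀≤ Cx≤Z v v≤x good τ≡0 p pp bad with p ℕ.<? suc M
    ... | yes p≤M = good p≤M pp bad
    ... | no p≰M = contradiction (bad-large pp (≤-<-trans S≤M M<p) v bad)
      where
      M<p : M < p
      M<p = ≮⇒≥ p≰M
      B = toForm v (suc d + d)
      R = ℤ.∣ Res {d} v ∣
      C = (d + d) ℕ.!
      e = d + d
      e≢0 : e ≢ 0
      e≢0 = >⇒≢ (≤-trans 0<d (m≤m+n d d))
      absurd : ¬ (1 ≤ tailWeight d M Z v)
      absurd h = <⇒≢ h (sym τ≡0)
      B≢0 : B ≢ + 0
      B≢0 z = absurd (≤-trans (≤-reflexive (sym (ind-yes (B ℤ.≟ + 0) z))) (m≤m+n _ _))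
      x≤Z : x ≤ Z
      x≤Z = ≤-trans (≤-trans (≤-reflexive (sym (*-identityˡ x))) (*-monoˡ-≤ x (1≤n! e))) Cx≤Z
      root : R ≢ 0 → p ^ e ∣ R → p ≤ Z
      root R≢0 h = ≤-trans (^-cancel-≤ e e≢0 (≤-trans (Div.∣⇒≤ {{ℕ.≢-nonZero R≢0}} h)
        (≤-trans (Res-bound d v x v≤x) (≤-trans (*-monoˡ-≤ (x ^ e) (m≤m^n C e e≢0))
          (≤-reflexive (sym (pow-* C x e))))))) Cx≤Z
      contradiction : (p ^ e ∣ R) ⊎ (∀ k → p ∣ ℤ.∣ toForm v k ∣) → ⊥
      contradiction (inj₂ all) = absurd (tail-hit pp M Z M<p
        (≤-trans (Div.∣⇒≤ {{ℕ.≢-nonZero (B≢0 ∘ ℤₚ.∣i∣≡0⇒i≡0)}} (all (suc d + d))) (≤-trans (v≤x (suc d + d)) (≤-trans x≤Z (m≤n+m Z M)))) v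
        (≤-trans (≤-reflexive (sym (ind-yes (E₁? d p v) (all (suc d + d) , all d))))
          (≤-trans (m≤m+n _ _) (m≤m+n _ _))))
      contradiction (inj₁ h) = go (R ℕ.≟ 0)
        where
        go : Dec (R ≡ 0) → ⊥
        -- A zero resultant bounds no prime. It is divisible by `p₀^(2d)`, however, and p₀ lies in
        -- the range of the weight by assumption.
        go (yes z) = absurd (tail-hit pp₀ M Z M<p₀ p₀≤ v (classify p₀ v (subst (p₀ ^ e ∣_) (sym z) ((p₀ ^ e) Div.∣0))))
        go (no nz) = absurd (tail-hit pp M Z M<p (≤-trans (root nz h) (m≤n+m Z M)) v (classify p v h))

-- Height boxes and the comparison of counts

height-≤⇒ : ∀ {n} (v : Vec ℤ n) {x} → height v ≤ x → ∀ k → ℤ.∣ toForm v k ∣ ≤ x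
height-≤⇒ [] h k = z≤n
height-≤⇒ (a ∷ v) h zero = ≤-trans (m≤m⊔n ℤ.∣ a ∣ (height v)) h
height-≤⇒ (a ∷ v) h (suc k) = height-≤⇒ v (≤-trans (m≤n⊔m ℤ.∣ a ∣ (height v)) h) k

height-≤⇐ : ∀ {n} (v : Vec ℤ n) {x} → (∀ k → k < n → ℤ.∣ toForm v k ∣ ≤ x) → height v ≤ x
height-≤⇐ [] h = z≤n
height-≤⇐ (a ∷ v) h = ⊔-lub (h 0 (s≤s z≤n)) (height-≤⇐ v (λ k lt → h (suc k) (s≤s lt)))

interval : ℕ → List ℤ
interval x = ap (ℤ.- (+ x)) 1 (suc (x + x))

∈-interval⁺ : ∀ x t → ℤ.∣ t ∣ ≤ x → t ∈ interval x
∈-interval⁺ x (+ n) h = subst (_∈ interval x) (trans (cong (λ z → ℤ.- (+ x) ℤ.+ z ℤ.* + 1) (ℤₚ.pos-+ x n)) (arith (+ x) (+ n)))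
  (∈-ap⁺ (ℤ.- (+ x)) 1 (suc (x + x)) (x + n) (s≤s (+-monoʳ-≤ x h)))
  where
  arith : ∀ x n → ℤ.- x ℤ.+ (x ℤ.+ n) ℤ.* + 1 ≡ n
  arith = ℤ-Ring.solve-∀
∈-interval⁺ x -[1+ n ] h with m≤n⇒∃[o]m+o≡n h
... | o , refl = subst (_∈ interval x) (trans (cong (λ z → ℤ.- z ℤ.+ + o ℤ.* + 1) (ℤₚ.pos-+ (suc n) o)) (arith (+ suc n) (+ o)))
  (∈-ap⁺ (ℤ.- (+ x)) 1 (suc (x + x)) o (s≤s (≤-trans (m≤n+m o (suc n)) (m≤m+n x x))))
  where
  arith : ∀ n o → ℤ.- (n ℤ.+ o) ℤ.+ o ℤ.* + 1 ≡ ℤ.- n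
  arith = ℤ-Ring.solve-∀

∈-interval⁻ : ∀ x t → t ∈ interval x → ℤ.∣ t ∣ ≤ x
∈-interval⁻ x t t∈ with ∈-ap⁻ (ℤ.- (+ x)) 1 (suc (x + x)) t∈
... | i , i<L , refl with ≤-total i x
...   | inj₁ i≤x with m≤n⇒∃[o]m+o≡n i≤x
...     | o , refl = ≤-trans (≤-reflexive (trans (cong ℤ.∣_∣ (trans (cong (λ z → ℤ.- z ℤ.+ + i ℤ.* + 1) (ℤₚ.pos-+ i o)) (arith (+ i) (+ o))))
            (ℤₚ.∣-i∣≡∣i∣ (+ o)))) (m≤n+m o i)
  where
  arith : ∀ i o → ℤ.- (i ℤ.+ o) ℤ.+ i ℤ.* + 1 ≡ ℤ.- o
  arith = ℤ-Ring.solve-∀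
∈-interval⁻ x t t∈ | i , i<L , refl | inj₂ x≤i with m≤n⇒∃[o]m+o≡n x≤i
...     | o , refl = ≤-trans (≤-reflexive (cong ℤ.∣_∣ (trans (cong (λ z → ℤ.- (+ x) ℤ.+ z ℤ.* + 1) (ℤₚ.pos-+ x o)) (arith (+ x) (+ o)))))
            (+-cancelˡ-≤ x o x (≤-pred i<L))
  where
  arith : ∀ x o → ℤ.- x ℤ.+ (x ℤ.+ o) ℤ.* + 1 ≡ o
  arith = ℤ-Ring.solve-∀

-- The points with A₀ > 0 in the box of height x.
halfSide : ℕ → ℕ → List ℤ
halfSide x zero    = ap (+ 1) 1 x
halfSide x (suc _) = interval x

halfBox : ∀ d → ℕ → Vec (List ℤ) (size d)
halfBox d x = build (size d) (halfSide x)

slice : ∀ d → ℕ → Vec (List ℤ) (d + suc d)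
slice d x = build (d + suc d) (λ _ → interval x)

-- What the lower bound requires of a set of candidates. It is met by the whole half box, for the
-- asymptotic count, and by a residue class inside it, for positivity.
record SubHalfBox (d x : ℕ) (xs : List (Coeffs d)) : Set where
  field
    unique   : Unique xs
    positive : ∀ v → v ∈ xs → firstNonzeroPos (Vec.toList v)
    small    : ∀ v → v ∈ xs → height v ≤ x

ap1-positive : ∀ x {t} → t ∈ ap (+ 1) 1 x → ∃ λ m → t ≡ + suc m × suc m ≤ x
ap1-positive x t∈ with ∈-ap⁻ (+ 1) 1 x t∈
... | i , i<x , refl = i , trans (cong (ℤ._+_ (+ 1)) (ℤₚ.*-identityʳ (+ i))) (sym (ℤₚ.pos-+ 1 i)) , i<x

subHalfBox : ∀ d x g → (∀ k → k < size d → Unique (g k)) → (∀ t → t ∈ g 0 → ∃ λ m → t ≡ + suc m × suc m ≤ x) →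
  (∀ k → k < size d → ∀ t → t ∈ g k → ℤ.∣ t ∣ ≤ x) → SubHalfBox d x (box (build (size d) g))
subHalfBox d x g u pos sm = record
  { unique   = box-unique (size d) g u
  ; positive = λ v v∈ → leading v (pos (toForm v 0) (∈-box⁻ (size d) g v v∈ 0 (s≤s z≤n)))
  ; small    = λ v v∈ → height-≤⇐ v (λ k lt → sm k lt (toForm v k) (∈-box⁻ (size d) g v v∈ k lt))
  }
  where
  leading : ∀ (v : Coeffs d) → (∃ λ m → toForm v 0 ≡ + suc m × suc m ≤ x) → firstNonzeroPos (Vec.toList v)
  leading (.(+ suc m) ∷ v) (m , refl , _) = tt

halfBox-subHalfBox : ∀ d x → SubHalfBox d x (box (halfBox d x))
halfBox-subHalfBox d x = subHalfBox d x (halfSide x) uniq (λ t → ap1-positive x) sm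
  where
  uniq : ∀ k → k < size d → Unique (halfSide x k)
  uniq zero _ = ap-unique (+ 1) 1 x (s≤s z≤n)
  uniq (suc k) _ = ap-unique (ℤ.- (+ x)) 1 (suc (x + x)) (s≤s z≤n)
  sm : ∀ k → k < size d → ∀ t → t ∈ halfSide x k → ℤ.∣ t ∣ ≤ x
  sm zero _ t t∈ with ap1-positive x t∈
  ... | m , refl , h = h
  sm (suc k) _ t t∈ = ∈-interval⁻ x t t∈

module _ (d : ℕ) (0<d : 0 < d) (𝒮 : Sieve d) where
  open Sieve 𝒮

  -- A candidate that is good up to M is either a solution or has positive tail weight, so the
  -- failures are paid for by the sum of the weights.
  lower-count : ∀ x (l : List (Coeffs d)) → (∀ v → Solution v → height v ≤ x → v ∈ l) →
    ∀ {p₀} → Prime p₀ → ∀ M Z → bound ≤ M → M < p₀ → p₀ ≤ M + Z → (d + d) ℕ.! * x ≤ Z →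
    ∀ xs → SubHalfBox d x xs → sumL xs (ind ∘ good? M) ≤ List.length l + sumL xs (tailWeight d M Z)
  lower-count x l complete pp₀ M Z S≤M M<p₀ p₀≤ Cx≤Z xs sub = begin
    sumL xs (ind ∘ good? M)
      ≤⟨ sumL-mono xs (λ v _ → split v) ⟩
    sumL xs (λ v → ind (both? v) + τ v)
      ≡⟨ sumL-+ xs (ind ∘ both?) τ ⟩
    sumL xs (ind ∘ both?) + sumL xs τ
      ≡⟨ cong (_+ sumL xs τ) (count-filter both? xs) ⟩
    List.length (List.filter both? xs) + sumL xs τ
      ≤⟨ +-monoˡ-≤ (sumL xs τ) (unique-length-≤ (List.filter both? xs) l
           (Uniqueₚ.filter⁺ both? (SubHalfBox.unique sub)) inside) ⟩
    List.length l + sumL xs τ ∎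
    where
    open ≤-Reasoning
    τ = tailWeight d M Z
    both? : ∀ v → Dec (Good M v × τ v ≡ 0)
    both? v = good? M v ×-dec (τ v ℕ.≟ 0)
    split : ∀ v → ind (good? M v) ≤ ind (both? v) + τ v
    split v = go (τ v ℕ.≟ 0)
      where
      go : Dec (τ v ≡ 0) → ind (good? M v) ≤ ind (both? v) + τ v
      go (yes z) = ≤-trans (ind-mono (good? M v) (both? v) (λ g → g , z)) (m≤m+n (ind (both? v)) (τ v))
      go (no nz) = ≤-trans (ind≤1 (good? M v)) (≤-trans (n≢0⇒n>0 nz) (m≤n+m (τ v) (ind (both? v))))
    inside : ∀ v → v ∈ List.filter both? xs → v ∈ l
    inside v v∈ with ∈ₚ.∈-filter⁻ both? {xs = xs} v∈
    ... | v∈xs , (good , z) = complete v (SubHalfBox.positive sub v v∈xs ,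
            all-good d 0<d 𝒮 pp₀ M x Z S≤M M<p₀ p₀≤ Cx≤Z v (height-≤⇒ v (SubHalfBox.small sub v v∈xs)) good z)
            (SubHalfBox.small sub v v∈xs)

  -- Normalisation excludes A₀ < 0. Solutions with A₀ > 0 lie in the half box and are good up to M;
  -- those with A₀ = 0 are bounded by the whole slice, which has one dimension less.
  upper-count : ∀ x M (l : List (Coeffs d)) → Unique l → (∀ v → v ∈ l → Solution v × height v ≤ x) →
    List.length l ≤ sumL (box (halfBox d x)) (ind ∘ good? M) + volume (slice d x)
  upper-count x M l uniq sound = ≤-trans
    (unique-length-≤ l (List.filter (good? M) (box (halfBox d x)) List.++ List.map (+ 0 ∷_) (box (slice d x))) uniq inside)
    (≤-reflexive (trans (Listₚ.length-++ (List.filter (good? M) (box (halfBox d x))))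
      (cong₂ _+_ (sym (count-filter (good? M) (box (halfBox d x))))
        (trans (Listₚ.length-map (+ 0 ∷_) (box (slice d x))) (trans (sym (*-identityʳ _)) (sym (sumL-const (box (slice d x)) 1)))))))
    where
    inside : ∀ v → v ∈ l → v ∈ List.filter (good? M) (box (halfBox d x)) List.++ List.map (+ 0 ∷_) (box (slice d x))
    inside v v∈ with sound v v∈
    ... | (pos , ok) , h = go v pos (λ {p} _ → ok p) (height-≤⇒ v h)
      where
      go : ∀ v → firstNonzeroPos (Vec.toList v) → Good M v → (∀ k → ℤ.∣ toForm v k ∣ ≤ x) →
        v ∈ List.filter (good? M) (box (halfBox d x)) List.++ List.map (+ 0 ∷_) (box (slice d x))
      go (+ zero ∷ w) pos good sm = ∈ₚ.∈-++⁺ʳ (List.filter (good? M) (box (halfBox d x)))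
        (∈ₚ.∈-map⁺ (+ 0 ∷_) (∈-box⁺ (d + suc d) (λ _ → interval x) w (λ k _ → ∈-interval⁺ x (toForm w k) (sm (suc k)))))
      go (+ suc m ∷ w) pos good sm = ∈ₚ.∈-++⁺ˡ (∈ₚ.∈-filter⁺ (good? M) (∈-box⁺ (size d) (halfSide x) (+ suc m ∷ w) coordinate) good)
        where
        coordinate : ∀ k → k < size d → toForm (+ suc m ∷ w) k ∈ halfSide x k
        coordinate zero _ = subst (_∈ ap (+ 1) 1 x) (trans (cong (ℤ._+_ (+ 1)) (ℤₚ.*-identityʳ (+ m))) (sym (ℤₚ.pos-+ 1 m)))
          (∈-ap⁺ (+ 1) 1 x m (sm 0))
        coordinate (suc k) _ = ∈-interval⁺ x (toForm w k) (sm (suc k))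

-- The modulus and the total error

prime-divisor : ∀ n → 1 < n → ∃ λ p → Prime p × p ∣ n
prime-divisor n 1<n with Fact.factorise n {{ℕ.>-nonZero (<-trans (s≤s z≤n) 1<n)}}
... | record { factors = List.[] ; isFactorisation = e } = ⊥-elim (<⇒≢ 1<n (sym e))
... | record { factors = p List.∷ ps ; isFactorisation = e ; factorsPrime = pp All.∷ _ } = p , pp , subst (p ∣_) (sym e) (Div.m∣m*n _)

∣-! : ∀ {p M} → 0 < p → p ≤ M → p ∣ M ℕ.!
∣-! {suc p} {M} _ p≤M = Div.∣-trans (Div.m∣m*n (p ℕ.!)) (Div.m≤n⇒m!∣n! p≤M)

prime-above : ∀ M → ∃ λ p → Prime p × M < p
prime-above M with prime-divisor (M ℕ.! + 1) (+-monoˡ-≤ 1 (1≤n! M))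
... | p , pp , h = p , pp , ≰⇒> (λ p≤M → Pr.¬prime[1] (subst Prime (Div.∣1⇒≡1
        (Div.∣m+n∣m⇒∣n h (∣-! (n≢0⇒n>0 (ℕ.≢-nonZero⁻¹ p {{Pr.prime⇒nonZero pp}})) p≤M))) pp))

-- Divisible enough to decide badness at every prime up to M, yet coprime to all larger primes, as
-- the tail estimate demands of the step of a progression.
modulus : ℕ → ℕ → ℕ
modulus d M = (M ℕ.!) ^ (d + d)

modulus>0 : ∀ d M → 0 < modulus d M
modulus>0 d M = m^n>0 (M ℕ.!) {{ℕ.>-nonZero (1≤n! M)}} (d + d)

∣-modulus : ∀ d M {p} → Prime p → p ≤ M → p ^ (d + d) ∣ modulus d M
∣-modulus d M {p} pp p≤M = ^-mono-∣ (d + d) (∣-! (n≢0⇒n>0 (ℕ.≢-nonZero⁻¹ p {{Pr.prime⇒nonZero pp}})) p≤M)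

∤-modulus : ∀ d M {p} → Prime p → M < p → ¬ (p ∣ modulus d M)
∤-modulus d M pp M<p = prime∤pow pp (M ℕ.!) (d + d) (prime∤! M pp M<p)

halfBox-sides : ∀ d x → Sides (halfBox d x) 1 x (suc (x + x))
halfBox-sides d x = sides (+ 1 , refl) other
  where
  other : ∀ i → 0 < i → i < size d → IsAp (side (halfBox d x) i) 1 (suc (x + x))
  other (suc i) _ lt = ℤ.- (+ x) , side-build (size d) (halfSide x) (suc i) lt

unitSteps-build : ∀ {Lmin} n g → (∀ k → ∃ λ a → ∃ λ L → g k ≡ ap a 1 L × Lmin ≤ L) → UnitSteps Lmin (build n g)
unitSteps-build zero g h = []
unitSteps-build (suc n) g h = h 0 ∷ unitSteps-build n (g ∘ suc) (h ∘ suc)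

halfBox-steps : ∀ d x → UnitSteps x (halfBox d x)
halfBox-steps d x = unitSteps-build (size d) (halfSide x) step
  where
  step : ∀ k → ∃ λ a → ∃ λ L → halfSide x k ≡ ap a 1 L × x ≤ L
  step zero = + 1 , x , refl , ≤-refl
  step (suc k) = ℤ.- (+ x) , suc (x + x) , refl , ≤-trans (m≤m+n x x) (n≤1+n _)

volume-build-≤ : ∀ n g g' c → (∀ k → k < n → List.length (g k) ≤ c * List.length (g' k)) →
  volume (build n g) ≤ c ^ n * volume (build n g')
volume-build-≤ zero g g' c h = ≤-refl
volume-build-≤ (suc n) g g' c h = begin
  volume (build (suc n) g)
    ≡⟨ volume-∷ (g 0) (build n (g ∘ suc)) ⟩
  List.length (g 0) * volume (build n (g ∘ suc))
    ≤⟨ *-mono-≤ (h 0 (s≤s z≤n)) (volume-build-≤ n (g ∘ suc) (g' ∘ suc) c (λ k lt → h (suc k) (s≤s lt))) ⟩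
  c * List.length (g' 0) * (c ^ n * volume (build n (g' ∘ suc)))
    ≡⟨ arith c (List.length (g' 0)) (c ^ n) _ ⟩
  c ^ suc n * (List.length (g' 0) * volume (build n (g' ∘ suc)))
    ≡⟨ cong (c ^ suc n *_) (sym (volume-∷ (g' 0) (build n (g' ∘ suc)))) ⟩
  c ^ suc n * volume (build (suc n) g') ∎
  where
  open ≤-Reasoning
  arith : ∀ a b c d → a * b * (c * d) ≡ a * c * (b * d)
  arith = ℕ-Ring.solve-∀

-- Within 1/K, the proportion of the solutions among the points with
-- A₀ > 0 is r / D.
ApproximateProportion : ∀ d → (Coeffs d → Set) → ℕ → ℕ → ℕ → ℕ → Set
ApproximateProportion d P K r D N = ∀ x → N ≤ x → ∀ s → CountH {d} P x s →
  (K * (s * D) ≤ K * (r * volume (halfBox d x)) + D * volume (halfBox d x)) ×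
  (K * (r * volume (halfBox d x)) ≤ K * (s * D) + D * volume (halfBox d x))

-- The upper bound loses the slice A₀ = 0 and the boundary error, the lower bound loses the tail and
-- the boundary error. Two errors on either side account for the 2 in front of K.
combine-estimates : ∀ K s P L T V r D E → s ≤ P + L → P ≤ s + T → Near E (D * P) (V * r) →
  2 * K * L ≤ V → 2 * K * T ≤ V → 2 * K * E ≤ D * V →
  (K * (s * D) ≤ K * (r * V) + D * V) × (K * (r * V) ≤ K * (s * D) + D * V)
combine-estimates K s P L T V r D E up low (n₁ , n₂) hL hT hE =
  *-cancelˡ-≤ 2 (begin
    2 * (K * (s * D))                                  ≤⟨ *-monoʳ-≤ 2 (*-monoʳ-≤ K (*-monoˡ-≤ D up)) ⟩
    2 * (K * ((P + L) * D))                            ≡⟨ a₁ K P L D ⟩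
    2 * (K * (D * P)) + D * (2 * K * L)                ≤⟨ +-mono-≤ (*-monoʳ-≤ 2 (*-monoʳ-≤ K n₁)) (*-monoʳ-≤ D hL) ⟩
    2 * (K * (V * r + E)) + D * V                      ≡⟨ a₂ K V r E D ⟩
    2 * (K * (r * V)) + (2 * K * E + D * V)            ≤⟨ +-monoʳ-≤ (2 * (K * (r * V))) (+-monoˡ-≤ (D * V) hE) ⟩
    2 * (K * (r * V)) + (D * V + D * V)                ≡⟨ a₃ (K * (r * V)) (D * V) ⟩
    2 * (K * (r * V) + D * V)                          ∎) ,
  *-cancelˡ-≤ 2 (begin
    2 * (K * (r * V))                                  ≤⟨ *-monoʳ-≤ 2 (*-monoʳ-≤ K (subst (_≤ D * P + E) (*-comm V r) n₂)) ⟩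
    2 * (K * (D * P + E))                              ≤⟨ *-monoʳ-≤ 2 (*-monoʳ-≤ K (+-monoˡ-≤ E (*-monoʳ-≤ D low))) ⟩
    2 * (K * (D * (s + T) + E))                        ≡⟨ a₄ K D s T E ⟩
    2 * (K * (s * D)) + (D * (2 * K * T) + 2 * K * E)  ≤⟨ +-monoʳ-≤ (2 * (K * (s * D))) (+-mono-≤ (*-monoʳ-≤ D hT) hE) ⟩
    2 * (K * (s * D)) + (D * V + D * V)                ≡⟨ a₃ (K * (s * D)) (D * V) ⟩
    2 * (K * (s * D) + D * V)                          ∎)
  where
  open ≤-Reasoning
  a₁ : ∀ K P L D → 2 * (K * ((P + L) * D)) ≡ 2 * (K * (D * P)) + D * (2 * K * L)
  a₁ = ℕ-Ring.solve-∀
  a₂ : ∀ K V r E D → 2 * (K * (V * r + E)) + D * V ≡ 2 * (K * (r * V)) + (2 * K * E + D * V)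
  a₂ = ℕ-Ring.solve-∀
  a₃ : ∀ x y → 2 * x + (y + y) ≡ 2 * (x + y)
  a₃ = ℕ-Ring.solve-∀
  a₄ : ∀ K D s T E → 2 * (K * (D * (s + T) + E)) ≡ 2 * (K * (s * D)) + (D * (2 * K * T) + 2 * K * E)
  a₄ = ℕ-Ring.solve-∀

-- The residue class of a map with good reduction everywhere

seedCoefficient : ℕ → ℕ → ℤ
seedCoefficient d k = + (ind (k ℕ.≟ d) + ind (k ℕ.≟ suc d))

-- The map X^d / Y^d.
seed : ∀ d → Coeffs d
seed d = build (size d) (seedCoefficient d)

seedCoefficient-≤ : ∀ d k → ind (k ℕ.≟ d) + ind (k ℕ.≟ suc d) ≤ 1
seedCoefficient-≤ d k = go (k ℕ.≟ d) (k ℕ.≟ suc d)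
  where
  go : (p : Dec (k ≡ d)) (q : Dec (k ≡ suc d)) → ind p + ind q ≤ 1
  go (yes refl) (yes e) = ⊥-elim (<⇒≢ (n<1+n d) e)
  go (yes _) (no _) = s≤s z≤n
  go (no _) q = ind≤1 q

-- The seed has A₀ = 0 for positive d. The first progression starts at q instead, in the same class,
-- to keep A₀ positive.
subSide : ℕ → ℕ → ℕ → ℕ → List ℤ
subSide d q Y zero    = ap (+ q) q Y
subSide d q Y (suc k) = ap (seedCoefficient d (suc k)) q Y

-- Points congruent to the seed modulo q.
subBox : ∀ d → ℕ → ℕ → Vec (List ℤ) (size d)
subBox d q Y = build (size d) (subSide d q Y)

+-multiple : ∀ c i q → + c ℤ.+ + i ℤ.* + q ≡ + (c + i * q)
+-multiple c i q = trans (cong (ℤ._+_ (+ c)) (sym (ℤₚ.pos-* i q))) (sym (ℤₚ.pos-+ c (i * q)))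

subBox-subHalfBox : ∀ d q Y x → 0 < q → Y * q ≤ x → SubHalfBox d x (box (subBox d q Y))
subBox-subHalfBox d q Y x 0<q Yq≤x = subHalfBox d x (subSide d q Y) uniq pos small
  where
  uniq : ∀ k → k < size d → Unique (subSide d q Y k)
  uniq zero _ = ap-unique (+ q) q Y 0<q
  uniq (suc k) _ = ap-unique (seedCoefficient d (suc k)) q Y 0<q
  pos : ∀ t → t ∈ ap (+ q) q Y → ∃ λ m → t ≡ + suc m × suc m ≤ x
  pos t t∈ with ∈-ap⁻ (+ q) q Y t∈
  ... | i , i<Y , e = pred (suc i * q) ,
        trans e (trans (+-multiple q i q) (cong +_ (sym (suc-pred (suc i * q) {{nz}})))) ,
        ≤-trans (≤-reflexive (suc-pred (suc i * q) {{nz}})) (≤-trans (*-monoˡ-≤ q i<Y) Yq≤x)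
    where nz = m*n≢0 (suc i) q {{_}} {{ℕ.>-nonZero 0<q}}
  bounded : ∀ c → c ≤ q → ∀ t → t ∈ ap (+ c) q Y → ℤ.∣ t ∣ ≤ x
  bounded c c≤q t t∈ with ∈-ap⁻ (+ c) q Y t∈
  ... | i , i<Y , e = ≤-trans (≤-reflexive (cong ℤ.∣_∣ (trans e (+-multiple c i q))))
        (≤-trans (+-monoˡ-≤ (i * q) c≤q) (≤-trans (*-monoˡ-≤ q i<Y) Yq≤x))
  small : ∀ k → k < size d → ∀ t → t ∈ subSide d q Y k → ℤ.∣ t ∣ ≤ x
  small zero _ = bounded q ≤-refl
  small (suc k) _ = bounded _ (≤-trans (seedCoefficient-≤ d (suc k)) 0<q)

subBox-seed : ∀ d → 0 < d → ∀ q Y v → v ∈ box (subBox d q Y) → ∀ k → toForm v k ≡ toForm (seed d) k mod q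
subBox-seed d 0<d q Y v v∈ k = go (k ℕ.<? size d)
  where
  seed₀ : seedCoefficient d 0 ≡ + 0
  seed₀ = cong +_ (cong₂ _+_ (ind-no (0 ℕ.≟ d) (<⇒≢ 0<d)) (ind-no (0 ℕ.≟ suc d) (λ ())))
  shift : ∀ q i → q ℤ.+ i ℤ.* q ≡ + 0 ℤ.+ (+ 1 ℤ.+ i) ℤ.* q
  shift = ℤ-Ring.solve-∀
  residue : ∀ k {t} → t ∈ subSide d q Y k → t ≡ seedCoefficient d k mod q
  residue zero {t} t∈ with ∈-ap⁻ (+ q) q Y t∈
  ... | i , _ , e = subst (λ z → t ≡ z mod q) (sym seed₀) (modulo (+ 1 ℤ.+ + i) (trans e (shift (+ q) (+ i))))
  residue (suc k) t∈ with ∈-ap⁻ (seedCoefficient d (suc k)) q Y t∈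
  ... | i , _ , e = modulo (+ i) e
  go : Dec (k < size d) → toForm v k ≡ toForm (seed d) k mod q
  go (no k≮) = subst₂ (λ y z → y ≡ z mod q) (sym (toForm-beyond v k (≮⇒≥ k≮))) (sym (toForm-beyond (seed d) k (≮⇒≥ k≮))) (mod-refl (+ 0))
  go (yes k<) = subst (λ z → toForm v k ≡ z mod q) (sym (toForm-build (size d) (seedCoefficient d) k k<))
    (residue k (∈-box⁻ (size d) (subSide d q Y) v v∈ k k<))

length-subSide : ∀ d q Y k → List.length (subSide d q Y k) ≡ Y
length-subSide d q Y zero = length-ap (+ q) q Y
length-subSide d q Y (suc k) = length-ap (seedCoefficient d (suc k)) q Y

subBox-sides : ∀ d q Y → Sides (subBox d q Y) q Y Y
subBox-sides d q Y = sides (+ q , refl) other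
  where
  other : ∀ i → 0 < i → i < size d → IsAp (side (subBox d q Y) i) q Y
  other (suc i) _ lt = seedCoefficient d (suc i) , side-build (size d) (subSide d q Y) (suc i) lt

-- A side of the half box has at most 2x + 1 entries, hence at most 3x, and 3x is at most 6qY; a
-- side of the sub-box has Y entries.
volume-halfBox-≤ : ∀ d q Y x → 1 ≤ x → x ≤ 2 * q * Y → volume (halfBox d x) ≤ (6 * q) ^ size d * volume (subBox d q Y)
volume-halfBox-≤ d q Y x 1≤x x≤2qY = volume-build-≤ (size d) (halfSide x) (subSide d q Y) (6 * q) (λ k _ →
  ≤-trans (length-half k) (≤-trans 3x≤ (≤-reflexive (cong (6 * q *_) (sym (length-subSide d q Y k))))))
  where
  a₁ : ∀ x → 1 * x + (x + x) ≡ 3 * x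
  a₁ = ℕ-Ring.solve-∀
  a₂ : ∀ q Y → 3 * (2 * q * Y) ≡ 6 * q * Y
  a₂ = ℕ-Ring.solve-∀
  3x≤ : 3 * x ≤ 6 * q * Y
  3x≤ = ≤-trans (*-monoʳ-≤ 3 x≤2qY) (≤-reflexive (a₂ q Y))
  length-half : ∀ k → List.length (halfSide x k) ≤ 3 * x
  length-half zero = ≤-trans (≤-reflexive (length-ap (+ 1) 1 x)) (m≤m+n x _)
  length-half (suc k) = ≤-trans (≤-reflexive (length-ap (ℤ.- (+ x)) 1 (suc (x + x))))
    (≤-trans (+-monoˡ-≤ (x + x) (≤-trans 1≤x (≤-reflexive (sym (*-identityˡ x))))) (≤-reflexive (a₁ x)))

m≤2q[m/q] : ∀ x q → {{_ : NonZero q}} → 1 ≤ x DM./ q → x ≤ 2 * q * (x DM./ q)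
m≤2q[m/q] x q 1≤Y = begin
  x                                ≡⟨ DM.m≡m%n+[m/n]*n x q ⟩
  x DM.% q + Y * q                 ≤⟨ +-monoˡ-≤ (Y * q) (≤-trans (<⇒≤ (DM.m%n<n x q))
                                       (≤-trans (≤-reflexive (sym (*-identityˡ q))) (*-monoˡ-≤ q 1≤Y))) ⟩
  Y * q + Y * q                    ≡⟨ arith Y q ⟩
  2 * q * Y                        ∎
  where
  open ≤-Reasoning
  Y = x DM./ q
  arith : ∀ Y q → Y * q + Y * q ≡ 2 * q * Y
  arith = ℕ-Ring.solve-∀

-- Proportions for an arbitrary sieve

module _ (d : ℕ) (0<d : 0 < d) (𝒮 : Sieve d) where
  open Sieve 𝒮

  good-periodic : ∀ M → Periodic (modulus d M) (ind ∘ good? M)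
  good-periodic M v w h = ≤-antisym (ind-mono (good? M v) (good? M w) (transfer v w h))
    (ind-mono (good? M w) (good? M v) (transfer w v (mod-sym ∘ h)))
    where
    transfer : ∀ v w → (∀ k → toForm v k ≡ toForm w k mod (modulus d M)) → Good M v → Good M w
    transfer v w h good {p} p<1+M pp bad =
      good p<1+M pp (bad-mod (∣-modulus d M pp (≤-pred p<1+M)) w v (mod-sym ∘ h) bad)

  proportion-at : ∀ K M p₀ Nτ → bound ≤ M → Prime p₀ → M < p₀ → TailSmall d (2 * K) M ((d + d) ℕ.! + p₀) Nτ →
    ∀ x → 1 + (Nτ + (2 * K + 2 * K * (size d * modulus d M))) ≤ x →
    ∀ l → Unique l → (∀ v → (v ∈ l) ⇔ (Solution v × height v ≤ x)) →
    (K * (List.length l * modulus d M ^ size d)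
      ≤ K * (sumL (residues (modulus d M) (size d)) (ind ∘ good? M) * volume (halfBox d x)) + modulus d M ^ size d * volume (halfBox d x)) ×
    (K * (sumL (residues (modulus d M) (size d)) (ind ∘ good? M) * volume (halfBox d x))
      ≤ K * (List.length l * modulus d M ^ size d) + modulus d M ^ size d * volume (halfBox d x))
  proportion-at K M p₀ Nτ S≤M pp₀ M<p₀ small x N≤x l uniq l⇔ =
    combine-estimates K (List.length l) (sumL (box (halfBox d x)) (ind ∘ good? M)) (volume (slice d x))
      (sumL (box (halfBox d x)) (tailWeight d M Z)) V r D E
      (upper-count d 0<d 𝒮 x M l uniq (λ v → Equivalence.to (l⇔ v)))
      (lower-count d 0<d 𝒮 x l (λ v sol h → Equivalence.from (l⇔ v) (sol , h)) pp₀ M Z S≤M M<p₀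
        (≤-trans (m≤n+m p₀ (C * x)) (m≤n+m Z M)) (m≤m+n (C * x) p₀) (box (halfBox d x)) (halfBox-subHalfBox d x))
      (count-periodic q (modulus>0 d M) (halfBox d x) (halfBox-steps d x) (ind ∘ good? M) (λ v → ind≤1 (good? M v)) (good-periodic M))
      slice-small
      (small (halfBox d x) 1 x (suc (x + x)) (halfBox-sides d x) (s≤s z≤n)
        (λ pp _ h → Pr.¬prime[1] (subst Prime (Div.∣1⇒≡1 h) pp)) x Z
        (≤-trans (m≤m+n Nτ _) N'≤x) ≤-refl (≤-trans (m≤m+n x x) (n≤1+n _)) Z≤Rx)
      error-small
    where
    open ≤-Reasoning
    C = (d + d) ℕ.!
    q = modulus d M
    r = sumL (residues q (size d)) (ind ∘ good? M)
    D = q ^ size d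
    -- The part `C * x` covers every prime whose 2d-th power divides a nonzero resultant at height
    -- x; the summand `p₀` puts the auxiliary prime into the range.
    Z = C * x + p₀
    V = volume (halfBox d x)
    E = boundaryError q (halfBox d x)
    N'≤x : Nτ + (2 * K + 2 * K * (size d * q)) ≤ x
    N'≤x = ≤-trans (n≤1+n _) N≤x
    1≤x : 1 ≤ x
    1≤x = ≤-trans (s≤s z≤n) N≤x
    Z≤Rx : Z ≤ (C + p₀) * x
    Z≤Rx = ≤-trans (+-monoʳ-≤ (C * x) (≤-trans (≤-reflexive (sym (*-identityʳ p₀))) (*-monoʳ-≤ p₀ 1≤x)))
      (≤-reflexive (sym (*-distribʳ-+ x C p₀)))
    N₂≤x : 2 * K + 2 * K * (size d * q) ≤ x
    N₂≤x = ≤-trans (m≤n+m _ Nτ) N'≤x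
    slice-small : 2 * K * volume (slice d x) ≤ V
    slice-small = ≤-trans (*-monoˡ-≤ (volume (slice d x)) (≤-trans (m≤m+n (2 * K) _) N₂≤x))
      (≤-reflexive (sym (trans (volume-∷ (ap (+ 1) 1 x) (slice d x)) (cong (_* volume (slice d x)) (length-ap (+ 1) 1 x)))))
    a₁ : ∀ K E x → x * (2 * K * E) ≡ 2 * K * (E * x)
    a₁ = ℕ-Ring.solve-∀
    a₂ : ∀ K n q D V → 2 * K * (n * (q * D * V)) ≡ 2 * K * (n * q) * (D * V)
    a₂ = ℕ-Ring.solve-∀
    error-small : 2 * K * E ≤ D * V
    error-small = *-cancelˡ-≤ x {{ℕ.>-nonZero 1≤x}} (begin
      x * (2 * K * E)                   ≡⟨ a₁ K E x ⟩
      2 * K * (E * x)                   ≤⟨ *-monoʳ-≤ (2 * K) (boundaryError-≤ q (halfBox d x) (halfBox-steps d x)) ⟩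
      2 * K * (size d * (q * D * V))    ≡⟨ a₂ K (size d) q D V ⟩
      2 * K * (size d * q) * (D * V)    ≤⟨ *-monoˡ-≤ (D * V) (≤-trans (m≤n+m _ (2 * K)) N₂≤x) ⟩
      x * (D * V)                       ∎)

  proportion : ∀ K → ∃ λ r → ∃ λ D → ∃ λ N → 0 < D × ApproximateProportion d Solution K r D N
  proportion K = from-tail (tail-small d 0<d (2 * K))
    where
    Goal : Set
    Goal = ∃ λ r → ∃ λ D → ∃ λ N → 0 < D × ApproximateProportion d Solution K r D N
    from-small : ∀ M p₀ → bound ≤ M → Prime p₀ → M < p₀ → (∃ λ N → TailSmall d (2 * K) M ((d + d) ℕ.! + p₀) N) → Goal
    from-small M p₀ S≤M pp₀ M<p₀ (Nτ , small) =
      sumL (residues (modulus d M) (size d)) (ind ∘ good? M) , modulus d M ^ size d ,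
      1 + (Nτ + (2 * K + 2 * K * (size d * modulus d M))) ,
      m^n>0 (modulus d M) {{ℕ.>-nonZero (modulus>0 d M)}} (size d) ,
      λ { x N≤x s (l , uniq , l⇔ , refl) → proportion-at K M p₀ Nτ S≤M pp₀ M<p₀ small x N≤x l uniq l⇔ }
    from-prime : ∀ M → bound ≤ M → (∃ λ p → Prime p × M < p) → (∀ R → ∃ λ N → TailSmall d (2 * K) M R N) → Goal
    from-prime M S≤M (p₀ , pp₀ , M<p₀) tail = from-small M p₀ S≤M pp₀ M<p₀ (tail ((d + d) ℕ.! + p₀))
    from-tail : (∃ λ M₀ → ∀ M → M₀ ≤ M → ∀ R → ∃ λ N → TailSmall d (2 * K) M R N) → Goal
    from-tail (M₀ , tail) = from-prime (M₀ + bound) (m≤n+m bound M₀) (prime-above (M₀ + bound)) (tail (M₀ + bound) (m≤m+n M₀ bound))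

  -- The points congruent to the seed modulo (M!)^(2d) are good at all
  -- primes up to M, and at most half of them are lost at larger primes.
  positive-at : (∀ p → Prime p → ¬ Bad p (seed d)) →
    ∀ M p₀ Nτ → bound ≤ M → Prime p₀ → M < p₀ → TailSmall d 2 M (2 * (d + d) ℕ.! * modulus d M + p₀) Nτ →
    ∀ x Y → suc Nτ ≤ Y → Y * modulus d M ≤ x → x ≤ 2 * modulus d M * Y →
    ∀ l → Unique l → (∀ v → (v ∈ l) ⇔ (Solution v × height v ≤ x)) →
    volume (halfBox d x) ≤ (6 * modulus d M) ^ size d * 2 * List.length l
  positive-at seed-good M p₀ Nτ S≤M pp₀ M<p₀ small x Y N<Y Yq≤x x≤2qY l uniq l⇔ = begin
    volume (halfBox d x)             ≤⟨ volume-halfBox-≤ d q Y x 1≤x x≤2qY ⟩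
    (6 * q) ^ size d * V             ≤⟨ *-monoʳ-≤ ((6 * q) ^ size d) V≤2s ⟩
    (6 * q) ^ size d * (2 * s)       ≡⟨ sym (*-assoc ((6 * q) ^ size d) 2 s) ⟩
    (6 * q) ^ size d * 2 * s         ∎
    where
    open ≤-Reasoning
    C = (d + d) ℕ.!
    q = modulus d M
    s = List.length l
    Z = C * x + p₀
    V = volume (subBox d q Y)
    T = sumL (box (subBox d q Y)) (tailWeight d M Z)
    1≤Y : 1 ≤ Y
    1≤Y = ≤-trans (s≤s z≤n) N<Y
    1≤x : 1 ≤ x
    1≤x = ≤-trans (*-mono-≤ 1≤Y (modulus>0 d M)) Yq≤x
    good : ∀ v → v ∈ box (subBox d q Y) → Good M v
    good v v∈ {p} p<1+M pp bad =
      seed-good p pp (bad-mod (∣-modulus d M pp (≤-pred p<1+M)) v (seed d) (subBox-seed d 0<d q Y v v∈) bad)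
    V≤s+T : V ≤ s + T
    V≤s+T = ≤-trans (sumL-mono (box (subBox d q Y)) (λ v v∈ → ≤-reflexive (sym (ind-yes (good? M v) (good v v∈)))))
      (lower-count d 0<d 𝒮 x l (λ v sol h → Equivalence.from (l⇔ v) (sol , h)) pp₀ M Z S≤M M<p₀
        (≤-trans (m≤n+m p₀ (C * x)) (m≤n+m Z M)) (m≤m+n (C * x) p₀) (box (subBox d q Y))
        (subBox-subHalfBox d q Y x (modulus>0 d M) Yq≤x))
    a₁ : ∀ C q Y p → C * (2 * q * Y) + p * Y ≡ (2 * C * q + p) * Y
    a₁ = ℕ-Ring.solve-∀
    Z≤RY : Z ≤ (2 * C * q + p₀) * Y
    Z≤RY = ≤-trans (+-mono-≤ (*-monoʳ-≤ C x≤2qY) (≤-trans (≤-reflexive (sym (*-identityʳ p₀))) (*-monoʳ-≤ p₀ 1≤Y)))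
      (≤-reflexive (a₁ C q Y p₀))
    2T≤V : 2 * T ≤ V
    2T≤V = small (subBox d q Y) q Y Y (subBox-sides d q Y) (modulus>0 d M) (∤-modulus d M) Y Z
      (≤-trans (n≤1+n _) N<Y) ≤-refl ≤-refl Z≤RY
    a₂ : ∀ s T → s + T + (s + T) ≡ 2 * s + 2 * T
    a₂ = ℕ-Ring.solve-∀
    V≤2s : V ≤ 2 * s
    V≤2s = +-cancelʳ-≤ V V (2 * s) (begin
      V + V             ≤⟨ +-mono-≤ V≤s+T V≤s+T ⟩
      s + T + (s + T)   ≡⟨ a₂ s T ⟩
      2 * s + 2 * T     ≤⟨ +-monoʳ-≤ (2 * s) 2T≤V ⟩
      2 * s + V         ∎)

  positive-proportion : (∀ p → Prime p → ¬ Bad p (seed d)) →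
    ∃ λ m → ∃ λ N → ∀ x → N ≤ x → ∀ s → CountH {d} Solution x s → volume (halfBox d x) ≤ m * s
  positive-proportion seed-good = from-tail (tail-small d 0<d 2)
    where
    Goal : Set
    Goal = ∃ λ m → ∃ λ N → ∀ x → N ≤ x → ∀ s → CountH {d} Solution x s → volume (halfBox d x) ≤ m * s
    quotient : ∀ n q x .{{_ : NonZero q}} → n * q ≤ x → n ≤ x DM./ q
    quotient n q x h = ≤-trans (≤-reflexive (sym (DM.m*n/n≡m n q))) (DM./-monoˡ-≤ q h)
    from-small : ∀ M p₀ → bound ≤ M → Prime p₀ → M < p₀ →
      (∃ λ N → TailSmall d 2 M (2 * (d + d) ℕ.! * modulus d M + p₀) N) → Goal
    from-small M p₀ S≤M pp₀ M<p₀ (Nτ , small) =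
      (6 * modulus d M) ^ size d * 2 , suc Nτ * modulus d M ,
      λ { x N≤x s (l , uniq , l⇔ , refl) →
            positive-at seed-good M p₀ Nτ S≤M pp₀ M<p₀ small x (x DM./ modulus d M)
              (quotient (suc Nτ) (modulus d M) x N≤x) (DM.m/n*n≤m x (modulus d M))
              (m≤2q[m/q] x (modulus d M) (≤-trans (s≤s z≤n) (quotient (suc Nτ) (modulus d M) x N≤x))) l uniq l⇔ }
      where instance q≢0 = ℕ.>-nonZero (modulus>0 d M)
    from-prime : ∀ M → bound ≤ M → (∃ λ p → Prime p × M < p) → (∀ R → ∃ λ N → TailSmall d 2 M R N) → Goal
    from-prime M S≤M (p₀ , pp₀ , M<p₀) tail = from-small M p₀ S≤M pp₀ M<p₀ (tail (2 * (d + d) ℕ.! * modulus d M + p₀))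
    from-tail : (∃ λ M₀ → ∀ M → M₀ ≤ M → ∀ R → ∃ λ N → TailSmall d 2 M R N) → Goal
    from-tail (M₀ , tail) = from-prime (M₀ + bound) (m≤n+m bound M₀) (prime-above (M₀ + bound)) (tail (M₀ + bound) (m≤m+n M₀ bound))

-- Points and the set `W` as sieves

All⇒toForm : ∀ {n p} (v : Vec ℤ n) → All (λ a → p ∣ ℤ.∣ a ∣) (Vec.toList v) → ∀ k → p ∣ ℤ.∣ toForm v k ∣
All⇒toForm {p = p} [] _ k = p Div.∣0
All⇒toForm (a ∷ v) (h All.∷ hs) zero = h
All⇒toForm (a ∷ v) (h All.∷ hs) (suc k) = All⇒toForm v hs k

toForm⇒All : ∀ {n p} (v : Vec ℤ n) → (∀ k → p ∣ ℤ.∣ toForm v k ∣) → All (λ a → p ∣ ℤ.∣ a ∣) (Vec.toList v)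
toForm⇒All [] h = All.[]
toForm⇒All (a ∷ v) h = h 0 All.∷ toForm⇒All v (h ∘ suc)

DividesAll : ∀ {n} → ℕ → Vec ℤ n → Set
DividesAll p v = All (λ a → p ∣ ℤ.∣ a ∣) (Vec.toList v)

dividesAll? : ∀ {n} p (v : Vec ℤ n) → Dec (DividesAll p v)
dividesAll? p v = All.all? (λ a → p ∣? ℤ.∣ a ∣) (Vec.toList v)

p∣p^2d : ∀ {d} p → 0 < d → p ∣ p ^ (d + d)
p∣p^2d {suc d} p _ = Div.m∣m*n (p ^ (d + suc d))

dividesAll-mod : ∀ {n p q} → p ∣ q → (v w : Vec ℤ n) → (∀ k → toForm v k ≡ toForm w k mod q) → DividesAll p v → DividesAll p w
dividesAll-mod p∣q v w h all = toForm⇒All w (λ k → mod-∣ p∣q (mod-sym (h k)) (All⇒toForm v all k))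

gcdList-greatest : ∀ {p} xs → All (λ a → p ∣ ℤ.∣ a ∣) xs → p ∣ gcdList xs
gcdList-greatest {p} List.[] _ = p Div.∣0
gcdList-greatest (x List.∷ xs) (h All.∷ hs) = gcd-greatest h (gcdList-greatest xs hs)

gcdList≡1⇒ : ∀ {n} (v : Vec ℤ n) → gcdList (Vec.toList v) ≡ 1 → ∀ p → Prime p → ¬ DividesAll p v
gcdList≡1⇒ v e p pp all = Pr.¬prime[1] (subst Prime (Div.∣1⇒≡1 (subst (p ∣_) e (gcdList-greatest (Vec.toList v) all))) pp)

⇒gcdList≡1 : ∀ {n} (v : Vec ℤ n) → (∀ p → Prime p → ¬ DividesAll p v) → gcdList (Vec.toList v) ≡ 1
⇒gcdList≡1 v h = go (gcdList (Vec.toList v)) refl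
  where
  divisor-of-all : ∀ {p} → p ∣ gcdList (Vec.toList v) → DividesAll p v
  divisor-of-all p∣g = All.tabulate (λ a∈ → Div.∣-trans p∣g (gcdList-∣ (Vec.toList v) a∈))
  go : ∀ g → gcdList (Vec.toList v) ≡ g → gcdList (Vec.toList v) ≡ 1
  -- The gcd is 0 only if all coefficients vanish, and then 2 divides them all.
  go zero e = ⊥-elim (h 2 Pr.prime[2] (divisor-of-all (subst (2 ∣_) (sym e) (2 Div.∣0))))
  go (suc zero) e = e
  go (suc (suc g)) e = ⊥-elim (refute (prime-divisor (suc (suc g)) (s≤s (s≤s z≤n))))
    where
    refute : (∃ λ p → Prime p × p ∣ suc (suc g)) → ⊥
    refute (p , pp , p∣g) = h p pp (divisor-of-all (subst (p ∣_) (sym e) p∣g))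

pointSieve : ∀ d → 0 < d → Sieve d
pointSieve d 0<d = record
  { Bad       = DividesAll
  ; bad?      = dividesAll?
  ; bound     = 0
  ; bad-large = λ _ _ v all → inj₂ (All⇒toForm v all)
  ; bad-mod   = λ {p} h v w → dividesAll-mod (Div.∣-trans (p∣p^2d p 0<d) h) v w
  }

mapSieve : ∀ d → 0 < d → List ℕ → Sieve d
mapSieve d 0<d S = record
  { Bad       = λ p v → DividesAll p v ⊎ ((p ^ (d + d) ∣ ℤ.∣ Res {d} v ∣) ⊎ ((p ∈ S) × (p ∣ ℤ.∣ Res {d} v ∣)))
  ; bad?      = λ p v → dividesAll? p v ⊎-dec ((p ^ (d + d) ∣? ℤ.∣ Res {d} v ∣) ⊎-dec ((p ∈? S) ×-dec (p ∣? ℤ.∣ Res {d} v ∣)))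
  -- Every member of S is at most this sum, so beyond it the condition of good reduction at S
  -- imposes nothing.
  ; bound     = sumL S (λ p → p)
  ; bad-large = large
  ; bad-mod   = λ {p} h v w e → [ (λ all → inj₁ (dividesAll-mod (Div.∣-trans (p∣p^2d p 0<d) h) v w e all)) ,
      (λ res → inj₂ ([ (λ b → inj₁ (mod-∣ h (mod-sym (Res-mod d v w e)) b)) ,
                       (λ b → inj₂ (proj₁ b , mod-∣ (Div.∣-trans (p∣p^2d p 0<d) h) (mod-sym (Res-mod d v w e)) (proj₂ b))) ]′ res)) ]′
  }
  where
  large : ∀ {p} → Prime p → sumL S (λ p → p) < p → ∀ v →
    DividesAll p v ⊎ ((p ^ (d + d) ∣ ℤ.∣ Res {d} v ∣) ⊎ ((p ∈ S) × (p ∣ ℤ.∣ Res {d} v ∣))) →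
    (p ^ (d + d) ∣ ℤ.∣ Res {d} v ∣) ⊎ (∀ k → p ∣ ℤ.∣ toForm v k ∣)
  large _ _ v (inj₁ all) = inj₂ (All⇒toForm v all)
  large _ _ v (inj₂ (inj₁ h)) = inj₁ h
  large _ lt v (inj₂ (inj₂ (p∈S , _))) = ⊥-elim (<⇒≱ lt (sumL-∈ (λ p → p) p∈S))

isPoint-solution : ∀ d (0<d : 0 < d) v → IsPoint {d} v ⇔ Sieve.Solution (pointSieve d 0<d) v
isPoint-solution d 0<d v = mk⇔ (λ { (e , pos) → pos , gcdList≡1⇒ v e }) (λ { (pos , h) → ⇒gcdList≡1 v h , pos })

W-solution : ∀ d (0<d : 0 < d) S → All Prime S → ∀ v → W d S v ⇔ Sieve.Solution (mapSieve d 0<d S) v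
W-solution d 0<d S primes v = mk⇔ to from
  where
  to : W d S v → Sieve.Solution (mapSieve d 0<d S) v
  to ((e , pos) , _ , free , good) = pos , λ p pp → [ gcdList≡1⇒ v e p pp ,
    [ free p pp , (λ b → All.lookup good (proj₁ b) (proj₂ b)) ]′ ]′
  from : Sieve.Solution (mapSieve d 0<d S) v → W d S v
  from (pos , h) = (⇒gcdList≡1 v (λ p pp → h p pp ∘ inj₁) , pos) ,
    -- A zero resultant would be divisible by 2^(2d), contrary to the condition at the prime 2.
    (λ z → h 2 Pr.prime[2] (inj₂ (inj₁ (subst (λ r → 2 ^ (d + d) ∣ ℤ.∣ r ∣) (sym z) ((2 ^ (d + d)) Div.∣0))))) ,
    (λ p pp → h p pp ∘ inj₂ ∘ inj₁) ,
    All.tabulate (λ {p} p∈S p∣R → h p (All.lookup primes p∈S) (inj₂ (inj₂ (p∈S , p∣R))))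

countH-resp : ∀ {d} {P P' : Coeffs d → Set} → (∀ v → P v ⇔ P' v) → ∀ {x s} → CountH {d} P x s → CountH {d} P' x s
countH-resp P⇔P' (l , uniq , l⇔ , e) = l , uniq ,
  (λ v → mk⇔ (λ v∈ → let (p , h) = Equivalence.to (l⇔ v) v∈ in Equivalence.to (P⇔P' v) p , h)
             (λ { (p , h) → Equivalence.from (l⇔ v) (Equivalence.from (P⇔P' v) p , h) })) , e

seed-coefficient : ∀ d k → k < size d → toForm (seed d) k ≡ seedCoefficient d k
seed-coefficient d k = toForm-build (size d) (seedCoefficient d) k

Res-seed : ∀ d → Res {d} (seed d) ≡ + 1
Res-seed d = begin
  Res {d} (seed d)                    ≡⟨ Res-toForm d (seed d) ⟩
  resF d (toForm (seed d)) (upper (suc d) (seed d))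
    ≡⟨ resF-cong d {toForm (seed d)} {toForm (seed d)} {upper (suc d) (seed d)} {oneF} (λ _ _ → refl) upper-seed ⟩
  resF d (toForm (seed d)) oneF       ≡⟨ resF-oneF d (toForm (seed d)) ⟩
  toForm (seed d) d ℤ.^ d             ≡⟨ cong (ℤ._^ d) (trans (seed-coefficient d d (d<size d)) (cong +_ (cong₂ _+_
                                           (ind-yes (d ℕ.≟ d) refl) (ind-no (d ℕ.≟ suc d) (<⇒≢ (n<1+n d)))))) ⟩
  (+ 1) ℤ.^ d                         ≡⟨ ℤₚ.^-zeroˡ d ⟩
  + 1                                 ∎
  where
  open ≡-Reasoning
  upper-seed : ∀ k → k ≤ d → upper (suc d) (seed d) k ≡ oneF k
  upper-seed zero _ = trans (cong (toForm (seed d)) (+-identityʳ (suc d))) (trans (seed-coefficient d (suc d) (1+d<size d))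
    (cong +_ (cong₂ _+_ (ind-no (suc d ℕ.≟ d) (>⇒≢ (n<1+n d))) (ind-yes (suc d ℕ.≟ suc d) refl))))
  upper-seed (suc k) k<d = trans (seed-coefficient d (suc d + suc k) (s≤s (+-monoʳ-< d (s≤s k<d))))
    (cong +_ (cong₂ _+_ (ind-no (suc d + suc k ℕ.≟ d) (>⇒≢ (s≤s (m≤m+n d (suc k)))))
                        (ind-no (suc d + suc k ℕ.≟ suc d) (>⇒≢ (m<m+n (suc d) (s≤s z≤n))))))

1-not-divisible : ∀ {p q z} → Prime p → p ∣ q → z ≡ + 1 → ¬ (q ∣ ℤ.∣ z ∣)
1-not-divisible pp p∣q e h = Pr.¬prime[1] (subst Prime (Div.∣1⇒≡1 (Div.∣-trans p∣q (subst (λ z → _ ∣ ℤ.∣ z ∣) e h))) pp)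

seed-primitive : ∀ d p → Prime p → ¬ DividesAll p (seed d)
seed-primitive d p pp all = 1-not-divisible pp Div.∣-refl (trans (seed-coefficient d d (d<size d)) (cong +_ (cong₂ _+_
  (ind-yes (d ℕ.≟ d) refl) (ind-no (d ℕ.≟ suc d) (<⇒≢ (n<1+n d)))))) (All⇒toForm (seed d) all d)

seed-good : ∀ d (0<d : 0 < d) S p → Prime p → ¬ Sieve.Bad (mapSieve d 0<d S) p (seed d)
seed-good d 0<d S p pp (inj₁ all) = seed-primitive d p pp all
seed-good d 0<d S p pp (inj₂ (inj₁ h)) = 1-not-divisible pp (p∣p^2d p 0<d) (Res-seed d) h
seed-good d 0<d S p pp (inj₂ (inj₂ (_ , h))) = 1-not-divisible pp Div.∣-refl (Res-seed d) h

-- From proportions to the height density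

volume-build-> : ∀ n g → (∀ k → 0 < List.length (g k)) → 0 < volume (build n g)
volume-build-> zero g h = s≤s z≤n
volume-build-> (suc n) g h = subst (0 <_) (sym (volume-∷ (g 0) (build n (g ∘ suc))))
  (*-mono-≤ (h 0) (volume-build-> n (g ∘ suc) (h ∘ suc)))

volume-halfBox-> : ∀ d x → 1 ≤ x → 0 < volume (halfBox d x)
volume-halfBox-> d x 1≤x = volume-build-> (size d) (halfSide x) nonempty
  where
  nonempty : ∀ k → 0 < List.length (halfSide x k)
  nonempty zero = subst (0 <_) (sym (length-ap (+ 1) 1 x)) 1≤x
  nonempty (suc k) = s≤s z≤n

at-most : ∀ d → 0 < d → ∀ (𝒮 : Sieve d) x → 1 ≤ x → ∀ s → CountH {d} (Sieve.Solution 𝒮) x s → s ≤ 2 * volume (halfBox d x)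
at-most d 0<d 𝒮 x 1≤x s (l , uniq , l⇔ , refl) = begin
  List.length l
    ≤⟨ upper-count d 0<d 𝒮 x 0 l uniq (λ v → Equivalence.to (l⇔ v)) ⟩
  sumL (box (halfBox d x)) (ind ∘ Sieve.good? 𝒮 0) + volume (slice d x)
    ≤⟨ +-mono-≤ (sumL-mono (box (halfBox d x)) (λ v _ → ind≤1 (Sieve.good? 𝒮 0 v))) slice≤ ⟩
  V + V
    ≡⟨ cong (ℕ._+_ V) (sym (+-identityʳ V)) ⟩
  2 * V ∎
  where
  open ≤-Reasoning
  V = volume (halfBox d x)
  slice≤ : volume (slice d x) ≤ V
  slice≤ = ≤-trans (≤-reflexive (sym (*-identityˡ _))) (≤-trans (*-monoˡ-≤ (volume (slice d x)) 1≤x)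
    (≤-reflexive (sym (trans (volume-∷ (ap (+ 1) 1 x) (slice d x)) (cong (_* volume (slice d x)) (length-ap (+ 1) 1 x))))))

-- The proportions at two heights with volumes V and V' both approximate r / D.
compare-proportions : ∀ K r D s V s' V' → 0 < D →
  K * (s * D) ≤ K * (r * V) + D * V → K * (r * V') ≤ K * (s' * D) + D * V' →
  K * (s * V') ≤ K * (s' * V) + 2 * (V * V')
compare-proportions K r D s V s' V' 0<D h h' = *-cancelˡ-≤ D {{ℕ.>-nonZero 0<D}} (begin
  D * (K * (s * V'))                               ≡⟨ a₁ D K s V' ⟩
  V' * (K * (s * D))                               ≤⟨ *-monoʳ-≤ V' h ⟩
  V' * (K * (r * V) + D * V)                       ≡⟨ a₂ V' K r V D ⟩
  V * (K * (r * V')) + D * (V * V')                ≤⟨ +-monoˡ-≤ (D * (V * V')) (*-monoʳ-≤ V h') ⟩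
  V * (K * (s' * D) + D * V') + D * (V * V')       ≡⟨ a₃ V K s' D V' ⟩
  D * (K * (s' * V) + 2 * (V * V'))                ∎)
  where
  open ≤-Reasoning
  a₁ : ∀ D K s V' → D * (K * (s * V')) ≡ V' * (K * (s * D))
  a₁ = ℕ-Ring.solve-∀
  a₂ : ∀ V' K r V D → V' * (K * (r * V) + D * V) ≡ V * (K * (r * V')) + D * (V * V')
  a₂ = ℕ-Ring.solve-∀
  a₃ : ∀ V K s' D V' → V * (K * (s' * D) + D * V') + D * (V * V') ≡ D * (K * (s' * V) + 2 * (V * V'))
  a₃ = ℕ-Ring.solve-∀

-- The ratio s/t is compared with s'/t' through s/V and t/V. Each of the two errors `2 * (V * V')`
-- is multiplied by a count that is at most twice a volume, giving 4 + 4 = 8, and `m` converts an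
-- error relative to volumes into one relative to t t'.
compare-ratios : ∀ K m s t V s' t' V' → 0 < V → 0 < V' → s' ≤ 2 * V' → t' ≤ 2 * V' → V ≤ m * t → V' ≤ m * t' →
  K * (s * V') ≤ K * (s' * V) + 2 * (V * V') → K * (t' * V) ≤ K * (t * V') + 2 * (V' * V) →
  K * (s * t') ≤ K * (s' * t) + 8 * (m * m) * (t * t')
compare-ratios K m s t V s' t' V' 0<V 0<V' s'≤ t'≤ V≤ V'≤ h h' = *-cancelˡ-≤ (V * V') {{ℕ.>-nonZero (*-mono-< 0<V 0<V')}} (begin
  V * V' * (K * (s * t'))
    ≡⟨ a₁ V V' K s t' ⟩
  V * t' * (K * (s * V'))
    ≤⟨ *-monoʳ-≤ (V * t') h ⟩
  V * t' * (K * (s' * V) + 2 * (V * V'))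
    ≡⟨ a₂ V t' K s' V' ⟩
  s' * V * (K * (t' * V)) + 2 * (V * V') * (V * t')
    ≤⟨ +-mono-≤ (*-monoʳ-≤ (s' * V) h') (*-monoʳ-≤ (2 * (V * V')) (*-monoʳ-≤ V t'≤)) ⟩
  s' * V * (K * (t * V') + 2 * (V' * V)) + 2 * (V * V') * (V * (2 * V'))
    ≡⟨ a₃ s' V K t V' ⟩
  V * V' * (K * (s' * t)) + 2 * (V * V') * (V * s') + 4 * (V * V') * (V * V')
    ≤⟨ +-monoˡ-≤ (4 * (V * V') * (V * V')) (+-monoʳ-≤ (V * V' * (K * (s' * t))) (*-monoʳ-≤ (2 * (V * V')) (*-monoʳ-≤ V s'≤))) ⟩
  V * V' * (K * (s' * t)) + 2 * (V * V') * (V * (2 * V')) + 4 * (V * V') * (V * V')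
    ≡⟨ a₄ V V' (K * (s' * t)) ⟩
  V * V' * (K * (s' * t) + 8 * (V * V'))
    ≤⟨ *-monoʳ-≤ (V * V') (+-monoʳ-≤ (K * (s' * t)) (≤-trans (*-monoʳ-≤ 8 (*-mono-≤ V≤ V'≤)) (≤-reflexive (a₅ m t t')))) ⟩
  V * V' * (K * (s' * t) + 8 * (m * m) * (t * t')) ∎)
  where
  open ≤-Reasoning
  a₁ : ∀ V V' K s t' → V * V' * (K * (s * t')) ≡ V * t' * (K * (s * V'))
  a₁ = ℕ-Ring.solve-∀
  a₂ : ∀ V t' K s' V' → V * t' * (K * (s' * V) + 2 * (V * V')) ≡ s' * V * (K * (t' * V)) + 2 * (V * V') * (V * t')
  a₂ = ℕ-Ring.solve-∀
  a₃ : ∀ s' V K t V' → s' * V * (K * (t * V') + 2 * (V' * V)) + 2 * (V * V') * (V * (2 * V'))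
    ≡ V * V' * (K * (s' * t)) + 2 * (V * V') * (V * s') + 4 * (V * V') * (V * V')
  a₃ = ℕ-Ring.solve-∀
  a₄ : ∀ V V' x → V * V' * x + 2 * (V * V') * (V * (2 * V')) + 4 * (V * V') * (V * V') ≡ V * V' * (x + 8 * (V * V'))
  a₄ = ℕ-Ring.solve-∀
  a₅ : ∀ m t t' → 8 * (m * t * (m * t')) ≡ 8 * (m * m) * (t * t')
  a₅ = ℕ-Ring.solve-∀

∣-∣-bound : ∀ K a b E → K * a ≤ K * b + E → K * b ≤ K * a + E → K * ℕ.∣ a - b ∣ ≤ E
∣-∣-bound K a b E h h' = subst (_≤ E) (sym (*-distribˡ-∣-∣ K a b)) (go (∣m-n∣≡[m∸n]∨[n∸m] (K * a) (K * b)))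
  where
  go : (ℕ.∣ K * a - K * b ∣ ≡ K * a ∸ K * b) ⊎ (ℕ.∣ K * a - K * b ∣ ≡ K * b ∸ K * a) → ℕ.∣ K * a - K * b ∣ ≤ E
  go (inj₁ e) = ≤-trans (≤-reflexive e) (m≤n+o⇒m∸n≤o (K * a) (K * b) h)
  go (inj₂ e) = ≤-trans (≤-reflexive e) (m≤n+o⇒m∸n≤o (K * b) (K * a) h')

module _ (d : ℕ) (0<d : 0 < d) (𝒮 𝒯 : Sieve d)
  (seed-𝒮 : ∀ p → Prime p → ¬ Sieve.Bad 𝒮 p (seed d)) (seed-𝒯 : ∀ p → Prime p → ¬ Sieve.Bad 𝒯 p (seed d)) where

  private
    V = λ x → volume (halfBox d x)

  ratio-cauchy : ∀ k → ∃ λ N → ∀ x y → N ≤ x → N ≤ y → ∀ sx tx sy ty →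
    CountH {d} (Sieve.Solution 𝒮) x sx → CountH {d} (Sieve.Solution 𝒯) x tx →
    CountH {d} (Sieve.Solution 𝒮) y sy → CountH {d} (Sieve.Solution 𝒯) y ty →
    suc k * ℕ.∣ sx * ty - sy * tx ∣ < tx * ty
  ratio-cauchy k = from (positive-proportion d 0<d 𝒯 seed-𝒯)
    where
    Goal : Set
    Goal = ∃ λ N → ∀ x y → N ≤ x → N ≤ y → ∀ sx tx sy ty →
      CountH {d} (Sieve.Solution 𝒮) x sx → CountH {d} (Sieve.Solution 𝒯) x tx →
      CountH {d} (Sieve.Solution 𝒮) y sy → CountH {d} (Sieve.Solution 𝒯) y ty →
      suc k * ℕ.∣ sx * ty - sy * tx ∣ < tx * ty
    positive-count : ∀ {m t V} → 0 < V → V ≤ m * t → 0 < t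
    positive-count {m} {zero} 0<V h = ⊥-elim (<⇒≱ 0<V (≤-trans h (≤-reflexive (*-zeroʳ m))))
    positive-count {t = suc t} _ _ = s≤s z≤n
    with-proportions : ∀ m N₀ → (∀ x → N₀ ≤ x → ∀ t → CountH {d} (Sieve.Solution 𝒯) x t → V x ≤ m * t) →
      let K = suc k * suc (8 * (m * m)) in
      (∃ λ r → ∃ λ D → ∃ λ N → 0 < D × ApproximateProportion d (Sieve.Solution 𝒮) K r D N) →
      (∃ λ r → ∃ λ D → ∃ λ N → 0 < D × ApproximateProportion d (Sieve.Solution 𝒯) K r D N) → Goal
    with-proportions m N₀ pos (r₁ , D₁ , N₁ , 0<D₁ , near₁) (r₂ , D₂ , N₂ , 0<D₂ , near₂) = 1 + (N₀ + (N₁ + N₂)) , bound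
      where
      E = 8 * (m * m)
      -- The precision depends on m, so the positive proportion of points is established before the
      -- proportions are approximated. Using `suc E` instead of `E` makes the final inequality
      -- strict, as tx and ty are positive.
      K = suc k * suc E
      part₀ : ∀ {x} → 1 + (N₀ + (N₁ + N₂)) ≤ x → N₀ ≤ x
      part₀ h = ≤-trans (m≤m+n N₀ _) (≤-trans (n≤1+n _) h)
      part₁ : ∀ {x} → 1 + (N₀ + (N₁ + N₂)) ≤ x → N₁ ≤ x
      part₁ h = ≤-trans (m≤m+n N₁ N₂) (≤-trans (m≤n+m _ N₀) (≤-trans (n≤1+n _) h))
      part₂ : ∀ {x} → 1 + (N₀ + (N₁ + N₂)) ≤ x → N₂ ≤ x
      part₂ h = ≤-trans (m≤n+m N₂ N₁) (≤-trans (m≤n+m _ N₀) (≤-trans (n≤1+n _) h))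
      one-sided : ∀ x y → 1 + (N₀ + (N₁ + N₂)) ≤ x → 1 + (N₀ + (N₁ + N₂)) ≤ y → ∀ sx tx sy ty →
        CountH {d} (Sieve.Solution 𝒮) x sx → CountH {d} (Sieve.Solution 𝒯) x tx →
        CountH {d} (Sieve.Solution 𝒮) y sy → CountH {d} (Sieve.Solution 𝒯) y ty →
        K * (sx * ty) ≤ K * (sy * tx) + E * (tx * ty)
      one-sided x y hx hy sx tx sy ty csx ctx csy cty = compare-ratios K m sx tx (V x) sy ty (V y)
        (volume-halfBox-> d x 1≤x) (volume-halfBox-> d y 1≤y)
        (at-most d 0<d 𝒮 y 1≤y sy csy) (at-most d 0<d 𝒯 y 1≤y ty cty)
        (pos x (part₀ hx) tx ctx) (pos y (part₀ hy) ty cty)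
        (compare-proportions K r₁ D₁ sx (V x) sy (V y) 0<D₁ (proj₁ (near₁ x (part₁ hx) sx csx)) (proj₂ (near₁ y (part₁ hy) sy csy)))
        (compare-proportions K r₂ D₂ ty (V y) tx (V x) 0<D₂ (proj₁ (near₂ y (part₂ hy) ty cty)) (proj₂ (near₂ x (part₂ hx) tx ctx)))
        where
        1≤x = ≤-trans (s≤s z≤n) hx
        1≤y = ≤-trans (s≤s z≤n) hy
      bound : ∀ x y → 1 + (N₀ + (N₁ + N₂)) ≤ x → 1 + (N₀ + (N₁ + N₂)) ≤ y → ∀ sx tx sy ty →
        CountH {d} (Sieve.Solution 𝒮) x sx → CountH {d} (Sieve.Solution 𝒯) x tx →
        CountH {d} (Sieve.Solution 𝒮) y sy → CountH {d} (Sieve.Solution 𝒯) y ty →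
        suc k * ℕ.∣ sx * ty - sy * tx ∣ < tx * ty
      bound x y hx hy sx tx sy ty csx ctx csy cty = *-cancelˡ-< (suc E) _ _ (begin-strict
        suc E * (suc k * Δ)   ≡⟨ a (suc E) (suc k) Δ ⟩
        K * Δ                 ≤⟨ ∣-∣-bound K (sx * ty) (sy * tx) (E * (tx * ty)) (one-sided x y hx hy sx tx sy ty csx ctx csy cty)
                                   (subst (λ z → K * (sy * tx) ≤ K * (sx * ty) + E * z) (*-comm ty tx)
                                     (one-sided y x hy hx sy ty sx tx csy cty csx ctx)) ⟩
        E * (tx * ty)         <⟨ *-monoˡ-< (tx * ty) {{ℕ.>-nonZero (*-mono-< 0<tx 0<ty)}} (n<1+n E) ⟩
        suc E * (tx * ty)     ∎)
        where
        open ≤-Reasoning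
        Δ = ℕ.∣ sx * ty - sy * tx ∣
        a : ∀ e k x → e * (k * x) ≡ k * e * x
        a = ℕ-Ring.solve-∀
        0<tx = positive-count {m} (volume-halfBox-> d x (≤-trans (s≤s z≤n) hx)) (pos x (part₀ hx) tx ctx)
        0<ty = positive-count {m} (volume-halfBox-> d y (≤-trans (s≤s z≤n) hy)) (pos y (part₀ hy) ty cty)
    from : (∃ λ m → ∃ λ N → ∀ x → N ≤ x → ∀ t → CountH {d} (Sieve.Solution 𝒯) x t → V x ≤ m * t) → Goal
    from (m , N₀ , pos) = with-proportions m N₀ pos (proportion d 0<d 𝒮 (suc k * suc (8 * (m * m)))) (proportion d 0<d 𝒯 (suc k * suc (8 * (m * m))))

  ratio-positive : ∃ λ m → ∃ λ N → ∀ x → N ≤ x → ∀ s t →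
    CountH {d} (Sieve.Solution 𝒮) x s → CountH {d} (Sieve.Solution 𝒯) x t → t ≤ suc m * s
  ratio-positive = from (positive-proportion d 0<d 𝒮 seed-𝒮)
    where
    from : (∃ λ m → ∃ λ N → ∀ x → N ≤ x → ∀ s → CountH {d} (Sieve.Solution 𝒮) x s → V x ≤ m * s) →
      ∃ λ m → ∃ λ N → ∀ x → N ≤ x → ∀ s t →
        CountH {d} (Sieve.Solution 𝒮) x s → CountH {d} (Sieve.Solution 𝒯) x t → t ≤ suc m * s
    from (m , N , pos) = 2 * m , suc N , λ x h s t cs ct →
      ≤-trans (at-most d 0<d 𝒯 x (≤-trans (s≤s z≤n) h) t ct)
        (≤-trans (*-monoʳ-≤ 2 (pos x (≤-trans (n≤1+n N) h) s cs))
          (≤-trans (≤-reflexive (sym (*-assoc 2 m s))) (m≤n+m (2 * m * s) s)))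

positive-density : ∀ d → 0 < d → ∀ S → All Prime S → PositiveHeightDensity d (W d S)
positive-density d 0<d S primes =
  (λ k → let (N , cauchy) = ratio-cauchy d 0<d 𝒮 𝒯 good seedPrimitive k in
    N , λ x y hx hy sx tx sy ty csx ctx csy cty → cauchy x y hx hy sx tx sy ty (to𝒮 csx) (to𝒯 ctx) (to𝒮 csy) (to𝒯 cty)) ,
  (let (m , N , bound) = ratio-positive d 0<d 𝒮 𝒯 good seedPrimitive in
    m , N , λ x h s t cs ct → bound x h s t (to𝒮 cs) (to𝒯 ct))
  where
  𝒮 = mapSieve d 0<d S
  𝒯 = pointSieve d 0<d
  good = seed-good d 0<d S
  seedPrimitive = seed-primitive d
  to𝒮 : ∀ {x s} → CountH {d} (W d S) x s → CountH {d} (Sieve.Solution 𝒮) x s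
  to𝒮 = countH-resp {d} (W-solution d 0<d S primes)
  to𝒯 : ∀ {x s} → CountH {d} (IsPoint {d}) x s → CountH {d} (Sieve.Solution 𝒯) x s
  to𝒯 = countH-resp {d} (isPoint-solution d 0<d)

theoremA : (d : ℕ) → (∃ λ k → d ≡ suc (2 * k)) → 3 ≤ d →
    (S : List ℕ) → All Prime S →
    (∀ (v : Coeffs d) → W d S v → GloballyMinimal v)
    × PositiveHeightDensity d (W d S)
theoremA d odd 3≤d S primes =
  (λ v w → globally-minimal d odd v (proj₁ (proj₂ (proj₂ w)))) ,
  positive-density d (≤-trans (s≤s z≤n) 3≤d) S primes
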